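{- Let $Y$ denote the tree with degree sequence $(1,1,1,2,3)$. If $G$ is a $191$-edge-connected graph whose number of edges is divisible by $4$, then $G$ has a $Y$-decomposition.
   Context: All graphs are finite. $Y$ is the unique tree on 5 vertices having one vertex of degree 3, one vertex of degree 2 and three leaves. A $Y$-decomposition of $G$ is a partition of the edge set of $G$ into subgraphs each isomorphic to $Y$. -}

module Defs where

open import Data.Nat using (ℕ; zero; suc; _≤_; _<ᵇ_)
open import Data.Bool using (Bool; true; false; _∧_; not; if_then_else_)
open import Data.Fin using (Fin; toℕ) renaming (zero to f0; suc to fs)
open import Data.List using (List; map; allFin)
open import Data.Nat.ListAction using (sum)
open import Data.Product using (Σ; _×_; _,_; proj₁; proj₂; ∃)
open import Data.Sum using (_⊎_)
open import Relation.Binary.PropositionalEquality using (_≡_)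
open import Function.Definitions using (Injective)

record Graph (n : ℕ) : Set where
  field
    adj    : Fin n → Fin n → Bool
    sym    : ∀ i j → adj i j ≡ adj j i
    irrefl : ∀ i → adj i i ≡ false
open Graph public

Σv : ∀ {n} → (Fin n → ℕ) → ℕ
Σv {n} f = sum (map f (allFin n))

edgeCount : ∀ {n} → Graph n → ℕ
edgeCount G = Σv λ i → Σv λ j →
  if adj G i j ∧ (toℕ i <ᵇ toℕ j) then 1 else 0

cutSize : ∀ {n} → Graph n → (Fin n → Bool) → ℕ
cutSize G S = Σv λ i → Σv λ j →
  if adj G i j ∧ (S i ∧ not (S j)) then 1 else 0

EdgeConnected : ℕ → ∀ {n} → Graph n → Set
EdgeConnected k {n} G = (S : Fin n → Bool) →
  (∃ λ i → S i ≡ true) → (∃ λ j → S j ≡ false) → k ≤ cutSize G S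

-- The tree Y on vertices 0..4: edges 0-1, 0-2, 0-3, 3-4
-- (vertex 0 has degree 3, vertex 3 degree 2, vertices 1,2,4 are leaves)
yEdge : Fin 4 → Fin 5 × Fin 5
yEdge f0                = (f0 , fs f0)
yEdge (fs f0)           = (f0 , fs (fs f0))
yEdge (fs (fs f0))      = (f0 , fs (fs (fs f0)))
yEdge (fs (fs (fs _)))  = (fs (fs (fs f0)) , fs (fs (fs (fs f0))))

record YCopy {n : ℕ} (G : Graph n) : Set where
  field
    emb     : Fin 5 → Fin n
    inj     : Injective _≡_ _≡_ emb
    isEdge  : ∀ e → adj G (emb (proj₁ (yEdge e))) (emb (proj₂ (yEdge e))) ≡ true
open YCopy public

Hits : ∀ {n} {G : Graph n} → YCopy G → Fin 4 → Fin n → Fin n → Set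
Hits c e u v =
  (emb c (proj₁ (yEdge e)) ≡ u × emb c (proj₂ (yEdge e)) ≡ v) ⊎
  (emb c (proj₁ (yEdge e)) ≡ v × emb c (proj₂ (yEdge e)) ≡ u)

YDecomposition : ∀ {n} → Graph n → Set
YDecomposition {n} G =
  Σ ℕ λ m → Σ (Fin m → YCopy G) λ cs →
    ∀ u v → adj G u v ≡ true →
      Σ (Fin m × Fin 4) λ p → Hits (cs (proj₁ p)) (proj₂ p) u v ×
        (∀ q → Hits (cs (proj₁ q)) (proj₂ q) u v → q ≡ p)

{-# OPTIONS --safe #-}

-- Let (A , B) be a maximum cut, so that every vertex set is left by at least 80 edges of the cut. Copies
-- of Y inside A or inside B are split off greedily; after that every inner edge has an endpoint with at
-- most three inner edges, its owner. All further copies of Y have their centre in A: such a copy consists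
-- of an edge J from its centre a to a vertex s of B, an edge E continuing it at s, and two edges P at a.
-- It suffices to label the cut so that at each a ∈ A the P-edges and the owned inner edges together are
-- twice as many as the J-edges, and at each b ∈ B the J-edges are as many as the E-edges and the owned
-- inner edges together; regrouping the edges at a then avoids all triangles.
--
-- Matroid intersection yields eight disjoint connected spanning subgraphs of the cut that use at most a
-- third of the edges at each a ∈ A. Two of them contain a connected Eulerian subgraph, whose edges can be
-- paired at the vertices of B so that the pairs form a connected multigraph on A. Giving one edge of each
-- pair the label J and the other the label E, with the choice made by a T-join argument and the parities
-- corrected by a third subgraph, settles the degrees in A modulo 4. Three subgraphs provide the J-edges
-- for the inner edges of B. The last two play the same game with A and B exchanged: half of the edges
-- left at each a are chosen so that every b meets evenly many, and an Eulerian orientation splits the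
-- chosen edges equally into J and E at every vertex.
module Submission where

open import Defs hiding (sym)
open import Data.Nat.Divisibility using (_∣_; divides; ∣m+n∣m⇒∣n)
open import Data.Nat.ListAction using (sum)
open import Data.Bool using (Bool; true; false; _∧_; _∨_; not; _xor_; if_then_else_)
open import Data.Bool.Properties using (xor-assoc; xor-comm; xor-same; xor-identityʳ; ∧-distribˡ-xor; ∧-distribʳ-xor; ∧-comm; ∧-identityʳ; ∧-zeroʳ; ∨-comm; not-involutive; ¬-not)
  renaming (_≟_ to _≟ᵇ_)
open import Data.Nat using (>-nonZero; ℕ; zero; suc; _+_; _*_; _∸_; _≤_; _<_; _<ᵇ_; z≤n; s≤s)
open import Data.Nat.Properties
open import Data.Nat.Tactic.RingSolver using (solve-∀)
open import Data.Fin using (Fin; #_; toℕ; combine; remQuot) renaming (zero to fzero; suc to fsuc)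
open import Data.Fin.Properties using (any?; toℕ-injective; remQuot-combine; combine-remQuot) renaming (_≟_ to _≟ᶠ_)
open import Data.List using (List; []; _∷_; _++_; map; concatMap; length; allFin; fromMaybe) renaming (lookup to lookupList)
open import Data.List.Properties using (length-map; length-++; map-tabulate; length-tabulate)
open import Data.Product using (∃; _×_; _,_; proj₁; proj₂; swap)
open import Data.Sum using (_⊎_; inj₁; inj₂)
open import Data.Empty using (⊥; ⊥-elim)
open import Function using (_∘_; id; const; case_of_)
open import Relation.Nullary using (¬_; Dec; yes; no; does; contradiction; ¬?; _×-dec_)
open import Relation.Nullary.Decidable using (dec-true; dec-false)
open import Relation.Binary.PropositionalEquality hiding (J)
open import Relation.Binary.Definitions using (tri<; tri≈; tri>)
open import Data.List.Relation.Unary.All.Properties using (++⁺)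
open import Data.Maybe using (Maybe; just; nothing; is-just) renaming (map to mapMaybe)
open import Data.Maybe.Properties using (just-injective)
open import Data.List.Membership.Propositional using (_∈_; _∉_; find; lose)
open import Data.List.Membership.Propositional.Properties using (∈-allFin; ∈-++⁺ˡ; ∈-++⁺ʳ; ∈-++⁻; ∈-map⁻; ∈-map⁺; ∈-lookup)
open import Data.List.Relation.Unary.Any using (Any; here; there) renaming (any? to anyList?)
open import Data.List.Relation.Unary.All using (All; []; _∷_) renaming (lookup to lookupAll; tail to tailAll; map to mapAll; all? to allList?; tabulate to tabulateAll)
open import Data.List.Relation.Unary.Unique.Propositional using (Unique)
open import Data.List.Relation.Unary.Unique.Propositional.Properties using (allFin⁺)
open import Data.List.Relation.Unary.AllPairs using ([]; _∷_)
open import Data.Vec.Functional using (updateAt)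
open import Data.Vec.Functional.Properties using (updateAt-updates; updateAt-minimal)
open import Data.Vec using (Vec; lookup) renaming (tabulate to tabulateᵛ; [] to []ᵛ; _∷_ to _∷ᵛ_)
open import Data.Vec.Properties using (lookup∘tabulate)
open import Data.Fin.Subset using (Subset)
open import Data.Fin.Subset.Properties using (anySubset?)

-- The obstacle is a congruence modulo 4 at the vertices of A. Every `J`-edge at such a vertex needs
-- two further edges there, so the vertex meets 3|J| + |E| edges, owned inner ones included. If `f`
-- of the `J`-edges are fixed in a first stage and a second stage gives j edges each to `J` and `E`,
-- then the `D` edges left for the second stage, owned ones included, must satisfy D = 2f + 4j. The
-- third subgraph only makes `D` even. Exchanging the labels of a pair at a vertex of B moves a `J`
-- from one tip of the pair to the other: `D` stays, `f` changes by one at either tip. As the pairs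
-- connect A, `f` gets the parity of D/2 everywhere, up to one global parity, which divisibility by
-- 4 settles. The constant comes from the packing. In each of eight copies of the vertex set an edge
-- lies on the boundary of at most two components. The edges at a vertex of A fall into groups of
-- three to five, of which at most one edge is used, so two thirds stay free. Cuts of 2 * 8 * 5 = 80
-- edges then suffice, and a maximum cut contains at least half of every boundary in G.

private variable
  α β : Set
  n : ℕ

-- Sums over lists and over finite index sets.

⟦_⟧ : Bool → ℕ
⟦ b ⟧ = if b then 1 else 0

infix 4 _==_

_==_ : Fin n → Fin n → Bool
i == j = does (i ≟ᶠ j)

==-refl : (i : Fin n) → (i == i) ≡ true
==-refl i = dec-true (i ≟ᶠ i) refl

==-≢ : {i j : Fin n} → i ≢ j → (i == j) ≡ false
==-≢ {i = i} {j} = dec-false (i ≟ᶠ j)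

==-≡ : {i j : Fin n} → (i == j) ≡ true → i ≡ j
==-≡ {i = i} {j} eq with i ≟ᶠ j
... | yes p = p
... | no _ with () ← eq

==-sym : (i j : Fin n) → (i == j) ≡ (j == i)
==-sym i j with i ≟ᶠ j
... | yes refl = sym (==-refl i)
... | no i≢j = sym (==-≢ (i≢j ∘ sym))

⟦⟧≤1 : ∀ b → ⟦ b ⟧ ≤ 1
⟦⟧≤1 true = ≤-refl
⟦⟧≤1 false = z≤n

Sum : (α → ℕ) → List α → ℕ
Sum f [] = 0
Sum f (x ∷ xs) = f x + Sum f xs

Sum-sum : (f : α → ℕ) (xs : List α) → sum (map f xs) ≡ Sum f xs
Sum-sum f [] = refl
Sum-sum f (x ∷ xs) = cong (f x +_) (Sum-sum f xs)

Sum-++ : (f : α → ℕ) (xs ys : List α) → Sum f (xs ++ ys) ≡ Sum f xs + Sum f ys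
Sum-++ f [] ys = refl
Sum-++ f (x ∷ xs) ys = trans (cong (f x +_) (Sum-++ f xs ys)) (sym (+-assoc (f x) _ _))

Sum-cong : {f g : α → ℕ} → (∀ x → f x ≡ g x) → ∀ xs → Sum f xs ≡ Sum g xs
Sum-cong eq [] = refl
Sum-cong eq (x ∷ xs) = cong₂ _+_ (eq x) (Sum-cong eq xs)

Sum-map : (f : β → ℕ) (h : α → β) (xs : List α) → Sum f (map h xs) ≡ Sum (f ∘ h) xs
Sum-map f h [] = refl
Sum-map f h (x ∷ xs) = cong (f (h x) +_) (Sum-map f h xs)

Sum-+ : (f g : α → ℕ) (xs : List α) → Sum (λ x → f x + g x) xs ≡ Sum f xs + Sum g xs
Sum-+ f g [] = refl
Sum-+ f g (x ∷ xs) = trans (cong (f x + g x +_) (Sum-+ f g xs)) (interchange (f x) (g x) (Sum f xs) (Sum g xs))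
  where
  interchange : ∀ a b c d → a + b + (c + d) ≡ a + c + (b + d)
  interchange = solve-∀

Sum-*ˡ : (k : ℕ) (f : α → ℕ) (xs : List α) → Sum (λ x → k * f x) xs ≡ k * Sum f xs
Sum-*ˡ k f [] = sym (*-zeroʳ k)
Sum-*ˡ k f (x ∷ xs) = trans (cong (k * f x +_) (Sum-*ˡ k f xs)) (sym (*-distribˡ-+ k (f x) (Sum f xs)))

Sum-0 : (xs : List α) → Sum (λ _ → 0) xs ≡ 0
Sum-0 [] = refl
Sum-0 (x ∷ xs) = Sum-0 xs

Sum-1 : (xs : List α) → Sum (λ _ → 1) xs ≡ length xs
Sum-1 [] = refl
Sum-1 (x ∷ xs) = cong suc (Sum-1 xs)

Sum-mono : {f g : α → ℕ} → (∀ x → f x ≤ g x) → ∀ xs → Sum f xs ≤ Sum g xs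
Sum-mono le [] = z≤n
Sum-mono le (x ∷ xs) = +-mono-≤ (le x) (Sum-mono le xs)

Sum-swap : (f : α → β → ℕ) (xs : List α) (ys : List β) →
  Sum (λ x → Sum (f x) ys) xs ≡ Sum (λ y → Sum (λ x → f x y) xs) ys
Sum-swap f [] ys = sym (Sum-0 ys)
Sum-swap f (x ∷ xs) ys = trans (cong (Sum (f x) ys +_) (Sum-swap f xs ys)) (sym (Sum-+ (f x) _ ys))

Sum-concatMap : (f : β → ℕ) (h : α → List β) (xs : List α) → Sum f (concatMap h xs) ≡ Sum (λ x → Sum f (h x)) xs
Sum-concatMap f h [] = refl
Sum-concatMap f h (x ∷ xs) = trans (Sum-++ f (h x) (concatMap h xs)) (cong (Sum f (h x) +_) (Sum-concatMap f h xs))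

opaque
  allV : List (Fin n)
  allV = allFin _

ΣF : (Fin n → ℕ) → ℕ
ΣF f = Sum f allV

opaque
  unfolding allV

  ∈-allV : (x : Fin n) → x ∈ allV
  ∈-allV = ∈-allFin

  allV-unique : Unique (allV {n})
  allV-unique {n} = allFin⁺ n

  length-allV : length (allV {n}) ≡ n
  length-allV {n} = length-tabulate {n = n} id

  ΣF-Σv : (f : Fin n → ℕ) → Σv f ≡ ΣF f
  ΣF-Σv f = Sum-sum f (allFin _)

  ΣF-suc : (f : Fin (suc n) → ℕ) → ΣF f ≡ f fzero + ΣF (f ∘ fsuc)
  ΣF-suc {n} f = cong (f fzero +_) (trans (cong (Sum f) (sym (map-tabulate id fsuc))) (Sum-map f fsuc (allFin n)))

-- The change of a sum when one value changes, written additively to avoid truncated subtraction.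
ΣF-update : (f g : Fin n → ℕ) (x : Fin n) → (∀ y → y ≢ x → f y ≡ g y) → ΣF f + g x ≡ ΣF g + f x
ΣF-update f g fzero eq rewrite ΣF-suc f | ΣF-suc g
  | Sum-cong {f = f ∘ fsuc} {g ∘ fsuc} (λ y → eq (fsuc y) λ ()) allV = lem (f fzero) (g fzero) _
  where
  lem : ∀ a b c → a + c + b ≡ b + c + a
  lem = solve-∀
ΣF-update f g (fsuc x) eq rewrite ΣF-suc f | ΣF-suc g | eq fzero (λ ()) =
  trans (+-assoc (g fzero) _ _)
    (trans (cong (g fzero +_) (ΣF-update (f ∘ fsuc) (g ∘ fsuc) x λ y y≢x → eq (fsuc y) λ where refl → y≢x refl))
      (sym (+-assoc (g fzero) _ _)))

ΣF-δ : (x : Fin n) (g : Fin n → ℕ) → ΣF (λ v → ⟦ x == v ⟧ * g v) ≡ g x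
ΣF-δ {n} x g = begin
  ΣF f ≡⟨ +-identityʳ _ ⟨
  ΣF f + 0 ≡⟨ ΣF-update f (λ _ → 0) x (λ y y≢x → cong (λ b → ⟦ b ⟧ * g y) (==-≢ (y≢x ∘ sym))) ⟩
  ΣF {n} (λ _ → 0) + f x ≡⟨ cong₂ _+_ (Sum-0 allV) (cong (λ b → ⟦ b ⟧ * g x) (==-refl x)) ⟩
  g x + 0 ≡⟨ +-identityʳ _ ⟩
  g x ∎
  where
  open ≡-Reasoning
  f = λ v → ⟦ x == v ⟧ * g v

ΣF-δ₁ : (x : Fin n) → ΣF (λ v → ⟦ x == v ⟧) ≡ 1
ΣF-δ₁ x = trans (Sum-cong (λ v → sym (*-identityʳ _)) allV) (ΣF-δ x (λ _ → 1))

fiber-sum : (f : α → ℕ) (k : α → Fin n) (xs : List α) → ΣF (λ v → Sum (λ x → ⟦ k x == v ⟧ * f x) xs) ≡ Sum f xs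
fiber-sum f k xs = trans (Sum-swap (λ v x → ⟦ k x == v ⟧ * f x) allV xs) (Sum-cong (λ x → ΣF-δ (k x) (λ _ → f x)) xs)

fiber-count : (k : α → Fin n) (xs : List α) → ΣF (λ v → Sum (λ x → ⟦ k x == v ⟧) xs) ≡ length xs
fiber-count k xs = trans (Sum-swap (λ v x → ⟦ k x == v ⟧) allV xs)
  (trans (Sum-cong (λ x → ΣF-δ₁ (k x)) xs) (Sum-1 xs))

ΣF-≤1 : (f : Fin n → ℕ) (x : Fin n) → f x ≤ ΣF f
ΣF-≤1 f x = subst (_≤ ΣF f) (ΣF-δ x f) (Sum-mono (λ v → ≤-trans (*-monoˡ-≤ (f v) (⟦⟧≤1 (x == v))) (≤-reflexive (*-identityˡ (f v)))) allV)

-- Multisets: two lists are identified when every weight function has the same total on both.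
infix 4 _≈_

record _≈_ {α : Set} (xs ys : List α) : Set where
  constructor mk
  field at : (f : α → ℕ) → Sum f xs ≡ Sum f ys
open _≈_ public

≈-refl : {xs : List α} → xs ≈ xs
≈-refl = mk λ f → refl

≈-sym : {xs ys : List α} → xs ≈ ys → ys ≈ xs
≈-sym p = mk λ f → sym (at p f)

≈-trans : {xs ys zs : List α} → xs ≈ ys → ys ≈ zs → xs ≈ zs
≈-trans p q = mk λ f → trans (at p f) (at q f)

≈-++ : {xs xs' ys ys' : List α} → xs ≈ xs' → ys ≈ ys' → xs ++ ys ≈ xs' ++ ys'
≈-++ {xs = xs} {xs'} {ys} {ys'} p q = mk λ f →
  trans (Sum-++ f xs ys) (trans (cong₂ _+_ (at p f) (at q f)) (sym (Sum-++ f xs' ys')))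

≈-length : {xs ys : List α} → xs ≈ ys → length xs ≡ length ys
≈-length {xs = xs} {ys} p = trans (sym (Sum-1 xs)) (trans (at p (λ _ → 1)) (Sum-1 ys))

extract : (p : α → Bool) (xs : List α) → 0 < Sum (⟦_⟧ ∘ p) xs →
  ∃ λ x → ∃ λ ys → p x ≡ true × xs ≈ x ∷ ys
extract p (x ∷ xs) lt with p x in eq
... | true = x , xs , eq , ≈-refl
... | false with extract p xs lt
... | y , ys , py , eqv = y , x ∷ ys , py , mk λ f → trans (cong (f x +_) (at eqv f)) (lem (f x) (f y) (Sum f ys))
  where
  lem : ∀ a b c → a + (b + c) ≡ b + (a + c)
  lem = solve-∀

-- Parities of numbers and of sums.

par : ℕ → Bool
par zero = false
par (suc n) = not (par n)

par-+ : ∀ m n → par (m + n) ≡ par m xor par n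
par-+ zero n = refl
par-+ (suc m) n rewrite par-+ m n with par m
... | true = not-invol (par n)
  where
  not-invol : ∀ b → not (not b) ≡ b
  not-invol true = refl
  not-invol false = refl
... | false = refl

par-double : ∀ m → par (m + m) ≡ false
par-double m = trans (par-+ m m) (xor-same (par m))

par-⟦⟧ : ∀ b → par ⟦ b ⟧ ≡ b
par-⟦⟧ true = refl
par-⟦⟧ false = refl

half : ∀ m → par m ≡ false → ∃ λ h → m ≡ h + h
half zero p = 0 , refl
half (suc (suc m)) p with half m (trans (sym (lem (par m))) p)
  where
  lem : ∀ b → not (not b) ≡ b
  lem true = refl
  lem false = refl
... | h , refl = suc h , cong suc (sym (+-suc h h))

par-pos : ∀ m → par m ≡ true → 0 < m
par-pos (suc m) p = s≤s z≤n

Par : (α → Bool) → List α → Bool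
Par f [] = false
Par f (x ∷ xs) = f x xor Par f xs

par-Sum : (f : α → ℕ) (xs : List α) → par (Sum f xs) ≡ Par (par ∘ f) xs
par-Sum f [] = refl
par-Sum f (x ∷ xs) = trans (par-+ (f x) (Sum f xs)) (cong (par (f x) xor_) (par-Sum f xs))

Par-cong : {f g : α → Bool} → (∀ x → f x ≡ g x) → ∀ xs → Par f xs ≡ Par g xs
Par-cong eq [] = refl
Par-cong eq (x ∷ xs) = cong₂ _xor_ (eq x) (Par-cong eq xs)

Par-Sum⟦⟧ : (f : α → Bool) (xs : List α) → Par f xs ≡ par (Sum (⟦_⟧ ∘ f) xs)
Par-Sum⟦⟧ f xs = trans (Par-cong (λ x → sym (par-⟦⟧ (f x))) xs) (sym (par-Sum (⟦_⟧ ∘ f) xs))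

xor-interchange : ∀ a b c d → (a xor b) xor (c xor d) ≡ (a xor c) xor (b xor d)
xor-interchange a b c d = begin
  (a xor b) xor (c xor d) ≡⟨ xor-assoc a b _ ⟩
  a xor (b xor (c xor d)) ≡⟨ cong (a xor_) (xor-assoc b c d) ⟨
  a xor ((b xor c) xor d) ≡⟨ cong (λ z → a xor (z xor d)) (xor-comm b c) ⟩
  a xor ((c xor b) xor d) ≡⟨ cong (a xor_) (xor-assoc c b d) ⟩
  a xor (c xor (b xor d)) ≡⟨ xor-assoc a c _ ⟨
  (a xor c) xor (b xor d) ∎
  where open ≡-Reasoning

Par-xor : (f g : α → Bool) (xs : List α) → Par (λ x → f x xor g x) xs ≡ Par f xs xor Par g xs
Par-xor f g [] = refl
Par-xor f g (x ∷ xs) = trans (cong ((f x xor g x) xor_) (Par-xor f g xs)) (xor-interchange (f x) (g x) _ _)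

Par-false : (xs : List α) → Par (λ _ → false) xs ≡ false
Par-false [] = refl
Par-false (x ∷ xs) = Par-false xs

Par-∧ : (b : Bool) (f : α → Bool) (xs : List α) → Par (λ x → b ∧ f x) xs ≡ b ∧ Par f xs
Par-∧ true f xs = refl
Par-∧ false f xs = Par-false xs

Par-swap : (f : α → β → Bool) (xs : List α) (ys : List β) →
  Par (λ x → Par (f x) ys) xs ≡ Par (λ y → Par (λ x → f x y) xs) ys
Par-swap f [] ys = sym (Par-false ys)
Par-swap f (x ∷ xs) ys = trans (cong (Par (f x) ys xor_) (Par-swap f xs ys)) (sym (Par-xor (f x) _ ys))

ParF : (Fin n → Bool) → Bool
ParF f = Par f allV

ParF-δ : (x : Fin n) (g : Fin n → Bool) → ParF (λ v → g v ∧ (x == v)) ≡ g x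
ParF-δ x g = begin
  ParF (λ v → g v ∧ (x == v)) ≡⟨ Par-Sum⟦⟧ _ allV ⟩
  par (ΣF (λ v → ⟦ g v ∧ (x == v) ⟧)) ≡⟨ cong par (Sum-cong (λ v → lem (g v) (x == v)) allV) ⟩
  par (ΣF (λ v → ⟦ x == v ⟧ * ⟦ g v ⟧)) ≡⟨ cong par (ΣF-δ x (⟦_⟧ ∘ g)) ⟩
  par ⟦ g x ⟧ ≡⟨ par-⟦⟧ (g x) ⟩
  g x ∎
  where
  open ≡-Reasoning
  lem : ∀ a b → ⟦ a ∧ b ⟧ ≡ ⟦ b ⟧ * ⟦ a ⟧
  lem true true = refl
  lem true false = refl
  lem false true = refl
  lem false false = refl

ΣF-mono-< : {f g : Fin n → ℕ} → (∀ x → f x ≤ g x) → ∀ x → f x < g x → ΣF f < ΣF g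
ΣF-mono-< {f = f} {g} le x lt = begin-strict
  ΣF f <⟨ m<m+n (ΣF f) (≤-trans (m<n⇒0<n∸m lt) (ΣF-≤1 (λ y → g y ∸ f y) x)) ⟩
  ΣF f + ΣF (λ y → g y ∸ f y) ≡⟨ Sum-+ f _ allV ⟨
  ΣF (λ y → f y + (g y ∸ f y)) ≡⟨ Sum-cong (λ y → m+[n∸m]≡n (le y)) allV ⟩
  ΣF g ∎
  where open ≤-Reasoning

ΣF-1 : ΣF {n} (λ _ → 1) ≡ n
ΣF-1 = trans (Sum-1 allV) length-allV

Sum-cong-∈ : {f g : α → ℕ} (xs : List α) → (∀ {x} → x ∈ xs → f x ≡ g x) → Sum f xs ≡ Sum g xs
Sum-cong-∈ [] eq = refl
Sum-cong-∈ (x ∷ xs) eq = cong₂ _+_ (eq (here refl)) (Sum-cong-∈ xs (eq ∘ there))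

⟦xor⟧≤ : ∀ a b → ⟦ a xor b ⟧ ≤ ⟦ a ⟧ + ⟦ b ⟧
⟦xor⟧≤ true b = ≤-trans (⟦⟧≤1 (not b)) (s≤s z≤n)
⟦xor⟧≤ false b = ≤-refl

xor-both-≢ : ∀ {a b c d} → a ≢ b → c ≢ d → a xor c ≡ b xor d
xor-both-≢ {true} {true} p q = contradiction refl p
xor-both-≢ {false} {false} p q = contradiction refl p
xor-both-≢ {true} {false} {true} {true} p q = contradiction refl q
xor-both-≢ {true} {false} {false} {false} p q = contradiction refl q
xor-both-≢ {false} {true} {true} {true} p q = contradiction refl q
xor-both-≢ {false} {true} {false} {false} p q = contradiction refl q
xor-both-≢ {true} {false} {true} {false} p q = refl
xor-both-≢ {true} {false} {false} {true} p q = refl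
xor-both-≢ {false} {true} {true} {false} p q = refl
xor-both-≢ {false} {true} {false} {true} p q = refl

xor-cancelʳ : ∀ {a b c d} → c ≡ d → a xor c ≡ b xor d → a ≡ b
xor-cancelʳ {true} {true} p q = refl
xor-cancelʳ {false} {false} p q = refl
xor-cancelʳ {true} {false} {true} refl ()
xor-cancelʳ {true} {false} {false} refl ()
xor-cancelʳ {false} {true} {true} refl ()
xor-cancelʳ {false} {true} {false} refl ()

∨-falseˡ : ∀ {a b} → a ∨ b ≡ false → a ≡ false
∨-falseˡ {false} p = refl

∨-falseʳ : ∀ {a b} → a ∨ b ≡ false → b ≡ false
∨-falseʳ {false} p = p

true≢false : ∀ {b} → b ≡ true → b ≡ false → ⊥
true≢false refl ()

-- Augmentation in the intersection of a partition matroid and a graphic matroid.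

-- Each group offers items (edges on the vertex set Fin N) of which at most one may be selected.
-- A selection is a forest when each chosen edge is separated by a colouring that is constant on the
-- other chosen edges; working with two-colourings makes every cycle exchange a xor of colourings.
module Transversal {N G : ℕ} (items : Fin G → List (Fin N × Fin N)) where

  Item : Set
  Item = Fin N × Fin N

  Colouring : Set
  Colouring = Fin N → Bool

  Selection : Set
  Selection = Fin G → Maybe Item

  Agree : Colouring → Item → Set
  Agree X (u , v) = X u ≡ X v

  agree? : ∀ X e → Dec (Agree X e)
  agree? X (u , v) = X u ≟ᵇ X v

  _⊕_ : Colouring → Colouring → Colouring
  (X ⊕ Z) v = X v xor Z v

  -- `S` marks the deleted groups. The admissible `X` are the unions of components of the edges
  -- selected elsewhere, so `Separated` and `Connected` below tell whether an item joins two
  -- components.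
  Const : Selection → (Fin G → Bool) → Colouring → Set
  Const T S X = ∀ g e → S g ≡ false → T g ≡ just e → Agree X e

  ConstOff : Selection → Fin G → Colouring → Set
  ConstOff T g Z = ∀ h e → h ≢ g → T h ≡ just e → Agree Z e

  Valid : Selection → Set
  Valid T = ∀ g e → T g ≡ just e → e ∈ items g

  Forest : Selection → Set
  Forest T = ∀ g e → T g ≡ just e → ∃ λ Z → ConstOff T g Z × ¬ Agree Z e

  Separated : Selection → (Fin G → Bool) → Item → Set
  Separated T S e = ∃ λ X → Const T S X × ¬ Agree X e

  Connected : Selection → (Fin G → Bool) → Item → Set
  Connected T S e = ∀ X → Const T S X → Agree X e

  size : Selection → ℕ
  size T = ΣF (λ g → ⟦ is-just (T g) ⟧)

  set : Selection → Fin G → Maybe Item → Selection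
  set T g m = updateAt T g (const m)

  set-at : ∀ T g m → set T g m g ≡ m
  set-at T g m = updateAt-updates g T

  set-off : ∀ T g m {h} → h ≢ g → set T g m h ≡ T h
  set-off T g m {h} = updateAt-minimal h g T

  size-set : ∀ T g m → size (set T g m) + ⟦ is-just (T g) ⟧ ≡ size T + ⟦ is-just m ⟧
  size-set T g m = trans
    (ΣF-update (λ h → ⟦ is-just (set T g m h) ⟧) (λ h → ⟦ is-just (T h) ⟧) g λ h h≢g → cong (⟦_⟧ ∘ is-just) (set-off T g m h≢g))
    (cong (λ x → size T + ⟦ is-just x ⟧) (set-at T g m))

  valid-set : ∀ {T} g {e} → e ∈ items g → Valid T → Valid (set T g (just e))
  valid-set {T} g {e} e∈ val h e' eq with h ≟ᶠ g
  ... | yes refl = subst (_∈ items h) (just-injective (trans (sym (set-at T h (just e))) eq)) e∈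
  ... | no h≢g = val h e' (trans (sym (set-off T g (just e) h≢g)) eq)

  -- Where an old witness `Zg` cuts the new edge, adding `Z` mends this: `Z` also cuts the new edge
  -- and is constant on all others, so the edge of `g` stays separated.
  forest-insert : ∀ {T} x {e} Z → T x ≡ nothing → ConstOff T x Z → ¬ Agree Z e → Forest T → Forest (set T x (just e))
  forest-insert {T} x {e} Z free constZ sepZ forest g e' eq with g ≟ᶠ x
  ... | yes refl = Z , (λ h e₁ h≢ q → constZ h e₁ h≢ (trans (sym (set-off T x (just e) h≢)) q)) ,
    subst (λ e₁ → ¬ Agree Z e₁) (just-injective (trans (sym (set-at T x (just e))) eq)) sepZ
  ... | no g≢x with forest g e' (trans (sym (set-off T x (just e) g≢x)) eq)
  ... | Zg , constZg , sepZg with agree? Zg e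
  ... | yes agr = Zg , constZg' , sepZg
    where
    constZg' : ConstOff (set T x (just e)) g Zg
    constZg' h e₁ h≢ q with h ≟ᶠ x
    ... | yes refl = subst (Agree Zg) (just-injective (trans (sym (set-at T x (just e))) q)) agr
    ... | no h≢x = constZg h e₁ h≢ (trans (sym (set-off T x (just e) h≢x)) q)
  ... | no dis = Zg ⊕ Z , const⊕ , λ a → sepZg (xor-cancelʳ (constZ g e' g≢x (trans (sym (set-off T x (just e) g≢x)) eq)) a)
    where
    const⊕ : ConstOff (set T x (just e)) g (Zg ⊕ Z)
    const⊕ h e₁ h≢ q with h ≟ᶠ x
    ... | yes refl = subst (Agree (Zg ⊕ Z)) (just-injective (trans (sym (set-at T x (just e))) q)) (xor-both-≢ dis sepZ)
    ... | no h≢x = let q' = trans (sym (set-off T x (just e) h≢x)) q in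
      cong₂ _xor_ (constZg h e₁ h≢ q') (constZ h e₁ h≢x q')

  forest-remove : ∀ {T} w → Forest T → Forest (set T w nothing)
  forest-remove {T} w forest g e eq with g ≟ᶠ w
  ... | yes refl with () ← trans (sym (set-at T w nothing)) eq
  ... | no g≢w with forest g e (trans (sym (set-off T w nothing g≢w)) eq)
  ... | Z , constZ , sepZ = Z , constZ' , sepZ
    where
    constZ' : ConstOff (set T w nothing) g Z
    constZ' h e₁ h≢ q with h ≟ᶠ w
    ... | yes refl with () ← trans (sym (set-at T w nothing)) q
    ... | no h≢w = constZ h e₁ h≢ (trans (sym (set-off T w nothing h≢w)) q)

  valid-remove : ∀ {T} w → Valid T → Valid (set T w nothing)
  valid-remove {T} w val g e eq with g ≟ᶠ w
  ... | yes refl with () ← trans (sym (set-at T w nothing)) eq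
  ... | no g≢w = val g e (trans (sym (set-off T w nothing g≢w)) eq)

  -- The levels of the augmenting search of matroid intersection: a group enters the next level when
  -- one of its items joins two components of the selection with the current level deleted.
  data Levels (T : Selection) : ℕ → (Fin G → Bool) → Set where
    base : ∀ {S} → (∀ g → S g ≡ false) → Levels T 0 S
    step : ∀ {d S S'} → Levels T d S → (∀ g → S' g ≡ false → S g ≡ false) →
      (∀ g → S g ≡ false → S' g ≡ true → ∃ λ e → e ∈ items g × Separated T S e) →
      (∀ g → S' g ≡ false → ∀ e → e ∈ items g → Connected T S e) → Levels T (suc d) S'

  -- The levels see `T` only through the colourings that are constant once `S` or an earlier level,
  -- a subset of `S`, is deleted.
  transport : ∀ {T T' d S} → Levels T d S →
    (∀ S₁ → (∀ g → S g ≡ false → S₁ g ≡ false) → ∀ X → (Const T S₁ X → Const T' S₁ X) × (Const T' S₁ X → Const T S₁ X)) →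
    Levels T' d S
  transport (base p) same = base p
  transport (step {S = S} L sub entered outside) same = step
    (transport L λ S₁ sub₁ → same S₁ (λ g → sub₁ g ∘ sub g)) sub
    (λ g Sg S'g → case entered g Sg S'g of λ where (e , e∈ , X , cX , sep) → e , e∈ , X , proj₁ (same S sub X) cX , sep)
    (λ g S'g e e∈ X cX → outside g S'g e e∈ X (proj₂ (same S sub X) cX))

  -- The cycle closed by `e` in `T` without `S` must use an edge of `S'`. To find it, start from a
  -- colouring that separates `e` with `S'` deleted and add the witness of each violated edge; if
  -- none of these witnesses separated `e`, the result would separate `e` with only `S` deleted.
  find-exchange : ∀ {T S S'} → Forest T → (∀ g → S' g ≡ false → S g ≡ false) → ∀ e →
    Connected T S e → Separated T S' e →
    ∃ λ w → ∃ λ f → ∃ λ Z → T w ≡ just f × S w ≡ false × S' w ≡ true × ConstOff T w Z × ¬ Agree Z f × ¬ Agree Z e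
  find-exchange {T} {S} {S'} forest sub e conn (X₀ , cX₀ , sepX₀) =
    go allV X₀ (λ { h f Sh eq (inj₁ S'h) → cX₀ h f S'h eq ; h f Sh eq (inj₂ h∉) → contradiction (∈-allV h) h∉ }) sepX₀
    where
    Goal = ∃ λ w → ∃ λ f → ∃ λ Z → T w ≡ just f × S w ≡ false × S' w ≡ true × ConstOff T w Z × ¬ Agree Z f × ¬ Agree Z e
    -- Invariant: only edges whose group is in `S'` and still listed in `gs` may be violated by `X`.
    go : ∀ gs X → (∀ h f → S h ≡ false → T h ≡ just f → S' h ≡ false ⊎ h ∉ gs → Agree X f) → ¬ Agree X e → Goal
    go [] X cX sep = contradiction (conn X λ h f Sh eq → cX h f Sh eq (inj₂ λ ())) sep
    go (g ∷ gs) X cX sep = head (T g) refl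
      where
      extend : (∀ f → S g ≡ false → T g ≡ just f → Agree X f) → Goal
      extend atg = go gs X cX' sep
        where
        cX' : ∀ h f → S h ≡ false → T h ≡ just f → S' h ≡ false ⊎ h ∉ gs → Agree X f
        cX' h f Sh eq (inj₁ p) = cX h f Sh eq (inj₁ p)
        cX' h f Sh eq (inj₂ h∉) with h ≟ᶠ g
        ... | yes refl = atg f Sh eq
        ... | no h≢g = cX h f Sh eq (inj₂ λ { (here p) → h≢g p ; (there p) → h∉ p })
      head : ∀ m → T g ≡ m → Goal
      head nothing Tg = extend λ f _ eq → case trans (sym Tg) eq of λ ()
      head (just f) Tg with agree? X f | S g in Sg
      ... | yes agr | _ = extend λ f' _ eq → subst (Agree X) (just-injective (trans (sym Tg) eq)) agr
      ... | no dis | true = extend λ f' Sg' eq → ⊥-elim (true≢false Sg Sg')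
      ... | no dis | false with forest g f Tg
      ... | Z , cZ , sepZ with agree? Z e
      ... | no dis' = g , f , Z , Tg , Sg , S'g , cZ , sepZ , dis'
        where
        S'g : S' g ≡ true
        S'g with S' g in eq
        ... | true = refl
        ... | false = contradiction (cX g f Sg Tg (inj₁ eq)) dis
      ... | yes agr = go gs (X ⊕ Z) c⊕ λ a → sep (xor-cancelʳ agr a)
        where
        c⊕ : ∀ h f → S h ≡ false → T h ≡ just f → S' h ≡ false ⊎ h ∉ gs → Agree (X ⊕ Z) f
        c⊕ h f' Sh eq q with h ≟ᶠ g
        ... | yes refl = subst (Agree (X ⊕ Z)) (just-injective (trans (sym Tg) eq)) (xor-both-≢ dis sepZ)
        ... | no h≢g = cong₂ _xor_
          (cX h f' Sh eq (case q of λ { (inj₁ p) → inj₁ p ; (inj₂ h∉) → inj₂ λ { (here p) → h≢g p ; (there p) → h∉ p } }))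
          (cZ h f' h≢g eq)

  Larger : Selection → Set
  Larger T = ∃ λ T' → Valid T' × Forest T' × size T' ≡ suc (size T)

  -- Exchanging `f` at `w` for `e` at `x` leaves the components after deletion of any level up to
  -- `S` as they were, for `e` closes a cycle through `f` outside `S`. So the levels survive, and
  -- the group `w`, now free, offers the item by which it entered, separated one level lower.
  exchange : ∀ {T d S S'} → Levels T d S → Valid T → Forest T →
    (∀ g → S' g ≡ false → S g ≡ false) →
    (∀ g → S g ≡ false → S' g ≡ true → ∃ λ e → e ∈ items g × Separated T S e) →
    ∀ x → T x ≡ nothing → S' x ≡ false → (∀ e → e ∈ items x → Connected T S e) →
    ∀ e → e ∈ items x → Separated T S' e →
    ∃ λ T₂ → Valid T₂ × Forest T₂ × size T₂ ≡ size T × Levels T₂ d S ×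
      ∃ λ w → T₂ w ≡ nothing × S w ≡ false × ∃ λ e' → e' ∈ items w × Separated T₂ S e'
  exchange {T} {d} {S} {S'} L val forest sub entered x free S'x outside e e∈ sep
    with find-exchange forest sub e (outside e e∈) sep
  ... | w , f , Z , Tw , Sw , S'w , cZ , sepZf , sepZe =
    T₂ , val₂ , forest₂ , size₂ , transport L same , w , T₂w , Sw ,
    (case entered w Sw S'w of λ where
      (e' , e'∈ , X , cX , sep') → e' , e'∈ , X , proj₁ (same S (λ g p → p) X) cX , sep')
    where
    x≢w : x ≢ w
    x≢w refl = true≢false S'w S'x
    T₁ = set T w nothing
    T₂ = set T₁ x (just e)
    T₁x : T₁ x ≡ nothing
    T₁x = trans (set-off T w nothing x≢w) free
    T₂x = set-at T₁ x (just e)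
    T₂w : T₂ w ≡ nothing
    T₂w = trans (set-off T₁ x (just e) (x≢w ∘ sym)) (set-at T w nothing)
    T₂-off : ∀ {h} → h ≢ x → h ≢ w → T₂ h ≡ T h
    T₂-off p q = trans (set-off T₁ x (just e) p) (set-off T w nothing q)
    val₂ : Valid T₂
    val₂ = valid-set x e∈ (valid-remove w val)
    forest₂ : Forest T₂
    forest₂ = forest-insert x Z T₁x cZ₁ sepZe (forest-remove w forest)
      where
      cZ₁ : ConstOff T₁ x Z
      cZ₁ h e₁ h≢ q with h ≟ᶠ w
      ... | yes refl with () ← trans (sym (set-at T w nothing)) q
      ... | no h≢w = cZ h e₁ h≢w (trans (sym (set-off T w nothing h≢w)) q)
    size₂ : size T₂ ≡ size T
    size₂ = begin
      size T₂ ≡⟨ +-identityʳ _ ⟨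
      size T₂ + 0 ≡⟨ cong (λ m → size T₂ + ⟦ is-just m ⟧) T₁x ⟨
      size T₂ + ⟦ is-just (T₁ x) ⟧ ≡⟨ size-set T₁ x (just e) ⟩
      size T₁ + 1 ≡⟨ cong (λ m → size T₁ + ⟦ is-just m ⟧) Tw ⟨
      size T₁ + ⟦ is-just (T w) ⟧ ≡⟨ size-set T w nothing ⟩
      size T + 0 ≡⟨ +-identityʳ _ ⟩
      size T ∎
      where open ≡-Reasoning
    same : ∀ S₁ → (∀ g → S g ≡ false → S₁ g ≡ false) → ∀ X → (Const T S₁ X → Const T₂ S₁ X) × (Const T₂ S₁ X → Const T S₁ X)
    same S₁ sub₁ X = to , from
      where
      to : Const T S₁ X → Const T₂ S₁ X
      to cX h e₁ S₁h q with h ≟ᶠ x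
      ... | yes refl = subst (Agree X) (just-injective (trans (sym T₂x) q)) (outside e e∈ X λ g e₂ Sg → cX g e₂ (sub₁ g Sg))
      ... | no h≢x with h ≟ᶠ w
      ... | yes refl with () ← trans (sym T₂w) q
      ... | no h≢w = cX h e₁ S₁h (trans (sym (T₂-off h≢x h≢w)) q)
      from : Const T₂ S₁ X → Const T S₁ X
      from cX h e₁ S₁h q with h ≟ᶠ x
      ... | yes refl with () ← trans (sym free) q
      ... | no h≢x with h ≟ᶠ w
      ... | no h≢w = cX h e₁ S₁h (trans (T₂-off h≢x h≢w) q)
      ... | yes refl with agree? X e₁
      ... | yes agr = agr
      -- If `X` cut `f`, then `X ⊕ Z` would be constant on `T` without `S` and still separate `e`.
      ... | no dis = ⊥-elim (sepZe (xor-cancelʳ {a = Z (proj₁ e)} {Z (proj₂ e)} agrX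
              (trans (xor-comm (Z (proj₁ e)) _) (trans (outside e e∈ (X ⊕ Z) c⊕) (xor-comm _ (Z (proj₂ e)))))))
        where
        agrX : Agree X e
        agrX = cX x e (sub₁ x (sub x S'x)) T₂x
        c⊕ : Const T S (X ⊕ Z)
        c⊕ g e₂ Sg q₂ with g ≟ᶠ w
        ... | yes refl = subst (Agree (X ⊕ Z)) (just-injective (trans (sym q) q₂))
               (xor-both-≢ dis (subst (λ e₃ → ¬ Agree Z e₃) (just-injective (trans (sym Tw) q)) sepZf))
        ... | no g≢w with g ≟ᶠ x
        ... | yes refl with () ← trans (sym free) q₂
        ... | no g≢x = cong₂ _xor_ (cX g e₂ (sub₁ g Sg) (trans (T₂-off g≢x g≢w) q₂)) (cZ g e₂ g≢w q₂)

  -- Every exchange moves the free group one level down. At level 0 nothing is deleted, so the item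
  -- is separated from the whole selection and can be added.
  augment : ∀ {d T S} → Levels T d S → Valid T → Forest T → ∀ x → T x ≡ nothing → S x ≡ false →
    ∀ e → e ∈ items x → Separated T S e → Larger T
  augment {T = T} (base {S} none) val forest x free Sx e e∈ (X , cX , sep) =
    set T x (just e) , valid-set x e∈ val ,
    forest-insert x X free (λ h f _ eq → cX h f (none h) eq) sep forest , (begin
      size T₁ ≡⟨ +-identityʳ _ ⟨
      size T₁ + 0 ≡⟨ cong (λ m → size T₁ + ⟦ is-just m ⟧) free ⟨
      size T₁ + ⟦ is-just (T x) ⟧ ≡⟨ size-set T x (just e) ⟩
      size T + 1 ≡⟨ +-comm _ 1 ⟩
      suc (size T) ∎)
    where
    open ≡-Reasoning
    T₁ = set T x (just e)
  augment {suc d} (step L sub entered outside) val forest x free S'x e e∈ sep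
    with exchange L val forest sub entered x free S'x (outside x S'x) e e∈ sep
  ... | T₂ , val₂ , forest₂ , size₂ , L₂ , w , T₂w , Sw , e' , e'∈ , sep'
    with augment {d} L₂ val₂ forest₂ w T₂w Sw e' e'∈ sep'
  ... | T' , val' , forest' , size' = T' , val' , forest' , trans size' (cong suc size₂)

-- Representatives of components; their fixed points count the components.

roots : {N : ℕ} → (Fin N → Fin N) → ℕ
roots r = ΣF (λ x → ⟦ r x == x ⟧)

Idempotent : {N : ℕ} → (Fin N → Fin N) → Set
Idempotent r = ∀ w → r (r w) ≡ r w

merge : {N : ℕ} → (Fin N → Fin N) → Fin N → Fin N → Fin N → Fin N
merge r u v w = if r w == r u then r v else r w

components : {N : ℕ} → List (Fin N × Fin N) → Fin N → Fin N
components [] = id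
components ((u , v) ∷ L) = merge (components L) u v

module _ {N : ℕ} where

  merge-yes : ∀ {r : Fin N → Fin N} {u v w} → r w ≡ r u → merge r u v w ≡ r v
  merge-yes {r} {u} {v} {w} p = cong (λ b → if b then r v else r w) (trans (cong (_== r u) p) (==-refl (r u)))

  merge-no : ∀ {r : Fin N → Fin N} {u v w} → r w ≢ r u → merge r u v w ≡ r w
  merge-no {r} {u} {v} {w} p = cong (λ b → if b then r v else r w) (==-≢ p)

  merge-idem : ∀ {r : Fin N → Fin N} {u v} → Idempotent r → Idempotent (merge r u v)
  merge-idem {r} {u} {v} idem w with r w ≟ᶠ r u
  ... | no p = merge-no {r} {u} {v} {r w} (λ q → p (trans (sym (idem w)) q)) ▸ idem w
    where
    _▸_ : ∀ {a b c : Fin N} → a ≡ b → b ≡ c → a ≡ c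
    _▸_ = trans
  ... | yes p with r v ≟ᶠ r u
  ... | yes q = merge-yes {r} {u} {v} {r v} (trans (idem v) q)
  ... | no q = trans (merge-no {r} {u} {v} {r v} (λ e → q (trans (sym (idem v)) e))) (idem v)

  merge-root-≢ : ∀ {r : Fin N → Fin N} {u v} → Idempotent r → r u ≢ r v → ∀ x → x ≢ r u →
    ⟦ merge r u v x == x ⟧ ≡ ⟦ r x == x ⟧
  merge-root-≢ {r} {u} {v} idem u≢v x x≢ with r x ≟ᶠ r u
  ... | no p = refl
  ... | yes p = trans (cong ⟦_⟧ (==-≢ λ q → u≢v (trans (sym p) (trans (cong r (sym q)) (idem v)))))
                  (sym (cong ⟦_⟧ (==-≢ λ q → x≢ (trans (sym q) p))))

  roots-merge-≢ : ∀ {r : Fin N → Fin N} {u v} → Idempotent r → r u ≢ r v → suc (roots (merge r u v)) ≡ roots r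
  roots-merge-≢ {r} {u} {v} idem u≢v = begin
    suc (roots (merge r u v)) ≡⟨ +-comm 1 _ ⟩
    roots (merge r u v) + 1 ≡⟨ cong (λ b → roots (merge r u v) + ⟦ b ⟧) (trans (cong (_== r u) (idem u)) (==-refl (r u))) ⟨
    roots (merge r u v) + ⟦ r (r u) == r u ⟧ ≡⟨ ΣF-update (λ x → ⟦ merge r u v x == x ⟧) (λ x → ⟦ r x == x ⟧) (r u) (merge-root-≢ idem u≢v) ⟩
    roots r + ⟦ merge r u v (r u) == r u ⟧ ≡⟨ cong (λ z → roots r + ⟦ z == r u ⟧) (merge-yes {r} {u} {v} (idem u)) ⟩
    roots r + ⟦ r v == r u ⟧ ≡⟨ cong (λ b → roots r + ⟦ b ⟧) (==-≢ (u≢v ∘ sym)) ⟩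
    roots r + 0 ≡⟨ +-identityʳ _ ⟩
    roots r ∎
    where open ≡-Reasoning

  merge-≡ : ∀ {r : Fin N → Fin N} {u v} → r u ≡ r v → ∀ w → merge r u v w ≡ r w
  merge-≡ {r} {u} {v} p w with r w ≟ᶠ r u
  ... | yes q = trans (sym p) (sym q)
  ... | no q = refl

  roots-merge : ∀ {r : Fin N → Fin N} u v → Idempotent r → roots r ≤ suc (roots (merge r u v))
  roots-merge {r} u v idem with r u ≟ᶠ r v
  ... | no p = ≤-reflexive (sym (roots-merge-≢ idem p))
  ... | yes p = ≤-trans (≤-reflexive (Sum-cong (λ x → cong (λ z → ⟦ z == x ⟧) (sym (merge-≡ {r} p x))) allV)) (n≤1+n _)

  components-idem : (L : List (Fin N × Fin N)) → Idempotent (components L)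
  components-idem [] w = refl
  components-idem ((u , v) ∷ L) = merge-idem (components-idem L)

  components-edge : ∀ (L : List (Fin N × Fin N)) {u v} → (u , v) ∈ L → components L u ≡ components L v
  components-edge ((u , v) ∷ L) (here refl) with components L v ≟ᶠ components L u
  ... | yes p = merge-yes {components L} {u} {v} {u} refl
  ... | no p = merge-yes {components L} {u} {v} {u} refl
  components-edge ((u , v) ∷ L) {x} {y} (there e∈) =
    cong (λ z → if z == components L u then components L v else z) (components-edge L e∈)

  components-const : {A : Set} (f : Fin N → A) (L : List (Fin N × Fin N)) →
    (∀ {u v} → (u , v) ∈ L → f u ≡ f v) → ∀ w → f (components L w) ≡ f w
  components-const f [] c w = refl
  components-const f ((u , v) ∷ L) c w with components L w ≟ᶠ components L u
  ... | no p = components-const f L (c ∘ there) w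
  ... | yes p = trans (IH v) (trans (sym (c (here refl))) (trans (sym (IH u)) (trans (cong f (sym p)) (IH w))))
    where IH = components-const f L (c ∘ there)

  roots-lower : (L : List (Fin N × Fin N)) → N ≤ roots (components L) + length L
  roots-lower [] = ≤-reflexive (sym (trans (+-identityʳ _) (trans (Sum-cong (λ x → cong ⟦_⟧ (==-refl x)) allV) ΣF-1)))
  roots-lower ((u , v) ∷ L) = ≤-trans (roots-lower L)
    (≤-trans (+-monoˡ-≤ (length L) (roots-merge u v (components-idem L))) (≤-reflexive (sym (+-suc _ (length L)))))

-- The search for a spanning selection or an obstruction to it.

module RadoLoop {N G : ℕ} (items : Fin G → List (Fin N × Fin N)) (κ : ℕ) where
  open Transversal items

  chosen : Selection → (Fin G → Bool) → List (Fin G) → List Item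
  chosen T S = concatMap (λ g → if S g then [] else fromMaybe (T g))

  none : Fin G → Bool
  none _ = false

  ∈-chosen⁺ : ∀ T S {gs g e} → g ∈ gs → S g ≡ false → T g ≡ just e → e ∈ chosen T S gs
  ∈-chosen⁺ T S {g ∷ gs} (here refl) Sg Tg rewrite Sg | Tg = here refl
  ∈-chosen⁺ T S {g ∷ gs} (there g∈) Sg Tg = ∈-++⁺ʳ (if S g then [] else fromMaybe (T g)) (∈-chosen⁺ T S g∈ Sg Tg)

  ∈-chosen⁻ : ∀ T S {gs e} → e ∈ chosen T S gs → ∃ λ g → g ∈ gs × S g ≡ false × T g ≡ just e
  ∈-chosen⁻ T S {g ∷ gs} e∈ with ∈-++⁻ (if S g then [] else fromMaybe (T g)) e∈
  ... | inj₂ q = case ∈-chosen⁻ T S q of λ where (h , h∈ , rest) → h , there h∈ , rest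
  ... | inj₁ q with S g in Sg | T g in Tg
  ... | false | just e with here refl ← q = g , here refl , Sg , Tg

  length-chosen : ∀ T S gs → length (chosen T S gs) + Sum (λ g → ⟦ S g ∧ is-just (T g) ⟧) gs ≡ Sum (λ g → ⟦ is-just (T g) ⟧) gs
  length-chosen T S [] = refl
  length-chosen T S (g ∷ gs) with S g | T g | length-chosen T S gs
  ... | true | just _ | IH = trans (+-suc _ _) (cong suc IH)
  ... | true | nothing | IH = IH
  ... | false | just _ | IH = cong suc IH
  ... | false | nothing | IH = IH

  -- The colouring that separates an edge of the forest is constant on the edges listed before,
  -- hence on their components; so each edge merges two different classes.
  roots-forest : ∀ {T} → Forest T → ∀ gs → Unique gs →
    roots (components (chosen T none gs)) + length (chosen T none gs) ≤ N
  roots-forest forest [] _ = ≤-reflexive (trans (+-identityʳ _) (trans (Sum-cong (λ x → cong ⟦_⟧ (==-refl x)) allV) ΣF-1))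
  roots-forest {T} forest (g ∷ gs) (g∉ ∷ uniq) with T g in Tg
  ... | nothing = roots-forest forest gs uniq
  ... | just (u , v) with forest g (u , v) Tg
  ... | Z , cZ , sepZ = ≤-trans (≤-reflexive (trans (+-suc _ _) (cong (_+ length L) (roots-merge-≢ (components-idem L) u≢v)))) (roots-forest forest gs uniq)
    where
    L = chosen T none gs
    constL : ∀ {a b} → (a , b) ∈ L → Z a ≡ Z b
    constL e∈ with ∈-chosen⁻ T none e∈
    ... | h , h∈ , _ , Th = cZ h _ (λ where refl → lookupAll g∉ h∈ refl) Th
    u≢v : components L u ≢ components L v
    u≢v p = sepZ (trans (sym (components-const Z L constL u)) (trans (cong Z p) (components-const Z L constL v)))

  -- The dual obstruction: with `S` deleted, at least `suc κ` plus the size of `S` classes remain,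
  -- and each group in `S` can reduce their number by at most one.
  Blocked : Set
  Blocked = ∃ λ (S : Fin G → Bool) → ∃ λ (r : Fin N → Fin N) →
    (∀ g → S g ≡ false → ∀ {u v} → (u , v) ∈ items g → r u ≡ r v) ×
    suc κ + ΣF (λ g → ⟦ S g ⟧) ≤ roots r

  Spanning : Selection → Set
  Spanning T = roots (components (chosen T none allV)) ≤ κ

  search : ∀ fuel {d} T S → Levels T d S → Valid T → Forest T → ¬ Spanning T →
    (∀ g → S g ≡ true → is-just (T g) ≡ true) → ΣF (λ g → ⟦ not (S g) ⟧) ≤ fuel → Larger T ⊎ Blocked
  search fuel T S L val forest ¬span used bound = main
    where
    edges = chosen T S allV
    r = components edges
    sep? : ∀ g → Dec (Any (λ e → r (proj₁ e) ≢ r (proj₂ e)) (items g))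
    sep? g = anyList? (λ e → ¬? (r (proj₁ e) ≟ᶠ r (proj₂ e))) (items g)
    separated : ∀ {u v} → r u ≢ r v → Separated T S (u , v)
    separated {u} {v} u≢v = (λ w → r w == r u) ,
      (λ g e Sg Tg → cong (_== r u) (components-edge edges (∈-chosen⁺ T S (∈-allV g) Sg Tg))) ,
      λ agr → u≢v (sym (==-≡ (trans (sym agr) (==-refl (r u)))))
    joined : ∀ {u v} → r u ≡ r v → Connected T S (u , v)
    joined {u} {v} p X cX = trans (sym (constX u)) (trans (cong X p) (constX v))
      where
      constX : ∀ w → X (r w) ≡ X w
      constX = components-const X edges λ e∈ → case ∈-chosen⁻ T S {allV} e∈ of λ where
        (g , _ , Sg , Tg) → cX g _ Sg Tg
    entering : ∀ {g} → Any (λ e → r (proj₁ e) ≢ r (proj₂ e)) (items g) → ∃ λ e → e ∈ items g × Separated T S e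
    entering a with find a
    ... | (u , v) , e∈ , u≢v = (u , v) , e∈ , separated u≢v
    main : Larger T ⊎ Blocked
    main with any? (λ g → (S g ≟ᵇ false) ×-dec sep? g ×-dec (is-just (T g) ≟ᵇ false))
    ... | yes (g , Sg , a , free) with entering a
    ... | e , e∈ , sep = inj₁ (augment L val forest g (is-nothing free) Sg e e∈ sep)
      where
      is-nothing : ∀ {m : Maybe Item} → is-just m ≡ false → m ≡ nothing
      is-nothing {nothing} p = refl
    main | no ¬free with any? (λ g → (S g ≟ᵇ false) ×-dec sep? g)
    ... | no ¬new = inj₂ (S , r , inside , count)
      where
      inside : ∀ g → S g ≡ false → ∀ {u v} → (u , v) ∈ items g → r u ≡ r v
      inside g Sg {u} {v} e∈ with r u ≟ᶠ r v
      ... | yes p = p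
      ... | no p = contradiction (g , Sg , lose e∈ p) ¬new
      S-size : ΣF (λ g → ⟦ S g ⟧) ≡ ΣF (λ g → ⟦ S g ∧ is-just (T g) ⟧)
      S-size = Sum-cong eq allV
        where
        eq : ∀ g → ⟦ S g ⟧ ≡ ⟦ S g ∧ is-just (T g) ⟧
        eq g with S g in Sg
        ... | false = refl
        ... | true = cong ⟦_⟧ (sym (used g Sg))
      count : suc κ + ΣF (λ g → ⟦ S g ⟧) ≤ roots r
      -- As all groups of `S` are used, the size of `S` and `length edges` add up to `size T`; a
      -- forest that does not span has more than `κ` classes.
      count = +-cancelʳ-≤ (length edges) _ _ (begin
        suc κ + ΣF (λ g → ⟦ S g ⟧) + length edges ≡⟨ +-assoc (suc κ) _ _ ⟩
        suc κ + (ΣF (λ g → ⟦ S g ⟧) + length edges) ≡⟨ cong (suc κ +_) (trans (cong (_+ length edges) S-size) (trans (+-comm _ (length edges)) (length-chosen T S allV))) ⟩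
        suc κ + size T ≤⟨ +-monoˡ-≤ (size T) (≰⇒> ¬span) ⟩
        roots (components full) + size T ≡⟨ cong (roots (components full) +_) (trans (sym (length-chosen T none allV)) (trans (cong (length full +_) (Sum-0 allV)) (+-identityʳ _))) ⟩
        roots (components full) + length full ≤⟨ roots-forest forest allV allV-unique ⟩
        N ≤⟨ roots-lower edges ⟩
        roots r + length edges ∎)
        where
        open ≤-Reasoning
        full = chosen T none allV
    ... | yes (g₀ , Sg₀ , a₀) = next fuel bound
      where
      S' : Fin G → Bool
      S' g = S g ∨ does (sep? g)
      L' = step L (λ g → ∨-falseˡ) entered outside
        where
        entered : ∀ g → S g ≡ false → S' g ≡ true → ∃ λ e → e ∈ items g × Separated T S e
        entered g Sg S'g with sep? g
        ... | yes a = entering a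
        ... | no _ rewrite Sg with () ← S'g
        outside : ∀ g → S' g ≡ false → ∀ e → e ∈ items g → Connected T S e
        outside g S'g (u , v) e∈ with r u ≟ᶠ r v
        ... | yes p = joined p
        ... | no p = ⊥-elim (true≢false (dec-true (sep? g) (lose e∈ p)) (∨-falseʳ {S g} S'g))
      used' : ∀ g → S' g ≡ true → is-just (T g) ≡ true
      used' g S'g with S g in Sg | sep? g
      ... | true | _ = used g Sg
      ... | false | yes a with is-just (T g) in Tg
      ... | true = refl
      ... | false = contradiction (g , Sg , a , Tg) ¬free
      fewer : ΣF (λ g → ⟦ not (S' g) ⟧) < ΣF (λ g → ⟦ not (S g) ⟧)
      fewer = ΣF-mono-< (λ g → le (S g) (does (sep? g))) g₀ lt
        where
        le : ∀ a b → ⟦ not (a ∨ b) ⟧ ≤ ⟦ not a ⟧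
        le true b = z≤n
        le false b = ⟦⟧≤1 (not b)
        lt : ⟦ not (S' g₀) ⟧ < ⟦ not (S g₀) ⟧
        lt rewrite Sg₀ | dec-true (sep? g₀) a₀ = s≤s z≤n
      next : ∀ fuel → ΣF (λ g → ⟦ not (S g) ⟧) ≤ fuel → Larger T ⊎ Blocked
      next zero le = contradiction (≤-trans fewer le) λ ()
      next (suc f) le = search f T S' L' val forest ¬span used' (≤-pred (≤-trans fewer le))

  size≤G : ∀ T → size T ≤ G
  size≤G T = ≤-trans (Sum-mono (λ g → ⟦⟧≤1 (is-just (T g))) allV) (≤-reflexive ΣF-1)

  spanning-or-blocked : (∃ λ T → Valid T × Spanning T) ⊎ Blocked
  spanning-or-blocked = go G (const nothing) (λ _ _ ()) (λ _ _ ()) (m≤n+m G _)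
    where
    go : ∀ fuel T → Valid T → Forest T → G ≤ size T + fuel → (∃ λ T → Valid T × Spanning T) ⊎ Blocked
    go fuel T val forest le with roots (components (chosen T none allV)) ≤? κ
    ... | yes span = inj₁ (T , val , span)
    ... | no ¬span with search _ T none (base λ _ → refl) val forest ¬span (λ _ ()) ≤-refl
    ... | inj₂ blocked = inj₂ blocked
    ... | inj₁ (T' , val' , forest' , bigger) with fuel
    ... | zero = contradiction (≤-trans (≤-reflexive (sym bigger)) (≤-trans (size≤G T') (≤-trans le (≤-reflexive (+-identityʳ _))))) 1+n≰n
    ... | suc f = go f T' val' forest' (≤-trans le (≤-reflexive (trans (+-suc _ f) (cong (_+ f) (sym bigger)))))

-- Packing disjoint connected spanning subgraphs.

Edge : ℕ → Set
Edge n = Fin n × Fin n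

cut : {n : ℕ} → (Fin n → Bool) → List (Edge n) → ℕ
cut X = Sum (λ e → ⟦ X (proj₁ e) xor X (proj₂ e) ⟧)

Conn : {n : ℕ} → List (Edge n) → Set
Conn L = ∀ (X : _ → Bool) → (∀ {u v} → (u , v) ∈ L → X u ≡ X v) → ∀ u v → X u ≡ X v

∈-concatMap⁻ : {A B : Set} (f : A → List B) (xs : List A) {y : B} → y ∈ concatMap f xs → ∃ λ x → x ∈ xs × y ∈ f x
∈-concatMap⁻ f (x ∷ xs) y∈ with ∈-++⁻ (f x) y∈
... | inj₁ p = x , here refl , p
... | inj₂ p = case ∈-concatMap⁻ f xs p of λ where (z , z∈ , q) → z , there z∈ , q

∈-concatMap⁺ : {A B : Set} (f : A → List B) {xs : List A} {x : A} {y : B} → x ∈ xs → y ∈ f x → y ∈ concatMap f xs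
∈-concatMap⁺ f {x ∷ xs} (here refl) y∈ = ∈-++⁺ˡ y∈
∈-concatMap⁺ f {z ∷ xs} (there x∈) y∈ = ∈-++⁺ʳ (f z) (∈-concatMap⁺ f x∈ y∈)

module Packing {n G : ℕ} (K c λ₀ : ℕ) (v₀ : Fin n) (groups : Fin G → List (Edge n))
  (small : ∀ g → length (groups g) ≤ c) (2Kc≤λ : 2 * K * c ≤ λ₀) (0<λ : 0 < λ₀)
  (cuts : ∀ X u v → X u ≡ true → X v ≡ false → λ₀ ≤ cut X (concatMap groups allV)) where

  lift : Fin K → Edge n → Edge (K * n)
  lift i (a , b) = combine i a , combine i b

  -- Matroid union as matroid intersection: K disjoint copies of the vertex set, every edge offered in each.
  items : Fin G → List (Edge (K * n))
  items g = concatMap (λ i → map (lift i) (groups g)) allV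

  copy : Fin (K * n) → Fin K
  copy x = proj₁ (remQuot n x)

  vertex : Fin (K * n) → Fin n
  vertex x = proj₂ (remQuot {K} n x)

  copy-combine : ∀ i v → copy (combine i v) ≡ i
  copy-combine i v = cong proj₁ (remQuot-combine i v)

  vertex-combine : ∀ (i : Fin K) v → vertex (combine i v) ≡ v
  vertex-combine i v = cong proj₂ (remQuot-combine i v)

  combine-copy : ∀ x → combine (copy x) (vertex x) ≡ x
  combine-copy x = combine-remQuot {K} n x

  items⁻ : ∀ {g e} → e ∈ items g → ∃ λ i → ∃ λ a → ∃ λ b → (a , b) ∈ groups g × e ≡ (combine i a , combine i b)
  items⁻ {g} e∈ with ∈-concatMap⁻ (λ i → map (lift i) (groups g)) allV e∈
  ... | i , _ , e∈' with ∈-map⁻ (lift i) e∈'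
  ... | (a , b) , ab∈ , eq = i , a , b , ab∈ , eq

  items⁺ : ∀ {g a b} i → (a , b) ∈ groups g → (combine i a , combine i b) ∈ items g
  items⁺ {g} i ab∈ = ∈-concatMap⁺ (λ i → map (lift i) (groups g)) (∈-allV i) (∈-map⁺ (lift i) ab∈)

  open Transversal items
  open RadoLoop items K

  -- If the class of a root misses a vertex of the root's own copy, it has at least `λ₀` boundary
  -- edges there; otherwise it contains the `v₀` of that copy, which accounts for at most `K` roots.
  -- Boundary edges come only from groups in `S`, and a group supplies at most `2 * K * c`: an edge
  -- meets at most two class boundaries in each copy. Hence there are at most `K` plus the size of
  -- `S` roots.
  blocked-impossible : ¬ Blocked
  blocked-impossible (S , r , inside , count) = 1+n≰n (*-cancelˡ-≤ λ₀ ⦃ >-nonZero 0<λ ⦄ (begin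
    λ₀ * (suc K + ΣF (λ g → ⟦ S g ⟧)) ≤⟨ *-monoʳ-≤ λ₀ count ⟩
    λ₀ * roots r ≡⟨ Sum-*ˡ λ₀ _ allV ⟨
    ΣF (λ x → λ₀ * ⟦ r x == x ⟧) ≤⟨ Sum-mono pointwise allV ⟩
    ΣF (λ x → ΣF (λ i → cut (X x i) L) + λ₀ * ΣF (λ i → ⟦ r (combine i v₀) == x ⟧)) ≡⟨ Sum-+ _ _ allV ⟩
    ΣF (λ x → ΣF (λ i → cut (X x i) L)) + ΣF (λ x → λ₀ * ΣF (λ i → ⟦ r (combine i v₀) == x ⟧))
                                                     ≤⟨ +-mono-≤ cuts-small (≤-reflexive full) ⟩
    λ₀ * ΣF (λ g → ⟦ S g ⟧) + λ₀ * K ≡⟨ *-distribˡ-+ λ₀ _ K ⟨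
    λ₀ * (ΣF (λ g → ⟦ S g ⟧) + K) ≡⟨ cong (λ₀ *_) (+-comm _ K) ⟩
    λ₀ * (K + ΣF (λ g → ⟦ S g ⟧)) ∎))
    where
    open ≤-Reasoning
    L = concatMap groups allV
    X : Fin (K * n) → Fin K → Fin n → Bool
    X x i v = r (combine i v) == x
    pointwise : ∀ x → λ₀ * ⟦ r x == x ⟧ ≤ ΣF (λ i → cut (X x i) L) + λ₀ * ΣF (λ i → ⟦ r (combine i v₀) == x ⟧)
    pointwise x with r x ≟ᶠ x
    ... | no _ = ≤-trans (≤-reflexive (*-zeroʳ λ₀)) z≤n
    ... | yes rx with any? (λ u → X x (copy x) u ≟ᵇ false)
    ... | yes (u , Xu) = ≤-trans (≤-trans (≤-reflexive (*-identityʳ λ₀))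
            (≤-trans (cuts (X x (copy x)) (vertex x) u at-x Xu) (ΣF-≤1 (λ i → cut (X x i) L) (copy x)))) (m≤m+n _ _)
      where
      at-x : X x (copy x) (vertex x) ≡ true
      at-x = trans (cong (_== x) (trans (cong r (combine-copy x)) rx)) (==-refl x)
    ... | no ¬false = ≤-trans (*-monoʳ-≤ λ₀ (≤-trans (≤-reflexive (cong ⟦_⟧ (sym (¬-not (λ p → ¬false (v₀ , p)))))) (ΣF-≤1 (λ i → ⟦ X x i v₀ ⟧) (copy x)))) (m≤n+m _ _)
    full : ΣF (λ x → λ₀ * ΣF (λ i → ⟦ r (combine i v₀) == x ⟧)) ≡ λ₀ * K
    full = trans (Sum-*ˡ λ₀ _ allV) (cong (λ₀ *_) (trans (Sum-swap (λ x i → ⟦ r (combine i v₀) == x ⟧) allV allV)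
      (trans (Sum-cong (λ i → ΣF-δ₁ (r (combine i v₀))) allV) ΣF-1)))
    D : Edge n → ℕ
    D (a , b) = ΣF (λ i → ΣF (λ x → ⟦ X x i a xor X x i b ⟧))
    D≤ : ∀ e → D e ≤ 2 * K
    D≤ (a , b) = begin
      D (a , b) ≤⟨ Sum-mono (λ i → Sum-mono (λ x → ⟦xor⟧≤ (X x i a) (X x i b)) allV) allV ⟩
      ΣF (λ i → ΣF (λ x → ⟦ X x i a ⟧ + ⟦ X x i b ⟧)) ≡⟨ Sum-cong (λ i → trans (Sum-+ _ _ allV) (cong₂ _+_ (ΣF-δ₁ (r (combine i a))) (ΣF-δ₁ (r (combine i b))))) allV ⟩
      ΣF {K} (λ i → 2 * 1) ≡⟨ Sum-*ˡ 2 (λ _ → 1) allV ⟩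
      2 * ΣF {K} (λ i → 1) ≡⟨ cong (2 *_) ΣF-1 ⟩
      2 * K ∎
    D-inside : ∀ g → S g ≡ false → ∀ {e} → e ∈ groups g → D e ≡ 0
    D-inside g Sg {a , b} e∈ = trans (Sum-cong (λ i → trans (Sum-cong (λ x →
      cong ⟦_⟧ (trans (cong (λ z → (z == x) xor X x i b) (inside g Sg (items⁺ i e∈))) (xor-same (X x i b)))) allV) (Sum-0 (allV {K * n}))) allV) (Sum-0 (allV {K}))
    group-small : ∀ g → Sum D (groups g) ≤ λ₀ * ⟦ S g ⟧
    group-small g with S g in Sg
    ... | false = ≤-reflexive (trans (Sum-cong-∈ (groups g) (D-inside g Sg)) (trans (Sum-0 (groups g)) (sym (*-zeroʳ λ₀))))
    ... | true = begin
      Sum D (groups g) ≤⟨ Sum-mono D≤ (groups g) ⟩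
      Sum (λ _ → 2 * K) (groups g) ≡⟨ Sum-cong (λ _ → sym (*-identityʳ (2 * K))) (groups g) ⟩
      Sum (λ _ → 2 * K * 1) (groups g) ≡⟨ Sum-*ˡ (2 * K) (λ _ → 1) (groups g) ⟩
      2 * K * Sum (λ _ → 1) (groups g) ≡⟨ cong (2 * K *_) (Sum-1 (groups g)) ⟩
      2 * K * length (groups g) ≤⟨ *-monoʳ-≤ (2 * K) (small g) ⟩
      2 * K * c ≤⟨ 2Kc≤λ ⟩
      λ₀ ≡⟨ *-identityʳ λ₀ ⟨
      λ₀ * 1 ∎
    cuts-small : ΣF (λ x → ΣF (λ i → cut (X x i) L)) ≤ λ₀ * ΣF (λ g → ⟦ S g ⟧)
    cuts-small = begin
      ΣF (λ x → ΣF (λ i → cut (X x i) L)) ≡⟨ Sum-swap (λ x i → cut (X x i) L) allV allV ⟩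
      ΣF (λ i → ΣF (λ x → cut (X x i) L)) ≡⟨ Sum-cong (λ i → Sum-swap (λ x e → ⟦ X x i (proj₁ e) xor X x i (proj₂ e) ⟧) allV L) allV ⟩
      ΣF (λ i → Sum (λ e → ΣF (λ x → ⟦ X x i (proj₁ e) xor X x i (proj₂ e) ⟧)) L) ≡⟨ Sum-swap (λ i e → ΣF (λ x → ⟦ X x i (proj₁ e) xor X x i (proj₂ e) ⟧)) allV L ⟩
      Sum D L ≡⟨ Sum-concatMap D groups allV ⟩
      ΣF (λ g → Sum D (groups g)) ≤⟨ Sum-mono group-small allV ⟩
      ΣF (λ g → λ₀ * ⟦ S g ⟧) ≡⟨ Sum-*ˡ λ₀ _ allV ⟩
      λ₀ * ΣF (λ g → ⟦ S g ⟧) ∎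

  decode : Edge (K * n) → Fin K × Edge n
  decode (x , y) = copy x , vertex x , vertex y

  pick : Fin K → Maybe (Fin K × Edge n) → List (Edge n)
  pick i nothing = []
  pick i (just (j , e)) = if j == i then e ∷ [] else []

  ∈-pick : ∀ i e → e ∈ pick i (just (i , e))
  ∈-pick i e rewrite ==-refl i = here refl

  tree : (Fin G → Maybe (Fin K × Edge n)) → Fin K → List (Edge n)
  tree sel i = concatMap (λ g → pick i (sel g)) allV

  abstract
    -- No item joins two copies, so a selection that leaves at most `K` components in all makes
    -- every single copy connected.
    packing : ∃ λ (sel : Fin G → Maybe (Fin K × Edge n)) →
      (∀ g i e → sel g ≡ just (i , e) → e ∈ groups g) × (∀ i → Conn (tree sel i))
    packing with spanning-or-blocked
    ... | inj₂ blocked = contradiction blocked blocked-impossible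
    ... | inj₁ (T , val , span) = sel , sel-valid , conn
      where
      sel : Fin G → Maybe (Fin K × Edge n)
      sel g = mapMaybe decode (T g)
      decode-lift : ∀ i a b → decode (combine i a , combine i b) ≡ (i , a , b)
      decode-lift i a b = cong₂ _,_ (copy-combine i a) (cong₂ _,_ (vertex-combine i a) (vertex-combine i b))
      sel-valid : ∀ g i e → sel g ≡ just (i , e) → e ∈ groups g
      sel-valid g i e eq with T g in Tg
      ... | just _ with items⁻ (val g _ Tg)
      ... | j , a , b , ab∈ , refl with refl ← trans (sym (decode-lift j a b)) (just-injective eq) = ab∈
      edges : List (Edge (K * n))
      edges = chosen T none allV
      r : Fin (K * n) → Fin (K * n)
      r = components edges
      r-copy : ∀ x → copy (r x) ≡ copy x
      r-copy = components-const copy edges λ {u} {v} e∈ → case ∈-chosen⁻ T none {allV} e∈ of λ where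
        (g , _ , _ , Tg) → case items⁻ (val g _ Tg) of λ where
          (j , a , b , _ , refl) → trans (copy-combine j a) (sym (copy-combine j b))
      conn : ∀ i → Conn (tree sel i)
      conn i X cX v v' with X v ≟ᵇ X v'
      ... | yes p = p
      -- If `X` split the subgraph `i`, the vertex `v` in each of the `K` copies and `v'` in copy
      -- `i` would lie in `K + 1` different components.
      ... | no dis = contradiction span (<⇒≱ many)
        where
        Y : Fin (K * n) → Bool
        Y x = (copy x == i) ∧ X (vertex x)
        Y-at' : ∀ j u → Y (combine j u) ≡ (j == i) ∧ X u
        Y-at' j u = cong₂ (λ k w → (k == i) ∧ X w) (copy-combine j u) (vertex-combine j u)
        Y-edge : ∀ {x y} → (x , y) ∈ edges → Y x ≡ Y y
        Y-edge e∈ with ∈-chosen⁻ T none {allV} e∈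
        ... | g , _ , _ , Tg with items⁻ (val g _ Tg)
        ... | j , a , b , _ , refl = trans (Y-at' j a) (trans core (sym (Y-at' j b)))
          where
          sel-g : sel g ≡ just (j , a , b)
          sel-g = trans (cong (mapMaybe decode) Tg) (cong just (decode-lift j a b))
          core : (j == i) ∧ X a ≡ (j == i) ∧ X b
          core with j ≟ᶠ i
          ... | no _ = refl
          ... | yes refl = cX (∈-concatMap⁺ (λ g → pick j (sel g)) (∈-allV g)
                  (subst (λ m → (a , b) ∈ pick j m) (sym sel-g) (∈-pick j (a , b))))
        Y-root : ∀ x → Y (r x) ≡ Y x
        Y-root = components-const Y edges Y-edge
        Y-at : ∀ u → Y (combine i u) ≡ X u
        Y-at u = trans (Y-at' i u) (cong (_∧ X u) (==-refl i))
        roots≢ : r (combine i v) ≢ r (combine i v')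
        roots≢ p = dis (trans (sym (Y-at v)) (trans (sym (Y-root _)) (trans (cong Y p) (trans (Y-root _) (Y-at v')))))
        is-root : ∀ {y x} → r y ≡ x → ⟦ r x == x ⟧ ≡ 1
        is-root {y} refl = cong ⟦_⟧ (trans (cong (_== r y) (components-idem edges y)) (==-refl (r y)))
        distinct : ∀ x → ΣF (λ (j : Fin K) → ⟦ r (combine j v) == x ⟧) + ⟦ r (combine i v') == x ⟧ ≤ ⟦ r x == x ⟧
        distinct x = ≤-trans (+-monoˡ-≤ _ at-copy) final
          where
          open ≤-Reasoning
          at-copy : ΣF (λ (j : Fin K) → ⟦ r (combine j v) == x ⟧) ≤ ⟦ r (combine (copy x) v) == x ⟧
          at-copy = begin
            ΣF (λ (j : Fin K) → ⟦ r (combine j v) == x ⟧) ≤⟨ Sum-mono le allV ⟩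
            ΣF (λ (j : Fin K) → ⟦ copy x == j ⟧ * ⟦ r (combine j v) == x ⟧) ≡⟨ ΣF-δ (copy x) (λ (j : Fin K) → ⟦ r (combine j v) == x ⟧) ⟩
            ⟦ r (combine (copy x) v) == x ⟧ ∎
            where
            le : ∀ (j : Fin K) → ⟦ r (combine j v) == x ⟧ ≤ ⟦ copy x == j ⟧ * ⟦ r (combine j v) == x ⟧
            le j with r (combine j v) ≟ᶠ x
            ... | no _ = z≤n
            ... | yes p = ≤-reflexive (sym (trans (*-identityʳ _) (cong ⟦_⟧ (trans (cong (_== j)
                    (trans (cong copy (sym p)) (trans (r-copy _) (copy-combine j v)))) (==-refl j)))))
          final : ⟦ r (combine (copy x) v) == x ⟧ + ⟦ r (combine i v') == x ⟧ ≤ ⟦ r x == x ⟧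
          final with r (combine (copy x) v) ≟ᶠ x | r (combine i v') ≟ᶠ x
          ... | no _ | no _ = z≤n
          ... | yes p | no _ = ≤-reflexive (sym (is-root p))
          ... | no _ | yes q = ≤-reflexive (sym (is-root q))
          ... | yes p | yes q = contradiction
                (trans (cong (λ (j : Fin K) → r (combine j v)) (trans (sym (copy-combine i v')) (trans (sym (r-copy _)) (cong copy q)))) (trans p (sym q))) roots≢
        many : K < roots r
        many = begin
          suc K ≡⟨ +-comm 1 K ⟩
          K + 1 ≡⟨ cong₂ _+_ (trans (Sum-swap (λ x (j : Fin K) → ⟦ r (combine j v) == x ⟧) allV allV)
                                                                                     (trans (Sum-cong (λ (j : Fin K) → ΣF-δ₁ (r (combine j v))) allV) ΣF-1)) (ΣF-δ₁ (r (combine i v'))) ⟨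
          ΣF (λ x → ΣF (λ (j : Fin K) → ⟦ r (combine j v) == x ⟧)) + ΣF (λ x → ⟦ r (combine i v') == x ⟧) ≡⟨ Sum-+ _ _ allV ⟨
          ΣF (λ x → ΣF (λ (j : Fin K) → ⟦ r (combine j v) == x ⟧) + ⟦ r (combine i v') == x ⟧) ≤⟨ Sum-mono distinct allV ⟩
          roots r ∎
          where open ≤-Reasoning

≈-∷ : (x : α) {xs ys : List α} → xs ≈ ys → x ∷ xs ≈ x ∷ ys
≈-∷ x p = mk λ f → cong (f x +_) (at p f)

≈-shift : (xs : List α) (y : α) (ys : List α) → xs ++ y ∷ ys ≈ y ∷ xs ++ ys
≈-shift xs y ys = mk λ f → trans (Sum-++ f xs (y ∷ ys)) (trans (lem (Sum f xs) (f y) (Sum f ys)) (cong (f y +_) (sym (Sum-++ f xs ys))))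
  where
  lem : ∀ a b c → a + (b + c) ≡ b + (a + c)
  lem = solve-∀

Par-≈ : {xs ys : List α} → xs ≈ ys → ∀ f → Par f xs ≡ Par f ys
Par-≈ {xs = xs} {ys} p f = trans (Par-Sum⟦⟧ f xs) (trans (cong par (at p (⟦_⟧ ∘ f))) (sym (Par-Sum⟦⟧ f ys)))

Par-++ : (f : α → Bool) (xs ys : List α) → Par f (xs ++ ys) ≡ Par f xs xor Par f ys
Par-++ f [] ys = refl
Par-++ f (x ∷ xs) ys = trans (cong (f x xor_) (Par-++ f xs ys)) (sym (xor-assoc (f x) _ _))

Par-map : (f : β → Bool) (h : α → β) (xs : List α) → Par f (map h xs) ≡ Par (f ∘ h) xs
Par-map f h [] = refl
Par-map f h (x ∷ xs) = cong (f (h x) xor_) (Par-map f h xs)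

Sum-∈ : (f : α → ℕ) {xs : List α} {x : α} → x ∈ xs → f x ≤ Sum f xs
Sum-∈ f (here refl) = m≤m+n _ _
Sum-∈ f {y ∷ xs} (there p) = ≤-trans (Sum-∈ f p) (m≤n+m _ (f y))

Sum-pos-∈ : (p : α → Bool) (xs : List α) → 0 < Sum (⟦_⟧ ∘ p) xs → ∃ λ x → x ∈ xs × p x ≡ true
Sum-pos-∈ p (x ∷ xs) lt with p x in eq
... | true = x , here refl , eq
... | false = case Sum-pos-∈ p xs lt of λ where (y , y∈ , q) → y , there y∈ , q

_==ᵉ_ : Edge n → Edge n → Bool
(a , b) ==ᵉ (c , d) = (a == c) ∧ (b == d)

==ᵉ-refl : (e : Edge n) → (e ==ᵉ e) ≡ true
==ᵉ-refl (a , b) rewrite ==-refl a = ==-refl b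

==ᵉ-≡ : {e f : Edge n} → (e ==ᵉ f) ≡ true → e ≡ f
==ᵉ-≡ {e = a , b} {c , d} p with a == c in q
... | true = cong₂ _,_ (==-≡ q) (==-≡ p)

-- Tested with the weight that counts copies of `e`, which exists because equality of edges is
-- decidable.
≈-∈ : {xs ys : List (Edge n)} → xs ≈ ys → ∀ {e} → e ∈ xs → e ∈ ys
≈-∈ {xs = xs} {ys} p {e} e∈ with Sum-pos-∈ (e ==ᵉ_) ys
  (≤-trans (≤-trans (≤-reflexive (cong ⟦_⟧ (sym (==ᵉ-refl e)))) (Sum-∈ (⟦_⟧ ∘ (e ==ᵉ_)) e∈)) (≤-reflexive (at p (⟦_⟧ ∘ (e ==ᵉ_)))))
... | f , f∈ , q = subst (_∈ ys) (sym (==ᵉ-≡ q)) f∈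

remove : {xs : List α} {x : α} → x ∈ xs →
  ∃ λ ys → xs ≈ x ∷ ys × (∀ {z} → z ∈ xs → z ≡ x ⊎ z ∈ ys) × (∀ {z} → z ∈ ys → z ∈ xs)
remove {xs = x ∷ xs} (here refl) = xs , ≈-refl , (λ { (here p) → inj₁ p ; (there p) → inj₂ p }) , there
remove {xs = y ∷ xs} {x} (there x∈) with remove x∈
... | ys , eqv , split , back = y ∷ ys , mk (λ f → trans (cong (f y +_) (at eqv f)) (lem (f y) (f x) (Sum f ys))) ,
  (λ { (here p) → inj₂ (here p) ; (there p) → case split p of λ { (inj₁ q) → inj₁ q ; (inj₂ q) → inj₂ (there q) } }) ,
  (λ { (here p) → here p ; (there p) → there (back p) })
  where
  lem : ∀ a b c → a + (b + c) ≡ b + (a + c)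
  lem = solve-∀

-- Degrees, their parities, and T-joins.

ends : Fin n → Edge n → Bool
ends v (a , b) = (a == v) xor (b == v)

d₁ : Fin n → List (Edge n) → ℕ
d₁ v = Sum (λ e → ⟦ proj₁ e == v ⟧)

d₂ : Fin n → List (Edge n) → ℕ
d₂ v = Sum (λ e → ⟦ proj₂ e == v ⟧)

ParF-ends : (X : Fin n → Bool) (e : Edge n) → ParF (λ w → X w ∧ ends w e) ≡ X (proj₁ e) xor X (proj₂ e)
ParF-ends X (u , v) = trans (Par-cong (λ w → ∧-distribˡ-xor (X w) (u == w) (v == w)) allV)
  (trans (Par-xor _ _ allV) (cong₂ _xor_ (ParF-δ u X) (ParF-δ v X)))

-- Such `X` are the unions of components of the graph with edges `p a`. The map `p` allows a cherry
-- to act as an edge between its tips.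
Closed : (α → Edge n) → List α → (Fin n → Bool) → Set
Closed p L X = ∀ {a} → a ∈ L → X (proj₁ (p a)) ≡ X (proj₂ (p a))

closed-dec : (p : α → Edge n) (L : List α) (s : Subset n) →
  Dec (All (λ a → lookup s (proj₁ (p a)) ≡ lookup s (proj₂ (p a))) L)
closed-dec p L s = allList? (λ a → lookup s (proj₁ (p a)) ≟ᵇ lookup s (proj₂ (p a))) L

closed-tabulate : (p : α → Edge n) {L : List α} {X : Fin n → Bool} → Closed p L X →
  All (λ a → lookup (tabulateᵛ X) (proj₁ (p a)) ≡ lookup (tabulateᵛ X) (proj₂ (p a))) L
closed-tabulate p {X = X} c = tabulateAll λ {a} a∈ →
  trans (lookup∘tabulate X (proj₁ (p a))) (trans (c a∈) (sym (lookup∘tabulate X (proj₂ (p a)))))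

-- A T-join exists as soon as every union of components contains evenly many odd demands; if deleting
-- the first edge breaks this for X₀, that edge must be in the join.
abstract
  tjoin : (p : α → Edge n) (L : List α) (ε : Fin n → Bool) →
    (∀ X → Closed p L X → ParF (λ v → X v ∧ ε v) ≡ false) →
    ∃ λ J → ∃ λ J' → L ≈ J ++ J' × (∀ v → Par (ends v ∘ p) J ≡ ε v)
  tjoin p [] ε ok = [] , [] , ≈-refl ,
    λ v → trans (sym (ok (v ==_) (λ ()))) (trans (Par-cong (λ w → ∧-comm (v == w) (ε w)) allV) (ParF-δ v ε))
  tjoin {n = n} p (e ∷ L) ε ok
    with anySubset? {n = n} (λ s → closed-dec p L s ×-dec (ParF (λ v → lookup s v ∧ ε v) ≟ᵇ true))
  ... | no ¬bad with tjoin p L ε still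
    where
    still : ∀ X → Closed p L X → ParF (λ v → X v ∧ ε v) ≡ false
    still X c with ParF (λ v → X v ∧ ε v) in eq
    ... | false = refl
    ... | true = contradiction (tabulateᵛ X , closed-tabulate p c ,
      trans (Par-cong (λ v → cong (_∧ ε v) (lookup∘tabulate X v)) allV) eq) ¬bad
  ... | J , J' , eqv , deg = J , e ∷ J' , ≈-trans (≈-∷ e eqv) (≈-sym (≈-shift J e J')) , deg
  tjoin {n = n} p (e ∷ L) ε ok | yes (s , cs , odd) with tjoin p L ε' ok'
    where
    u v : Fin n
    u = proj₁ (p e)
    v = proj₂ (p e)
    X₀ : Fin n → Bool
    X₀ = lookup s
    closed₀ : Closed p L X₀
    closed₀ = lookupAll cs
    separates : X₀ u ≢ X₀ v
    separates q = true≢false odd (ok X₀ λ { (here refl) → q ; (there a∈) → closed₀ a∈ })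
    ε' : Fin n → Bool
    ε' w = ε w xor ends w (p e)
    xor-true : ∀ {a b} → a ≢ b → a xor b ≡ true
    xor-true {true} {true} q = contradiction refl q
    xor-true {true} {false} q = refl
    xor-true {false} {true} q = refl
    xor-true {false} {false} q = contradiction refl q
    ok' : ∀ X → Closed p L X → ParF (λ w → X w ∧ ε' w) ≡ false
    ok' X c = trans (Par-cong (λ w → ∧-distribˡ-xor (X w) (ε w) _) allV)
      (trans (Par-xor _ _ allV) (trans (cong (ParF (λ w → X w ∧ ε w) xor_) (ParF-ends X (p e))) (parity (X u ≟ᵇ X v))))
      where
      parity : Dec (X u ≡ X v) → ParF (λ w → X w ∧ ε w) xor (X u xor X v) ≡ false
      parity (yes q) rewrite ok X (λ { (here refl) → q ; (there a∈) → c a∈ }) | q = xor-same (X v)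
      parity (no q) = trans (cong₂ _xor_ oddX (xor-true q)) refl
        where
        -- Both `X` and `X₀` separate the first edge, so their xor does not and falls under the
        -- hypothesis `ok` for the whole list.
        W : Fin n → Bool
        W w = X w xor X₀ w
        even : ParF (λ w → W w ∧ ε w) ≡ false
        even = ok W λ { (here refl) → xor-both-≢ q separates ; (there a∈) → cong₂ _xor_ (c a∈) (closed₀ a∈) }
        split : ParF (λ w → W w ∧ ε w) ≡ ParF (λ w → X w ∧ ε w) xor ParF (λ w → X₀ w ∧ ε w)
        split = trans (Par-cong (λ w → ∧-distribʳ-xor (ε w) (X w) (X₀ w)) allV) (Par-xor _ _ allV)
        oddX : ParF (λ w → X w ∧ ε w) ≡ true
        oddX = lem (trans (cong (ParF (λ w → X w ∧ ε w) xor_) (sym odd)) (trans (sym split) even))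
          where
          lem : ∀ {b} → b xor true ≡ false → b ≡ true
          lem {true} _ = refl
  ... | J , J' , eqv , deg = e ∷ J , J' , ≈-∷ e eqv , λ w → trans (cong (ends w (p e) xor_) (deg w)) (lem (ends w (p e)) (ε w))
    where
    lem : ∀ a b → a xor (b xor a) ≡ b
    lem true true = refl
    lem true false = refl
    lem false true = refl
    lem false false = refl

ConnOn : (D : Fin n → Bool) (p : α → Edge n) → List α → Set
ConnOn D p L = ∀ X → Closed p L X → ∀ u v → D u ≡ true → D v ≡ true → X u ≡ X v

abstract
  -- A union of components contains all of `D` or none of it, so only the total parity of the demand
  -- can obstruct the join.
  tjoin-on : (D : Fin n → Bool) (p : α → Edge n) (L : List α) (ε : Fin n → Bool) → ConnOn D p L →
    (∀ v → D v ≡ false → ε v ≡ false) → ParF ε ≡ false →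
    ∃ λ J → ∃ λ J' → L ≈ J ++ J' × (∀ v → Par (ends v ∘ p) J ≡ ε v)
  tjoin-on D p L ε conn supp even = tjoin p L ε ok
    where
    ok : ∀ X → Closed p L X → ParF (λ v → X v ∧ ε v) ≡ false
    ok X c with any? (λ v → (D v ≟ᵇ true) ×-dec (X v ≟ᵇ true))
    ... | yes (u , Du , Xu) = trans (Par-cong eq allV) even
      where
      eq : ∀ v → X v ∧ ε v ≡ ε v
      eq v with D v in Dv
      ... | true = cong (_∧ ε v) (trans (sym (conn X c u v Du Dv)) Xu)
      ... | false = trans (cong (X v ∧_) (supp v Dv)) (trans (∧-comm (X v) false) (sym (supp v Dv)))
    ... | no ¬u = trans (Par-cong eq allV) (Par-false (allV {_}))
      where
      eq : ∀ v → X v ∧ ε v ≡ false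
      eq v with D v in Dv | X v in Xv
      ... | true | true = contradiction (v , Dv , Xv) ¬u
      ... | _ | false = refl
      ... | false | true = supp v Dv

-- Pairing edges into cherries, and choosing one arm of each.

-- A cherry (c , x , y) stands for the two edges cx and cy.
Cherry : ℕ → Set
Cherry n = Fin n × Fin n × Fin n

tips : Cherry n → Edge n
tips = proj₂

first second : Cherry n → Edge n
first (c , x , y) = c , x
second (c , x , y) = c , y

flip : Cherry n → Cherry n
flip (c , x , y) = c , y , x

arms : List (Cherry n) → List (Edge n)
arms K = map first K ++ map second K

abstract
  -- Flipping a cherry changes the parity of the first arms at both of its tips, so the cherries to
  -- be flipped form a T-join in the graph of the tips. The number of first arms is `length K`
  -- before and after, whence the condition on the total.
  orient : (D : Fin n → Bool) (K : List (Cherry n)) (t : Fin n → Bool) → ConnOn D tips K →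
    (∀ v → D v ≡ false → t v ≡ par (d₂ v (map first K))) → ParF t ≡ par (length K) →
    ∃ λ K' → (∀ v → par (d₂ v (map first K')) ≡ t v) × arms K' ≈ arms K × map proj₁ K' ≈ map proj₁ K
  orient {n} D K t conn supp total with tjoin-on D tips K ε conn suppε evenε
    where
    fst-par : Fin n → Bool
    fst-par v = par (d₂ v (map first K))
    ε : Fin n → Bool
    ε v = t v xor fst-par v
    suppε : ∀ v → D v ≡ false → ε v ≡ false
    suppε v Dv = trans (cong (_xor fst-par v) (supp v Dv)) (xor-same (fst-par v))
    evenε : ParF ε ≡ false
    evenε = trans (Par-xor t fst-par allV) (trans (cong₂ _xor_ total
      (trans (sym (par-Sum (λ v → d₂ v (map first K)) allV))
        (cong par (trans (fiber-count proj₂ (map first K)) (length-map first K))))) (xor-same (par (length K))))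
  ... | J , J' , eqv , deg = map flip J ++ J' , degs , arms≈ , centers
    where
    degs : ∀ v → par (d₂ v (map first (map flip J ++ J'))) ≡ t v
    degs v = begin
      par (d₂ v (map first (map flip J ++ J')))
        ≡⟨ par-Sum _ (map first (map flip J ++ J')) ⟩
      Par (λ e → par ⟦ proj₂ e == v ⟧) (map first (map flip J ++ J'))
        ≡⟨ trans (Par-map _ first (map flip J ++ J')) (trans (Par-++ _ (map flip J) J') (cong (_xor _) (Par-map _ flip J))) ⟩
      Par (λ k → par ⟦ proj₂ (tips k) == v ⟧) J xor P J'
        ≡⟨ cong (_xor P J') (Par-cong (λ k → lem (proj₁ (tips k) == v) (proj₂ (tips k) == v)) J) ⟩
      Par (λ k → par ⟦ proj₁ (tips k) == v ⟧ xor ends v (tips k)) J xor P J'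
        ≡⟨ cong (_xor P J') (Par-xor _ _ J) ⟩
      (P J xor Par (ends v ∘ tips) J) xor P J'
        ≡⟨ cong (λ b → (P J xor b) xor P J') (deg v) ⟩
      (P J xor (t v xor par (d₂ v (map first K)))) xor P J'
        ≡⟨ cong (λ b → (P J xor (t v xor b)) xor P J') (trans (par-Sum _ (map first K)) (trans (Par-map _ first K) (trans (Par-≈ eqv _) (Par-++ _ J J')))) ⟩
      (P J xor (t v xor (P J xor P J'))) xor P J'
        ≡⟨ lem₂ (P J) (P J') (t v) ⟩
      t v ∎
      where
      open ≡-Reasoning
      P : List (Cherry n) → Bool
      P = Par (λ k → par ⟦ proj₁ (tips k) == v ⟧)
      lem : ∀ a b → par ⟦ b ⟧ ≡ par ⟦ a ⟧ xor (a xor b)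
      lem true true = refl
      lem true false = refl
      lem false true = refl
      lem false false = refl
      lem₂ : ∀ a b c → (a xor (c xor (a xor b))) xor b ≡ c
      lem₂ true true true = refl
      lem₂ true true false = refl
      lem₂ true false true = refl
      lem₂ true false false = refl
      lem₂ false true true = refl
      lem₂ false true false = refl
      lem₂ false false true = refl
      lem₂ false false false = refl
    Sum-arms : ∀ f (L : List (Cherry n)) → Sum f (arms L) ≡ Sum (λ k → f (first k) + f (second k)) L
    Sum-arms f L = trans (Sum-++ f (map first L) _) (trans (cong₂ _+_ (Sum-map f first L) (Sum-map f second L)) (sym (Sum-+ _ _ L)))
    flip-invariant : ∀ (g : Cherry n → ℕ) → (∀ k → g (flip k) ≡ g k) → Sum g (map flip J ++ J') ≡ Sum g K
    flip-invariant g inv = trans (Sum-++ g (map flip J) J') (trans (cong (_+ Sum g J') (trans (Sum-map g flip J) (Sum-cong inv J)))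
      (trans (sym (Sum-++ g J J')) (sym (at eqv g))))
    arms≈ : arms (map flip J ++ J') ≈ arms K
    arms≈ = mk λ f → trans (Sum-arms f (map flip J ++ J')) (trans (flip-invariant _ (λ k → +-comm (f (second k)) (f (first k)))) (sym (Sum-arms f K)))
    centers : map proj₁ (map flip J ++ J') ≈ map proj₁ K
    centers = mk λ f → trans (Sum-map f proj₁ (map flip J ++ J')) (trans (flip-invariant (f ∘ proj₁) (λ k → refl)) (sym (Sum-map f proj₁ K)))

abstract
  pairing : (L : List (Edge n)) → (∀ c → par (d₁ c L) ≡ false) → ∃ λ K → arms K ≈ L
  pairing L = go (length L) L ≤-refl
    where
    go : ∀ fuel (L : List (Edge n)) → length L ≤ fuel → (∀ c → par (d₁ c L) ≡ false) → ∃ λ K → arms K ≈ L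
    go fuel [] _ even = [] , ≈-refl
    go (suc fuel) ((c , x) ∷ L) (s≤s le) even
      with extract (λ e → proj₁ e == c) L (par-pos _ (lem {d₁ c L} (trans (cong (λ b → par (⟦ b ⟧ + d₁ c L)) (sym (==-refl c))) (even c))))
      where
      lem : ∀ {m} → par (suc m) ≡ false → par m ≡ true
      lem {m} p with par m
      ... | true = refl
    ... | (c' , y) , L' , c'≡c , eqv with refl ← ==-≡ {i = c'} {c} c'≡c
      with go fuel L' (≤-trans (≤-trans (n≤1+n _) (≤-reflexive (sym (≈-length eqv)))) le) even'
      where
      even' : ∀ v → par (d₁ v L') ≡ false
      even' v = trans (sym (trans (cong par (sym (+-assoc ⟦ c == v ⟧ ⟦ c == v ⟧ (d₁ v L')))) (trans (par-+ (⟦ c == v ⟧ + ⟦ c == v ⟧) (d₁ v L'))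
        (cong (_xor par (d₁ v L')) (par-double ⟦ c == v ⟧))))) (trans (cong (λ m → par (⟦ c == v ⟧ + m)) (sym (at eqv _))) (even v))
    ... | K , eqK = (c , x , y) ∷ K , mk λ f → trans (lem f) (cong (f (c , x) +_) (sym (at eqv f)))
      where
      lem : ∀ f → f (c , x) + Sum f (map first K ++ (c , y) ∷ map second K) ≡ f (c , x) + (f (c , y) + Sum f L')
      lem f = cong (f (c , x) +_) (trans (at (≈-shift (map first K) (c , y) (map second K)) f) (cong (f (c , y) +_) (at eqK f)))

  select : (k : α → Fin n) (L : List α) (μ : Fin n → ℕ) → (∀ v → μ v ≤ Sum (λ x → ⟦ k x == v ⟧) L) →
    ∃ λ M → ∃ λ P → L ≈ M ++ P × (∀ v → Sum (λ x → ⟦ k x == v ⟧) M ≡ μ v)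
  select k [] μ le = [] , [] , ≈-refl , λ v → sym (n≤0⇒n≡0 (le v))
  select k (x ∷ L) μ le with μ (k x) in eq
  ... | zero with select k L μ le'
    where
    le' : ∀ v → μ v ≤ Sum (λ y → ⟦ k y == v ⟧) L
    le' v with le v
    ... | p with k x ≟ᶠ v
    ... | yes refl = subst (_≤ _) (sym eq) z≤n
    ... | no _ = p
  ... | M , P , eqv , deg = M , x ∷ P , ≈-trans (≈-∷ x eqv) (≈-sym (≈-shift M x P)) , deg
  select k (x ∷ L) μ le | suc m with select k L (λ v → μ v ∸ ⟦ k x == v ⟧) (λ v → m≤n+o⇒m∸n≤o (μ v) ⟦ k x == v ⟧ (le v))
  ... | M , P , eqv , deg = x ∷ M , P , ≈-∷ x eqv , λ v → trans (cong (⟦ k x == v ⟧ +_) (deg v)) (m+[n∸m]≡n (pos v))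
    where
    pos : ∀ v → ⟦ k x == v ⟧ ≤ μ v
    pos v with k x ≟ᶠ v
    ... | yes refl = subst (1 ≤_) (sym eq) (s≤s z≤n)
    ... | no _ = z≤n

  match : (kx : α → Fin n) (ky : β → Fin n) (xs : List α) (ys : List β) →
    (∀ v → Sum (λ x → ⟦ kx x == v ⟧) xs ≡ Sum (λ y → ⟦ ky y == v ⟧) ys) →
    ∃ λ Z → map proj₁ Z ≈ xs × map proj₂ Z ≈ ys × All (λ z → kx (proj₁ z) ≡ ky (proj₂ z)) Z
  match kx ky [] [] eq = [] , ≈-refl , ≈-refl , []
  match kx ky [] (y ∷ ys) eq with () ← trans (eq (ky y)) (cong (λ b → ⟦ b ⟧ + Sum (λ z → ⟦ ky z == ky y ⟧) ys) (==-refl (ky y)))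
  match kx ky (x ∷ xs) ys eq
    with extract (λ y → ky y == kx x) ys (≤-trans (s≤s z≤n) (≤-reflexive (trans (cong (λ b → ⟦ b ⟧ + Sum (λ z → ⟦ kx z == kx x ⟧) xs) (sym (==-refl (kx x)))) (eq (kx x)))))
  ... | y , ys' , ky≡ , eqv with match kx ky xs ys' (λ v → +-cancelˡ-≡ ⟦ kx x == v ⟧ _ _
      (trans (eq v) (trans (at eqv _) (cong (λ z → ⟦ z == v ⟧ + Sum (λ y → ⟦ ky y == v ⟧) ys') (==-≡ {i = ky y} {kx x} ky≡)))))
  ... | Z , p₁ , p₂ , keys = (x , y) ∷ Z , ≈-∷ x p₁ , ≈-trans (≈-∷ y p₂) (≈-sym eqv) , sym (==-≡ {i = ky y} {kx x} ky≡) ∷ keys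

allSubsets : ∀ n → List (Vec Bool n)
allSubsets zero = []ᵛ ∷ []
allSubsets (suc n) = map (true ∷ᵛ_) (allSubsets n) ++ map (false ∷ᵛ_) (allSubsets n)

∈-allSubsets : ∀ {n} (s : Vec Bool n) → s ∈ allSubsets n
∈-allSubsets []ᵛ = here refl
∈-allSubsets (true ∷ᵛ s) = ∈-++⁺ˡ (∈-map⁺ (true ∷ᵛ_) (∈-allSubsets s))
∈-allSubsets {suc n} (false ∷ᵛ s) = ∈-++⁺ʳ (map (true ∷ᵛ_) (allSubsets n)) (∈-map⁺ (false ∷ᵛ_) (∈-allSubsets s))

Sum-mono-< : ∀ {A : Set} {f g : A → ℕ} (xs : List A) → (∀ x → f x ≤ g x) → ∀ {x} → x ∈ xs → f x < g x → Sum f xs < Sum g xs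
Sum-mono-< (x ∷ xs) le (here refl) lt = +-mono-<-≤ lt (Sum-mono le xs)
Sum-mono-< (y ∷ xs) le (there x∈) lt = +-mono-≤-< (le y) (Sum-mono-< xs le x∈ lt)

does-mono : {P Q : Set} (p? : Dec P) (q? : Dec Q) → (P → Q) → ⟦ does p? ⟧ ≤ ⟦ does q? ⟧
does-mono (no _) q? f = z≤n
does-mono (yes p) q? f = ≤-reflexive (cong ⟦_⟧ (sym (dec-true q? (f p))))

module _ {n : ℕ} where

  -- This is 2 to the number of components of the graph of the tips; it serves as the measure that
  -- drops when components merge.
  closedCount : List (Cherry n) → ℕ
  closedCount K = Sum (λ s → ⟦ does (closed-dec tips K s) ⟧) (allSubsets n)

  arms-∈ : ∀ (K : List (Cherry n)) {c x} → (c , x) ∈ arms K → ∃ λ k → k ∈ K × proj₁ k ≡ c × (x ≡ proj₁ (tips k) ⊎ x ≡ proj₂ (tips k))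
  arms-∈ K e∈ with ∈-++⁻ (map first K) e∈
  ... | inj₁ p with ∈-map⁻ first p
  ... | k , k∈ , refl = k , k∈ , refl , inj₁ refl
  arms-∈ K e∈ | inj₂ p with ∈-map⁻ second p
  ... | k , k∈ , refl = k , k∈ , refl , inj₂ refl

  Sum-arms : ∀ f (L : List (Cherry n)) → Sum f (arms L) ≡ Sum (λ k → f (first k) + f (second k)) L
  Sum-arms f L = trans (Sum-++ f (map first L) _) (trans (cong₂ _+_ (Sum-map f first L) (Sum-map f second L)) (sym (Sum-+ _ _ L)))

  -- The degrees of the vertices in `X` add up to the number of crossing cherries modulo two, since
  -- a cherry with both tips in `X` is counted twice.
  even-crossings : (K : List (Cherry n)) → (∀ v → par (d₂ v (arms K)) ≡ false) → ∀ (X : Fin n → Bool) →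
    Par (λ k → X (proj₁ (tips k)) xor X (proj₂ (tips k))) K ≡ false
  even-crossings K even X = begin
    Par (λ k → X (proj₁ (tips k)) xor X (proj₂ (tips k))) K ≡⟨ Par-cong (λ k → sym (ParF-ends X (tips k))) K ⟩
    Par (λ k → ParF (λ v → X v ∧ ends v (tips k))) K ≡⟨ Par-swap (λ k v → X v ∧ ends v (tips k)) K allV ⟩
    ParF (λ v → Par (λ k → X v ∧ ends v (tips k)) K) ≡⟨ Par-cong (λ v → trans (Par-∧ (X v) _ K) (trans (cong (X v ∧_) (degree v)) (∧-comm (X v) false))) allV ⟩
    ParF {n} (λ v → false) ≡⟨ Par-false (allV {n}) ⟩
    false ∎
    where
    open ≡-Reasoning
    degree : ∀ v → Par (λ k → ends v (tips k)) K ≡ false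
    degree v = trans (Par-cong (λ k → sym (trans (par-+ ⟦ proj₁ (tips k) == v ⟧ ⟦ proj₂ (tips k) == v ⟧)
        (cong₂ _xor_ (par-⟦⟧ (proj₁ (tips k) == v)) (par-⟦⟧ (proj₂ (tips k) == v))))) K)
      (trans (sym (par-Sum _ K)) (trans (cong par (sym (Sum-arms _ K))) (even v)))

  -- Swapping arms of two cherries at c in different components merges the components, because the
  -- graph of the tips has even degrees and hence no bridge.
  abstract
    repair : (K : List (Cherry n)) → (∀ v → par (d₂ v (arms K)) ≡ false) → ∀ {c x₁ y₁ x₂ y₂} →
      (c , x₁ , y₁) ∈ K → (c , x₂ , y₂) ∈ K → ∀ s → All (λ k → lookup s (proj₁ (tips k)) ≡ lookup s (proj₂ (tips k))) K →
      lookup s x₁ ≡ true → lookup s x₂ ≡ false →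
      ∃ λ K' → arms K' ≈ arms K × closedCount K' < closedCount K
    repair K even {c} {x₁} {y₁} {x₂} {y₂} k₁∈ k₂∈ s cs s₁ s₂ with remove k₁∈
    ... | K₁ , eq₁ , split₁ , back₁ with split₁ k₂∈
    ... | inj₁ refl = ⊥-elim (true≢false s₁ s₂)
    ... | inj₂ k₂∈' with remove k₂∈'
    ... | K₂ , eq₂ , split₂ , back₂ = K' , arms≈ , Sum-mono-< (allSubsets n) fewer (∈-allSubsets s) strict
      where
      K' : List (Cherry n)
      K' = (c , x₁ , x₂) ∷ (c , y₁ , y₂) ∷ K₂
      K≈ : K ≈ (c , x₁ , y₁) ∷ (c , x₂ , y₂) ∷ K₂
      K≈ = ≈-trans eq₁ (≈-∷ _ eq₂)
      arms≈ : arms K' ≈ arms K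
      arms≈ = mk λ f → trans (Sum-arms f K') (trans (lem (f (c , x₁)) (f (c , x₂)) (f (c , y₁)) (f (c , y₂)) _)
        (trans (sym (at K≈ (λ k → f (first k) + f (second k)))) (sym (Sum-arms f K))))
        where
        lem : ∀ a b d e t → a + b + (d + e + t) ≡ a + d + (b + e + t)
        lem = solve-∀
      s-closed : ∀ {k} → k ∈ K → lookup s (proj₁ (tips k)) ≡ lookup s (proj₂ (tips k))
      s-closed = lookupAll cs
      ClosedIn : List (Cherry n) → Vec Bool n → Set
      ClosedIn L t = All (λ k → lookup t (proj₁ (tips k)) ≡ lookup t (proj₂ (tips k))) L
      old-closed : ∀ t → ClosedIn K' t → ClosedIn K t
      old-closed t (x-eq ∷ y-eq ∷ ct) = tabulateAll λ k∈ → case split₁ k∈ of λ where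
          (inj₁ refl) → eqx₁
          (inj₂ k∈₁) → case split₂ k∈₁ of λ where
            (inj₁ refl) → trans (sym x-eq) (trans eqx₁ y-eq)
            (inj₂ k∈₂) → lookupAll ct k∈₂
        where
        -- Evenness is applied to the cut of `t` and `s` together. The untouched cherries are closed
        -- under both, and the tips of the second cherry lie outside `s`; so the first does not
        -- cross either, and `t` agrees on `x₁` and `y₁`.
        Z : Fin n → Bool
        Z v = lookup t v ∧ lookup s v
        Zcross : Cherry n → Bool
        Zcross k = Z (proj₁ (tips k)) xor Z (proj₂ (tips k))
        others : ∀ L → (∀ {k} → k ∈ L → k ∈ K₂) → Par Zcross L ≡ false
        others [] sub = refl
        others (k ∷ L) sub = cong₂ _xor_ (trans (cong (_xor Z (proj₂ (tips k)))
          (cong₂ _∧_ (lookupAll ct (sub (here refl))) (s-closed (back₁ (back₂ (sub (here refl))))))) (xor-same (Z (proj₂ (tips k))))) (others L (sub ∘ there))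
        total : Zcross (c , x₁ , y₁) xor (Zcross (c , x₂ , y₂) xor Par Zcross K₂) ≡ false
        total = trans (sym (Par-≈ K≈ Zcross)) (even-crossings K even Z)
        eqx₁ : lookup t x₁ ≡ lookup t y₁
        eqx₁ = lem' (lookup t x₁) (lookup t y₁) (lookup t x₂) (lookup t y₂) s₁ (s-closed k₁∈) s₂ (s-closed k₂∈) (others K₂ id) total
          where
          lem : ∀ a b d e → ((a ∧ true) xor (b ∧ true)) xor (((d ∧ false) xor (e ∧ false)) xor false) ≡ false → a ≡ b
          lem true true _ _ _ = refl
          lem false false _ _ _ = refl
          lem true false true true ()
          lem true false true false ()
          lem true false false true ()
          lem true false false false ()
          lem false true true true ()
          lem false true true false ()
          lem false true false true ()
          lem false true false false ()
          lem' : ∀ a b d e {p q r w z} → p ≡ true → p ≡ q → r ≡ false → r ≡ w → z ≡ false →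
            ((a ∧ p) xor (b ∧ q)) xor (((d ∧ r) xor (e ∧ w)) xor z) ≡ false → a ≡ b
          lem' a b d e refl refl refl refl refl = lem a b d e
      fewer : ∀ t → ⟦ does (closed-dec tips K' t) ⟧ ≤ ⟦ does (closed-dec tips K t) ⟧
      fewer t = does-mono (closed-dec tips K' t) (closed-dec tips K t) (old-closed t)
      strict : ⟦ does (closed-dec tips K' s) ⟧ < ⟦ does (closed-dec tips K s) ⟧
      strict = ≤-reflexive (trans (cong (suc ∘ ⟦_⟧) (dec-false (closed-dec tips K' s) λ { (p ∷ _) → true≢false s₁ (trans p s₂) }))
        (cong ⟦_⟧ (sym (dec-true (closed-dec tips K s) cs))))

  abstract
    -- If a union `s` of components of the tips splits `D`, some centre has cherries on both sides
    -- of `s` and can be repaired: otherwise `Y`, the side of the cherries at each centre, would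
    -- extend `s` to a colouring constant on `Q`. Centres and tips are coloured separately because
    -- they lie on opposite sides of a bipartite graph.
    connected-pairing : (D : Fin n → Bool) (Q : List (Edge n)) →
      (∀ c → par (d₁ c Q) ≡ false) → (∀ v → par (d₂ v Q) ≡ false) →
      (∀ (Y X : Fin n → Bool) → (∀ {c x} → (c , x) ∈ Q → Y c ≡ X x) → ∀ u v → D u ≡ true → D v ≡ true → X u ≡ X v) →
      ∃ λ K → arms K ≈ Q × ConnOn D tips K
    connected-pairing D Q even₁ even₂ conn with pairing Q even₁
    ... | K₀ , eq₀ = go (closedCount K₀) K₀ ≤-refl eq₀
      where
      go : ∀ fuel K → closedCount K ≤ fuel → arms K ≈ Q → ∃ λ K → arms K ≈ Q × ConnOn D tips K
      go fuel K le eqK with anySubset? {n = n} (λ s → closed-dec tips K s ×-dec any? (λ u → any? (λ v →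
          (D u ≟ᵇ true) ×-dec (D v ≟ᵇ true) ×-dec ¬? (lookup s u ≟ᵇ lookup s v))))
      ... | no ¬bad = K , eqK , connected
        where
        connected : ConnOn D tips K
        connected X c u v Du Dv with X u ≟ᵇ X v
        ... | yes p = p
        ... | no p = contradiction (tabulateᵛ X , closed-tabulate tips c , u , v , Du , Dv ,
                λ q → p (trans (sym (lookup∘tabulate X u)) (trans q (lookup∘tabulate X v)))) ¬bad
      ... | yes (s , cs , u , v , Du , Dv , u≢v) with anyList? (λ k₁ → anyList? (λ k₂ →
          (proj₁ k₁ ≟ᶠ proj₁ k₂) ×-dec (lookup s (proj₁ (tips k₁)) ≟ᵇ true) ×-dec (lookup s (proj₁ (tips k₂)) ≟ᵇ false)) K) K
      ... | no ¬pair = contradiction (conn Y (lookup s) agree u v Du Dv) u≢v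
        where
        hit? : ∀ c → Dec (Any (λ k → proj₁ k ≡ c × lookup s (proj₁ (tips k)) ≡ true) K)
        hit? c = anyList? (λ k → (proj₁ k ≟ᶠ c) ×-dec (lookup s (proj₁ (tips k)) ≟ᵇ true)) K
        Y : Fin n → Bool
        Y c = does (hit? c)
        agree : ∀ {c x} → (c , x) ∈ Q → Y c ≡ lookup s x
        agree {c} {x} e∈ with arms-∈ K (≈-∈ (≈-sym eqK) e∈)
        ... | k , k∈ , refl , which = trans side (sym (sx which))
          where
          sx : x ≡ proj₁ (tips k) ⊎ x ≡ proj₂ (tips k) → lookup s x ≡ lookup s (proj₁ (tips k))
          sx (inj₁ refl) = refl
          sx (inj₂ refl) = sym (lookupAll cs k∈)
          side : Y c ≡ lookup s (proj₁ (tips k))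
          side with lookup s (proj₁ (tips k)) in sk
          ... | true = dec-true (hit? c) (lose k∈ (refl , sk))
          ... | false = dec-false (hit? c) λ hit → case find hit of λ where
            (k₁ , k₁∈ , c≡ , s₁) → ¬pair (lose k₁∈ (lose k∈ (c≡ , s₁ , sk)))
      ... | yes pair with find pair
      ... | k₁ , k₁∈ , pair₁ with find pair₁
      ... | k₂ , k₂∈ , refl , s₁ , s₂ with repair K (λ v → trans (cong par (at eqK _)) (even₂ v)) k₁∈ k₂∈ s cs s₁ s₂
      ... | K' , arms≈ , lt with fuel
      ... | zero = contradiction (≤-trans lt le) λ ()
      ... | suc fuel' = go fuel' K' (≤-pred (≤-trans lt le)) (≈-trans arms≈ eqK)

  -- Eulerian orientations, written as a splitting into two labels.

  balance : Fin n → List (Edge n) → List (Edge n) → Set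
  balance v E J = d₁ v J + d₂ v E ≡ d₂ v J + d₁ v E

  Orientation : List (Edge n) → Set
  Orientation L = ∃ λ E → ∃ λ J → L ≈ E ++ J × (∀ v → balance v E J)

  orientation-≈ : ∀ {L L'} → L ≈ L' → Orientation L → Orientation L'
  orientation-≈ p (E , J , eqv , bal) = E , J , ≈-trans (≈-sym p) eqv , bal

  -- Reversing the written direction and moving the edge to the other label leaves the arc that is
  -- traversed unchanged.
  orientation-flip : ∀ {u v L} → Orientation ((u , v) ∷ L) → Orientation ((v , u) ∷ L)
  orientation-flip {u} {v} {L} (E , J , eqv , bal) with ∈-++⁻ E (≈-∈ eqv (here refl))
  ... | inj₁ e∈ with remove e∈
  ... | E₁ , eqE , _ = E₁ , (v , u) ∷ J , mk new ,
    λ x → trans (lem ⟦ v == x ⟧ (d₁ x J) (d₂ x E₁)) (trans (cong (d₁ x J +_) (sym (at eqE _)))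
      (trans (bal x) (trans (cong (d₂ x J +_) (at eqE _)) (sym (lem ⟦ u == x ⟧ (d₂ x J) (d₁ x E₁))))))
    where
    lem : ∀ a b c → a + b + c ≡ b + (a + c)
    lem = solve-∀
    new : ∀ f → f (v , u) + Sum f L ≡ Sum f (E₁ ++ (v , u) ∷ J)
    new f = trans (cong (f (v , u) +_) (+-cancelˡ-≡ (f (u , v)) _ _ (trans (at eqv f) (at (≈-++ eqE (≈-refl {xs = J})) f))))
      (sym (at (≈-shift E₁ (v , u) J) f))
  orientation-flip {u} {v} {L} (E , J , eqv , bal) | inj₂ e∈ with remove e∈
  ... | J₁ , eqJ , _ = (v , u) ∷ E , J₁ , mk new ,
    λ x → trans (lem (d₁ x J₁) ⟦ u == x ⟧ (d₂ x E)) (trans (cong (_+ d₂ x E) (sym (at eqJ _)))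
      (trans (bal x) (trans (cong (_+ d₁ x E) (at eqJ _)) (sym (lem (d₂ x J₁) ⟦ v == x ⟧ (d₁ x E))))))
    where
    lem : ∀ a b c → a + (b + c) ≡ b + a + c
    lem = solve-∀
    new : ∀ f → f (v , u) + Sum f L ≡ f (v , u) + Sum f (E ++ J₁)
    new f = cong (f (v , u) +_) (+-cancelˡ-≡ (f (u , v)) _ _ (trans (at eqv f)
      (trans (at (≈-++ (≈-refl {xs = E}) eqJ) f) (at (≈-shift E (u , v) J₁) f))))

  -- Both halves inherit the label of the divided edge, so the walk enters and leaves `w` once more.
  orientation-subdivide : ∀ {u z L} w → Orientation ((u , z) ∷ L) → Orientation ((u , w) ∷ (w , z) ∷ L)
  orientation-subdivide {u} {z} {L} w (E , J , eqv , bal) with ∈-++⁻ E (≈-∈ eqv (here refl))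
  ... | inj₁ e∈ with remove e∈
  ... | E₁ , eqE , _ = (u , w) ∷ (w , z) ∷ E₁ , J , ≈-∷ (u , w) (≈-∷ (w , z) (mk new)) ,
    λ v → trans (lem₁ (d₁ v J) ⟦ w == v ⟧ ⟦ z == v ⟧ (d₂ v E₁)) (trans (cong (⟦ w == v ⟧ +_)
      (trans (cong (d₁ v J +_) (sym (at eqE _))) (trans (bal v) (cong (d₂ v J +_) (at eqE _)))))
      (lem₂ (d₂ v J) ⟦ w == v ⟧ ⟦ u == v ⟧ (d₁ v E₁)))
    where
    lem₁ : ∀ a b c d → a + (b + (c + d)) ≡ b + (a + (c + d))
    lem₁ = solve-∀
    lem₂ : ∀ a b c d → b + (a + (c + d)) ≡ a + (c + (b + d))
    lem₂ = solve-∀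
    new : ∀ f → Sum f L ≡ Sum f (E₁ ++ J)
    new f = +-cancelˡ-≡ (f (u , z)) _ _ (trans (at eqv f) (at (≈-++ eqE (≈-refl {xs = J})) f))
  orientation-subdivide {u} {z} {L} w (E , J , eqv , bal) | inj₂ e∈ with remove e∈
  ... | J₁ , eqJ , _ = E , (u , w) ∷ (w , z) ∷ J₁ ,
    ≈-trans (≈-∷ (u , w) (≈-trans (≈-∷ (w , z) (mk new)) (≈-sym (≈-shift E (w , z) J₁)))) (≈-sym (≈-shift E (u , w) ((w , z) ∷ J₁))) ,
    λ v → trans (lem₁ ⟦ u == v ⟧ ⟦ w == v ⟧ (d₁ v J₁) (d₂ v E)) (trans (cong (⟦ w == v ⟧ +_)
      (trans (cong (_+ d₂ v E) (sym (at eqJ _))) (trans (bal v) (cong (_+ d₁ v E) (at eqJ _)))))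
      (lem₂ ⟦ w == v ⟧ ⟦ z == v ⟧ (d₂ v J₁) (d₁ v E)))
    where
    lem₁ : ∀ a b c d → a + (b + c) + d ≡ b + (a + c + d)
    lem₁ = solve-∀
    lem₂ : ∀ b a c d → b + (a + c + d) ≡ b + (a + c) + d
    lem₂ = solve-∀
    new : ∀ f → Sum f L ≡ Sum f (E ++ J₁)
    new f = +-cancelˡ-≡ (f (u , z)) _ _ (trans (at eqv f)
      (trans (at (≈-++ (≈-refl {xs = E}) eqJ) f) (at (≈-shift E (u , z) J₁) f)))

  -- J is traversed forwards and E backwards. The induction replaces two adjacent edges uw, wz by uz.
  abstract
    euler : (L : List (Edge n)) → (∀ v → Par (ends v) L ≡ false) → Orientation L
    euler L = go (length L) L ≤-refl
      where
      contract : ∀ a b d t → (a xor d) xor t ≡ (a xor b) xor ((b xor d) xor t)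
      contract true true true t = refl
      contract true true false t = refl
      contract true false true t = sym (not-involutive t)
      contract true false false t = refl
      contract false true true t = refl
      contract false true false t = sym (not-involutive t)
      contract false false true t = refl
      contract false false false t = refl
      go : ∀ fuel (L : List (Edge n)) → length L ≤ fuel → (∀ v → Par (ends v) L ≡ false) → Orientation L
      go fuel [] le even = [] , [] , ≈-refl , λ v → refl
      go (suc fuel) ((u , w) ∷ L) (s≤s le) even with u ≟ᶠ w
      ... | yes refl with go fuel L le (λ v → trans (cong (_xor Par (ends v) L) (sym (xor-same (u == v)))) (even v))
      ... | E , J , eqv , bal = E , (u , u) ∷ J , ≈-trans (≈-∷ _ eqv) (≈-sym (≈-shift E (u , u) J)) ,
        λ v → trans (+-assoc ⟦ u == v ⟧ _ _) (trans (cong (⟦ u == v ⟧ +_) (bal v)) (sym (+-assoc ⟦ u == v ⟧ _ _)))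
      go (suc fuel) ((u , w) ∷ L) (s≤s le) even | no u≢w
        with extract (ends w) L (par-pos _ (trans (sym (Par-Sum⟦⟧ (ends w) L)) (odd (even w))))
        where
        odd : ((u == w) xor (w == w)) xor Par (ends w) L ≡ false → Par (ends w) L ≡ true
        odd p rewrite ==-≢ u≢w | ==-refl w with Par (ends w) L
        ... | true = refl
      ... | (p , q) , L' , end , eqL with p ≟ᶠ w
      ... | yes refl = orientation-≈ (≈-∷ (u , p) (≈-sym eqL)) (orientation-subdivide p (go fuel ((u , q) ∷ L') le' even'))
        where
        le' : suc (length L') ≤ fuel
        le' = ≤-trans (≤-reflexive (sym (≈-length eqL))) le
        even' : ∀ v → Par (ends v) ((u , q) ∷ L') ≡ false
        even' v = trans (contract (u == v) (p == v) (q == v) (Par (ends v) L'))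
          (trans (cong (ends v (u , p) xor_) (sym (Par-≈ eqL (ends v)))) (even v))
      ... | no p≢w with refl ← ==-≡ {i = q} {w} end =
        orientation-≈ (≈-trans (≈-shift ((p , q) ∷ []) (u , q) L') (≈-∷ (u , q) (≈-sym eqL)))
          (orientation-flip (orientation-≈ (≈-shift ((u , q) ∷ []) (q , p) L') (orientation-subdivide q (go fuel ((u , p) ∷ L') le' even'))))
        where
        le' : suc (length L') ≤ fuel
        le' = ≤-trans (≤-reflexive (sym (≈-length eqL))) le
        even' : ∀ v → Par (ends v) ((u , p) ∷ L') ≡ false
        even' v = trans (contract (u == v) (q == v) (p == v) (Par (ends v) L'))
          (trans (cong (λ b → ends v (u , q) xor (b xor Par (ends v) L')) (xor-comm (q == v) (p == v)))
            (trans (cong (ends v (u , q) xor_) (sym (Par-≈ eqL (ends v)))) (even v)))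

-- Connected and bipartite edge lists.

Par-ends : ∀ {n} (v : Fin n) (L : List (Edge n)) → Par (ends v) L ≡ par (d₁ v L) xor par (d₂ v L)
Par-ends v L = trans (Par-xor _ _ L) (cong₂ _xor_ (Par-Sum⟦⟧ _ L) (Par-Sum⟦⟧ _ L))

ParF-par : ∀ {n} (f : Fin n → ℕ) → ParF (λ v → par (f v)) ≡ par (ΣF f)
ParF-par f = sym (par-Sum f allV)

double-cancel-≤ : ∀ {m n} → m + m ≤ n + n → m ≤ n
double-cancel-≤ {m} {n} le with m ≤? n
... | yes p = p
... | no p = contradiction le (<⇒≱ (+-mono-< (≰⇒> p) (≰⇒> p)))

double-cancel : ∀ {m n} → m + m ≡ n + n → m ≡ n
double-cancel p = ≤-antisym (double-cancel-≤ (≤-reflexive p)) (double-cancel-≤ (≤-reflexive (sym p)))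

module _ {n : ℕ} where

  conn-mono : {L L' : List (Edge n)} → (∀ {e} → e ∈ L → e ∈ L') → Conn L → Conn L'
  conn-mono sub conn X c = conn X (c ∘ sub)

  conn-swap : {L : List (Edge n)} → Conn L → Conn (map swap L)
  conn-swap conn X c = conn X λ e∈ → sym (c (∈-map⁺ swap e∈))

  conn-degree : {L : List (Edge n)} → Conn L → ∀ {u v} → u ≢ v → 1 ≤ d₁ v L + d₂ v L
  conn-degree {L} conn {u} {v} u≢v with d₁ v L + d₂ v L in eq
  ... | suc m = s≤s z≤n
  ... | zero = contradiction (==-≡ {i = v} {u} (trans (conn (v ==_) closed u v) (==-refl v))) (u≢v ∘ sym)
    where
    away : ∀ {x} → 1 ≤ d₁ v L ⊎ 1 ≤ d₂ v L → x ≡ v → ⊥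
    away (inj₁ p) _ = contradiction (≤-trans p (≤-trans (m≤m+n _ (d₂ v L)) (≤-reflexive eq))) λ ()
    away (inj₂ p) _ = contradiction (≤-trans p (≤-trans (m≤n+m _ (d₁ v L)) (≤-reflexive eq))) λ ()
    closed : ∀ {x y} → (x , y) ∈ L → (v == x) ≡ (v == y)
    closed {x} {y} e∈ = trans (==-≢ λ p → away (inj₁ (≤-trans (≤-reflexive (cong ⟦_⟧ (sym (trans (cong (_== v) (sym p)) (==-refl v))))) (Sum-∈ _ e∈))) (sym p))
      (sym (==-≢ λ p → away (inj₂ (≤-trans (≤-reflexive (cong ⟦_⟧ (sym (trans (cong (_== v) (sym p)) (==-refl v))))) (Sum-∈ _ e∈))) (sym p)))

  record Sided (A : Fin n → Bool) (L : List (Edge n)) : Set where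
    constructor mk
    field sides : ∀ {u v} → (u , v) ∈ L → A u ≡ true × A v ≡ false
  open Sided public

  sided-≈ : ∀ {A L L'} → L ≈ L' → Sided A L → Sided A L'
  sided-≈ eqv sided = mk (sides sided ∘ ≈-∈ (≈-sym eqv))

  sided-++ˡ : ∀ {A} (L : List (Edge n)) {L'} → Sided A (L ++ L') → Sided A L
  sided-++ˡ L sided = mk (sides sided ∘ ∈-++⁺ˡ)

  sided-++ʳ : ∀ {A} (L : List (Edge n)) {L'} → Sided A (L ++ L') → Sided A L'
  sided-++ʳ L sided = mk (sides sided ∘ ∈-++⁺ʳ L)

  sided-++ : ∀ {A} {L L' : List (Edge n)} → Sided A L → Sided A L' → Sided A (L ++ L')
  sided-++ {L = L} s s' = mk λ e∈ → case ∈-++⁻ L e∈ of λ { (inj₁ p) → sides s p ; (inj₂ p) → sides s' p }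

  sided-swap : ∀ {A} {L : List (Edge n)} → Sided A L → Sided (not ∘ A) (map swap L)
  sided-swap sided = mk λ e∈ → case ∈-map⁻ swap e∈ of λ where
    (_ , uv∈ , refl) → cong not (proj₂ (sides sided uv∈)) , cong not (proj₁ (sides sided uv∈))

  d₁-sided : ∀ {A} {L : List (Edge n)} → Sided A L → ∀ {v} → A v ≡ false → d₁ v L ≡ 0
  d₁-sided {L = L} sided {v} Av = trans (Sum-cong-∈ L λ {x} e∈ → cong ⟦_⟧ (==-≢ {i = proj₁ x} {v} λ { refl → true≢false (proj₁ (sides sided e∈)) Av })) (Sum-0 L)

  d₂-sided : ∀ {A} {L : List (Edge n)} → Sided A L → ∀ {v} → A v ≡ true → d₂ v L ≡ 0
  d₂-sided {L = L} sided {v} Av = trans (Sum-cong-∈ L λ {x} e∈ → cong ⟦_⟧ (==-≢ {i = proj₂ x} {v} λ { refl → true≢false Av (proj₂ (sides sided e∈)) })) (Sum-0 L)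

  even-sides : ∀ {A} {L : List (Edge n)} → Sided A L → ∀ v → Par (ends v) L ≡ false → par (d₁ v L) ≡ false × par (d₂ v L) ≡ false
  even-sides {A} {L} sided v even with A v in Av | trans (sym (Par-ends v L)) even
  ... | true | p rewrite d₂-sided sided Av = trans (sym (xor-identityʳ _)) p , refl
  ... | false | p rewrite d₁-sided sided Av = refl , p

  d₁-swap : ∀ v (L : List (Edge n)) → d₁ v (map swap L) ≡ d₂ v L
  d₁-swap v L = Sum-map _ swap L

  d₂-swap : ∀ v (L : List (Edge n)) → d₂ v (map swap L) ≡ d₁ v L
  d₂-swap v L = Sum-map _ swap L

  d₁-++ : ∀ v (L L' : List (Edge n)) → d₁ v (L ++ L') ≡ d₁ v L + d₁ v L'
  d₁-++ v L L' = Sum-++ _ L L'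

  d₂-++ : ∀ v (L L' : List (Edge n)) → d₂ v (L ++ L') ≡ d₂ v L + d₂ v L'
  d₂-++ v L L' = Sum-++ _ L L'

  abstract
    -- The vertices of odd degree in `T` are even in number, so the connected `T'` contains a join
    -- for them.
    eulerian-union : (T T' : List (Edge n)) → Conn T' → ∃ λ J → ∃ λ J' → T' ≈ J ++ J' × (∀ v → Par (ends v) (T ++ J) ≡ false)
    eulerian-union T T' conn with tjoin-on (const true) id T' (λ v → par (d₁ v T + d₂ v T)) (λ X c u v _ _ → conn X c u v) (λ _ ()) total
      where
      total : ParF (λ v → par (d₁ v T + d₂ v T)) ≡ false
      total = trans (ParF-par _) (trans (cong par (trans (Sum-+ _ _ allV) (cong₂ _+_ (fiber-count proj₁ T) (fiber-count proj₂ T)))) (par-double (length T)))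
    ... | J , J' , eqv , deg = J , J' , eqv , λ v → trans (Par-++ (ends v) T J) (trans (cong₂ _xor_ (trans (Par-ends v T) (sym (par-+ (d₁ v T) _))) (deg v)) (xor-same (par (d₁ v T + d₂ v T))))

    centred-pairing : ∀ {A} (Q : List (Edge n)) → Sided A Q → Conn Q → (∀ v → Par (ends v) Q ≡ false) →
      ∃ λ K → arms K ≈ Q × ConnOn (not ∘ A) tips K
    centred-pairing {A} Q sided conn even = connected-pairing (not ∘ A) Q
      (λ c → proj₁ (even-sides sided c (even c))) (λ v → proj₂ (even-sides sided v (even v))) bip
      where
      bip : ∀ (Y X : Fin n → Bool) → (∀ {c x} → (c , x) ∈ Q → Y c ≡ X x) → ∀ u v → not (A u) ≡ true → not (A v) ≡ true → X u ≡ X v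
      bip Y X agree u v Bu Bv = trans (sym (at-end (flip-not Bu))) (trans (conn Z closed u v) (at-end (flip-not Bv)))
        where
        Z : Fin n → Bool
        Z w = if A w then Y w else X w
        flip-not : ∀ {b} → not b ≡ true → b ≡ false
        flip-not {false} _ = refl
        at-end : ∀ {w} → A w ≡ false → Z w ≡ X w
        at-end {w} p = cong (if_then Y w else X w) p
        closed : ∀ {c x} → (c , x) ∈ Q → Z c ≡ Z x
        closed {c} {x} e∈ = trans (cong (if_then Y c else X c) (proj₁ (sides sided e∈))) (trans (agree e∈) (sym (at-end (proj₂ (sides sided e∈)))))

  d₁-first : ∀ v (K : List (Cherry n)) → d₁ v (map first K) ≡ Sum (λ c → ⟦ c == v ⟧) (map proj₁ K)
  d₁-first v K = trans (Sum-map _ first K) (sym (Sum-map _ proj₁ K))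

  d₁-second : ∀ v (K : List (Cherry n)) → d₁ v (map second K) ≡ Sum (λ c → ⟦ c == v ⟧) (map proj₁ K)
  d₁-second v K = trans (Sum-map _ second K) (sym (Sum-map _ proj₁ K))

-- Labelling the edges of the cut.

-- In a copy of Y with centre a ∈ A, the edge to the vertex of degree two is in J, the edge
-- from there to the far leaf is in E (or in IB), and the other two edges are in P (or in IA).
record Labelling {n : ℕ} (Bp IA IB : List (Edge n)) : Set where
  field
    J E P : List (Edge n)
    total : Bp ≈ J ++ E ++ P
    at-B : ∀ v → d₂ v J ≡ d₂ v E + d₁ v IB
    at-A : ∀ v → d₁ v P + d₁ v IA ≡ d₁ v J + d₁ v J
    -- A value of 1 is excluded: a lone star with its far leaf among its two other leaves could not
    -- be regrouped.
    large : ∀ v → d₁ v J ≡ 0 ⊎ 2 ≤ d₁ v J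

-- `T₀` and `T₁` yield the cherries centred in B, `T₂` the parity correction, `T₃` and `T₄` the
-- cherries centred in A, `T₅` the `J`-edges for the inner edges of B. By `slack`, the `J`-edges
-- fixed before the second stage number at most half of `N` at each vertex.
module Label {n : ℕ} (A : Fin n → Bool) (Bp IA IB T₀ T₁ T₂ T₃ T₄ T₅ N : List (Edge n)) (M : ℕ)
  (split : Bp ≈ T₀ ++ T₁ ++ T₂ ++ T₃ ++ T₄ ++ T₅ ++ N)
  (sided : Sided A Bp)
  (conn₀ : Conn T₀) (conn₁ : Conn T₁) (conn₂ : Conn T₂) (conn₃ : Conn T₃) (conn₄ : Conn T₄)
  (reserve : ∀ v → d₁ v IB ≤ d₂ v T₅)
  (IA-side : ∀ v → A v ≡ false → d₁ v IA ≡ 0) (IB-side : ∀ v → A v ≡ true → d₁ v IB ≡ 0)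
  (slack : ∀ v → (d₁ v T₀ + d₁ v T₁ + d₁ v T₂ + d₁ v T₅) + (d₁ v T₀ + d₁ v T₁ + d₁ v T₂ + d₁ v T₅) ≤ d₁ v N)
  (IA-small : ∀ v → d₁ v IA ≤ d₁ v N) (N-large : ∀ v → A v ≡ true → 8 ≤ d₁ v N)
  (size : length Bp + (length IA + length IB) ≡ (M + M) + (M + M)) where

  sided-all : Sided A (T₀ ++ T₁ ++ T₂ ++ T₃ ++ T₄ ++ T₅ ++ N)
  sided-all = sided-≈ split sided
  s₀ = sided-++ˡ T₀ sided-all
  r₀ = sided-++ʳ T₀ sided-all
  s₁ = sided-++ˡ T₁ r₀
  r₁ = sided-++ʳ T₁ r₀
  s₂ = sided-++ˡ T₂ r₁
  r₂ = sided-++ʳ T₂ r₁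
  s₃ = sided-++ˡ T₃ r₂
  r₃ = sided-++ʳ T₃ r₂
  s₄ = sided-++ˡ T₄ r₃
  r₄ = sided-++ʳ T₄ r₃
  s₅ = sided-++ˡ T₅ r₄
  sN = sided-++ʳ T₅ r₄

  euler₁ = eulerian-union T₀ T₁ conn₁
  J₁ = proj₁ euler₁
  J₁' = proj₁ (proj₂ euler₁)
  eq₁ : T₁ ≈ J₁ ++ J₁'
  eq₁ = proj₁ (proj₂ (proj₂ euler₁))
  Q₁ = T₀ ++ J₁
  even₁ : ∀ v → Par (ends v) Q₁ ≡ false
  even₁ = proj₂ (proj₂ (proj₂ euler₁))
  sidedQ₁ : Sided A Q₁
  sidedQ₁ = sided-++ s₀ (sided-++ˡ J₁ (sided-≈ eq₁ s₁))

  selR = select proj₂ T₅ (λ v → d₁ v IB) reserve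
  R = proj₁ selR
  R' = proj₁ (proj₂ selR)
  eqR : T₅ ≈ R ++ R'
  eqR = proj₁ (proj₂ (proj₂ selR))
  degR : ∀ v → d₂ v R ≡ d₁ v IB
  degR = proj₂ (proj₂ (proj₂ selR))
  sidedR : Sided A R
  sidedR = sided-++ˡ R (sided-≈ eqR s₅)
  lengthR : length R ≡ length IB
  lengthR = trans (sym (fiber-count proj₂ R)) (trans (Sum-cong degR allV) (fiber-count proj₁ IB))

  -- The demand under which `D` below becomes even on A, where `Q₁` is even already. On B it
  -- vanishes, so that `J₂` can be paired there.
  ε₂ : Fin n → Bool
  ε₂ v = par (d₁ v Bp + (d₁ v IA + d₁ v R))
  total₂ : ParF ε₂ ≡ false
  total₂ = trans (ParF-par _) (trans (cong par (trans (Sum-+ _ _ allV) (trans (cong₂ _+_ (fiber-count proj₁ Bp) (trans (Sum-+ _ _ allV)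
    (cong₂ _+_ (fiber-count proj₁ IA) (trans (fiber-count proj₁ R) lengthR)))) size))) (par-double (M + M)))
  join₂ = tjoin-on (const true) id T₂ ε₂ (λ X c u v _ _ → conn₂ X c u v) (λ _ ()) total₂
  J₂ = proj₁ join₂
  J₂' = proj₁ (proj₂ join₂)
  eq₂ : T₂ ≈ J₂ ++ J₂'
  eq₂ = proj₁ (proj₂ (proj₂ join₂))
  deg₂ : ∀ v → Par (ends v) J₂ ≡ ε₂ v
  deg₂ = proj₂ (proj₂ (proj₂ join₂))
  sidedJ₂ : Sided A J₂
  sidedJ₂ = sided-++ˡ J₂ (sided-≈ eq₂ s₂)

  euler₄ = eulerian-union T₃ T₄ conn₄
  J₄ = proj₁ euler₄
  J₄' = proj₁ (proj₂ euler₄)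
  eq₄ : T₄ ≈ J₄ ++ J₄'
  eq₄ = proj₁ (proj₂ (proj₂ euler₄))
  Q₂ = T₃ ++ J₄
  even₄ : ∀ v → Par (ends v) Q₂ ≡ false
  even₄ = proj₂ (proj₂ (proj₂ euler₄))
  sidedQ₂ : Sided A Q₂
  sidedQ₂ = sided-++ s₃ (sided-++ˡ J₄ (sided-≈ eq₄ s₄))

  N' : List (Edge n)
  N' = N ++ J₁' ++ J₂' ++ J₄' ++ R'
  sidedN' : Sided A N'
  sidedN' = sided-++ sN (sided-++ (sided-++ʳ J₁ (sided-≈ eq₁ s₁))
    (sided-++ (sided-++ʳ J₂ (sided-≈ eq₂ s₂))
    (sided-++ (sided-++ʳ J₄ (sided-≈ eq₄ s₄)) (sided-++ʳ R (sided-≈ eqR s₅)))))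

  Bp-sum : ∀ f → Sum f Bp ≡ (Sum f Q₁ + (Sum f J₂ + Sum f R)) + (Sum f Q₂ + Sum f N')
  Bp-sum f = trans (trans (at split f) (trans (Sum-++ f T₀ _) (cong (Sum f T₀ +_)
      (trans (Sum-++ f T₁ _) (cong₂ _+_ (parts J₁ J₁' eq₁) (trans (Sum-++ f T₂ _) (cong₂ _+_ (parts J₂ J₂' eq₂)
      (trans (Sum-++ f T₃ _) (cong (Sum f T₃ +_) (trans (Sum-++ f T₄ _) (cong₂ _+_ (parts J₄ J₄' eq₄)
      (trans (Sum-++ f T₅ N) (cong (_+ Sum f N) (parts R R' eqR))))))))))))))
    (trans (lem (Sum f T₀) (Sum f J₁) (Sum f J₁') (Sum f J₂) (Sum f J₂') (Sum f T₃) (Sum f J₄) (Sum f J₄') (Sum f R) (Sum f R') (Sum f N))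
    (sym (cong₂ _+_ (cong (_+ (Sum f J₂ + Sum f R)) (Sum-++ f T₀ J₁)) (cong₂ _+_ (Sum-++ f T₃ J₄)
      (trans (Sum-++ f N _) (cong (Sum f N +_) (trans (Sum-++ f J₁' _) (cong (Sum f J₁' +_)
        (trans (Sum-++ f J₂' _) (cong (Sum f J₂' +_) (Sum-++ f J₄' R')))))))))))
    where
    parts : ∀ {L} X Y → L ≈ X ++ Y → Sum f L ≡ Sum f X + Sum f Y
    parts X Y eqv = trans (at eqv f) (Sum-++ f X Y)
    lem : ∀ t₀ j₁ j₁' j₂ j₂' t₃ j₄ j₄' r r' m →
      t₀ + ((j₁ + j₁') + ((j₂ + j₂') + (t₃ + ((j₄ + j₄') + ((r + r') + m))))) ≡
      ((t₀ + j₁) + (j₂ + r)) + ((t₃ + j₄) + (m + (j₁' + (j₂' + (j₄' + r')))))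
    lem = solve-∀

  -- What the first stage leaves at a vertex of A, owned inner edges included. It has to equal
  -- `2f + 4j` with j second-stage edges in each of `J` and `E`, so its half `h` must have the
  -- parity of `f`.
  D : Fin n → ℕ
  D v = (d₁ v Q₂ + d₁ v N') + d₁ v IA

  evenD : ∀ v → par (D v) ≡ false
  evenD v = go (A v) refl
    where
    go : ∀ b → A v ≡ b → par (D v) ≡ false
    go false Av = cong par (cong₂ _+_ (cong₂ _+_ (d₁-sided sidedQ₂ Av) (d₁-sided sidedN' Av)) (IA-side v Av))
    go true Av = trans (par-+ (d₁ v Q₂ + d₁ v N') _) (lem (par (d₁ v Q₂ + d₁ v N')) (par (d₁ v IA)) (par (d₁ v J₂)) (par (d₁ v R)) (trans parJ₂ (trans (par-+ (d₁ v Bp) _) (cong₂ _xor_ parBp (par-+ (d₁ v IA) _)))))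
      where
      parJ₂ : par (d₁ v J₂) ≡ ε₂ v
      parJ₂ = trans (sym (xor-identityʳ _)) (trans (cong (λ m → par (d₁ v J₂) xor par m) (sym (d₂-sided sidedJ₂ Av)))
        (trans (sym (Par-ends v J₂)) (deg₂ v)))
      parBp : par (d₁ v Bp) ≡ (par (d₁ v J₂) xor par (d₁ v R)) xor par (d₁ v Q₂ + d₁ v N')
      parBp = trans (cong par (Bp-sum _)) (trans (par-+ (d₁ v Q₁ + (d₁ v J₂ + d₁ v R)) _) (cong (_xor par (d₁ v Q₂ + d₁ v N'))
        (trans (par-+ (d₁ v Q₁) _) (cong₂ _xor_ (proj₁ (even-sides sidedQ₁ v (even₁ v))) (par-+ (d₁ v J₂) _)))))
      lem : ∀ x i j r → j ≡ ((j xor r) xor x) xor (i xor r) → x xor i ≡ false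
      lem true true _ _ _ = refl
      lem false false _ _ _ = refl
      lem true false true true ()
      lem true false true false ()
      lem true false false true ()
      lem true false false false ()
      lem false true true true ()
      lem false true true false ()
      lem false true false true ()
      lem false true false false ()

  h : Fin n → ℕ
  h v = proj₁ (half (D v) (evenD v))
  D≡ : ∀ v → D v ≡ h v + h v
  D≡ v = proj₂ (half (D v) (evenD v))

  cherries₁ = centred-pairing (map swap Q₁) (sided-swap sidedQ₁)
    (conn-swap {L = Q₁} (conn-mono {L = T₀} {Q₁} ∈-++⁺ˡ conn₀))
    (λ v → trans (Par-map (ends v) swap Q₁) (trans (Par-cong (λ e → xor-comm (proj₂ e == v) (proj₁ e == v)) Q₁) (even₁ v)))
  K₁ = proj₁ cherries₁
  arms₁ : arms K₁ ≈ map swap Q₁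
  arms₁ = proj₁ (proj₂ cherries₁)
  connK₁ : ConnOn A tips K₁
  connK₁ X c u v Au Av = proj₂ (proj₂ cherries₁) X c u v (trans (not-involutive (A u)) Au) (trans (not-involutive (A v)) Av)

  evenJ₂ : ∀ v → par (d₂ v J₂) ≡ false
  evenJ₂ v = go (A v) refl
    where
    go : ∀ b → A v ≡ b → par (d₂ v J₂) ≡ false
    go true Av = cong par (d₂-sided sidedJ₂ Av)
    go false Av = trans (cong (λ m → par m xor par (d₂ v J₂)) (sym (d₁-sided sidedJ₂ Av))) (trans (sym (Par-ends v J₂))
        (trans (deg₂ v) (cong par (cong₂ _+_ (d₁-sided sided Av) (cong₂ _+_ (IA-side v Av) (d₁-sided sidedR Av))))))
  cherries₂ = pairing (map swap J₂) (λ c → trans (cong par (d₁-swap c J₂)) (evenJ₂ c))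
  K₂ = proj₁ cherries₂
  arms₂ : arms K₂ ≈ map swap J₂
  arms₂ = proj₂ cherries₂

  length-arms : ∀ (K : List (Cherry n)) L → arms K ≈ L → length L ≡ length K + length K
  length-arms K L eqv = trans (sym (≈-length eqv)) (trans (length-++ (map first K)) (cong₂ _+_ (length-map first K) (length-map second K)))

  first-≤ : ∀ v (K : List (Cherry n)) L → arms K ≈ map swap L → d₂ v (map first K) ≤ d₁ v L
  first-≤ v K L eqv = ≤-trans (m≤m+n _ (d₂ v (map second K))) (≤-reflexive (trans (sym (d₂-++ v (map first K) (map second K))) (trans (at eqv _) (d₂-swap v L))))

  -- Half of `size`, expressed by cherries, inner edges of B and `h`. This half is still even by
  -- divisibility by 4, which gives the global parity needed in `total₁`.
  count : (M + M) ≡ (length K₁ + length K₂) + (length IB + ΣF h)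
  count = double-cancel (begin
    (M + M) + (M + M) ≡⟨ size ⟨
    length Bp + (length IA + length IB) ≡⟨ cong (_+ (length IA + length IB)) (trans (sym (Sum-1 Bp)) (trans (Bp-sum (λ _ → 1))
         (cong₂ _+_ (cong₂ _+_ (Sum-1 Q₁) (cong₂ _+_ (Sum-1 J₂) (trans (Sum-1 R) lengthR))) (cong₂ _+_ (Sum-1 Q₂) (Sum-1 N'))))) ⟩
    ((length Q₁ + (length J₂ + length IB)) + (length Q₂ + length N')) + (length IA + length IB)
      ≡⟨ lem₁ (length Q₁) (length J₂) (length IB) (length Q₂ + length N') (length IA) ⟩
    (length Q₁ + length J₂) + ((length IB + length IB) + ((length Q₂ + length N') + length IA))
      ≡⟨ cong₂ (λ x y → x + ((length IB + length IB) + y)) (cong₂ _+_ q₁ j₂) sumD ⟩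
    ((length K₁ + length K₁) + (length K₂ + length K₂)) + ((length IB + length IB) + (ΣF h + ΣF h))
      ≡⟨ lem₂ (length K₁) (length K₂) (length IB) (ΣF h) ⟩
    ((length K₁ + length K₂) + (length IB + ΣF h)) + ((length K₁ + length K₂) + (length IB + ΣF h)) ∎)
    where
    open ≡-Reasoning
    q₁ : length Q₁ ≡ length K₁ + length K₁
    q₁ = trans (sym (length-map swap Q₁)) (length-arms K₁ _ arms₁)
    j₂ : length J₂ ≡ length K₂ + length K₂
    j₂ = trans (sym (length-map swap J₂)) (length-arms K₂ _ arms₂)
    sumD : (length Q₂ + length N') + length IA ≡ ΣF h + ΣF h
    sumD = trans (cong₂ _+_ (cong₂ _+_ (sym (fiber-count proj₁ Q₂)) (sym (fiber-count proj₁ N'))) (sym (fiber-count proj₁ IA)))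
      (trans (cong (_+ _) (sym (Sum-+ _ _ allV))) (trans (sym (Sum-+ _ _ allV)) (trans (Sum-cong D≡ allV) (Sum-+ _ _ allV))))
    lem₁ : ∀ q j i x a → ((q + (j + i)) + x) + (a + i) ≡ (q + j) + ((i + i) + (x + a))
    lem₁ = solve-∀
    lem₂ : ∀ a b c d → ((a + a) + (b + b)) + ((c + c) + (d + d)) ≡ ((a + b) + (c + d)) + ((a + b) + (c + d))
    lem₂ = solve-∀

  firsts₂ : Fin n → ℕ
  firsts₂ v = d₂ v (map first K₂)

  -- The parity of the first arms of `K₁` that brings `f` to the parity of `h`, given the
  -- contributions of `R` and `K₂`.
  t₁ : Fin n → Bool
  t₁ v = par (h v + (d₁ v R + firsts₂ v))

  h-side : ∀ v → A v ≡ false → h v ≡ 0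
  h-side v Av = double-cancel (trans (sym (D≡ v)) (cong₂ _+_ (cong₂ _+_ (d₁-sided sidedQ₂ Av) (d₁-sided sidedN' Av)) (IA-side v Av)))

  supp₁ : ∀ v → A v ≡ false → t₁ v ≡ par (d₂ v (map first K₁))
  supp₁ v Av = trans
    (cong par (cong₂ _+_ (h-side v Av) (cong₂ _+_ (d₁-sided sidedR Av)
      (n≤0⇒n≡0 (≤-trans (first-≤ v K₂ J₂ arms₂) (≤-reflexive (d₁-sided sidedJ₂ Av)))))))
    (cong par (sym (n≤0⇒n≡0 (≤-trans (first-≤ v K₁ Q₁ arms₁) (≤-reflexive (d₁-sided sidedQ₁ Av))))))

  total₁ : ParF t₁ ≡ par (length K₁)
  total₁ = trans (ParF-par _) (trans (cong par (trans (Sum-+ _ _ allV) (cong (ΣF h +_) (trans (Sum-+ _ _ allV)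
      (cong₂ _+_ (trans (fiber-count proj₁ R) lengthR) (trans (fiber-count proj₂ (map first K₂)) (length-map first K₂)))))))
    (lem (ΣF h) (length IB) (length K₂) (length K₁) (trans (cong par (sym count)) (par-double M))))
    where
    lem : ∀ a b c d → par ((d + c) + (b + a)) ≡ false → par (a + (b + c)) ≡ par d
    lem a b c d p rewrite par-+ (d + c) (b + a) | par-+ d c | par-+ b a | par-+ a (b + c) | par-+ b c = bool (par a) (par b) (par c) (par d) p
      where
      bool : ∀ a b c d → (d xor c) xor (b xor a) ≡ false → a xor (b xor c) ≡ d
      bool true true true true _ = refl
      bool true true false false _ = refl
      bool true false true false _ = refl
      bool true false false true _ = refl
      bool false true true false _ = refl
      bool false true false true _ = refl
      bool false false true true _ = refl
      bool false false false false _ = refl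
      bool true true true false ()
      bool true true false true ()
      bool true false true true ()
      bool true false false false ()
      bool false true true true ()
      bool false true false false ()
      bool false false true false ()
      bool false false false true ()

  orient₁ = orient A K₁ t₁ connK₁ supp₁ total₁
  K₁' = proj₁ orient₁
  deg₁' : ∀ v → par (d₂ v (map first K₁')) ≡ t₁ v
  deg₁' = proj₁ (proj₂ orient₁)
  arms₁' : arms K₁' ≈ map swap Q₁
  arms₁' = ≈-trans (proj₁ (proj₂ (proj₂ orient₁))) arms₁

  -- The `J`-edges and the `E`-edges of the first stage. The indices are their costs at the end in
  -- A: a `J`-edge takes two more edges with it, an `E`-edge none.
  F₃ F₁ : List (Edge n)
  F₃ = map swap (map first K₁' ++ map first K₂) ++ R
  F₁ = map swap (map second K₁' ++ map second K₂)

  f : Fin n → ℕ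
  f v = d₁ v F₃

  f≡ : ∀ v → f v ≡ (d₂ v (map first K₁') + firsts₂ v) + d₁ v R
  f≡ v = trans (d₁-++ v (map swap (map first K₁' ++ map first K₂)) R) (cong (_+ d₁ v R) (trans (d₁-swap v (map first K₁' ++ map first K₂)) (d₂-++ v (map first K₁') _)))

  par-f : ∀ v → par (f v) ≡ par (h v)
  par-f v = trans (cong par (f≡ v)) (lem (d₂ v (map first K₁')) (firsts₂ v) (d₁ v R) (h v) (deg₁' v))
    where
    lem : ∀ x k r m → par x ≡ par (m + (r + k)) → par ((x + k) + r) ≡ par m
    lem x k r m p rewrite par-+ (x + k) r | par-+ x k | p | par-+ m (r + k) | par-+ r k = bool (par m) (par r) (par k)
      where
      bool : ∀ m r k → ((m xor (r xor k)) xor k) xor r ≡ m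
      bool true true true = refl
      bool true true false = refl
      bool true false true = refl
      bool true false false = refl
      bool false true true = refl
      bool false true false = refl
      bool false false true = refl
      bool false false false = refl

  2f≤N : ∀ v → f v + f v ≤ d₁ v N
  2f≤N v = ≤-trans (+-mono-≤ f≤ f≤) (slack v)
    where
    part : ∀ {L} L' L'' → L ≈ L' ++ L'' → d₁ v L' ≤ d₁ v L
    part L' L'' eqv = ≤-trans (m≤m+n _ (d₁ v L'')) (≤-reflexive (sym (trans (at eqv _) (d₁-++ v L' L''))))
    f≤ : f v ≤ d₁ v T₀ + d₁ v T₁ + d₁ v T₂ + d₁ v T₅
    f≤ = ≤-trans (≤-reflexive (f≡ v)) (+-mono-≤ (+-mono-≤
      (≤-trans (first-≤ v K₁' Q₁ arms₁') (≤-trans (≤-reflexive (d₁-++ v T₀ J₁)) (+-monoʳ-≤ (d₁ v T₀) (part J₁ J₁' eq₁))))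
      (≤-trans (first-≤ v K₂ J₂ arms₂) (part J₂ J₂' eq₂))) (part R R' eqR))

  N≤N' : ∀ v → d₁ v N ≤ d₁ v N'
  N≤N' v = ≤-trans (m≤m+n _ _) (≤-reflexive (sym (d₁-++ v N _)))

  cherries₄ = centred-pairing Q₂ sidedQ₂ (conn-mono {L = T₃} {Q₂} ∈-++⁺ˡ conn₃) even₄
  K₄ = proj₁ cherries₄
  arms₄ : arms K₄ ≈ Q₂
  arms₄ = proj₁ (proj₂ cherries₄)
  connK₄ : ConnOn (not ∘ A) tips K₄
  connK₄ = proj₂ (proj₂ cherries₄)

  κ : Fin n → ℕ
  κ v = Sum (λ c → ⟦ c == v ⟧) (map proj₁ K₄)

  d₁Q₂ : ∀ v → d₁ v Q₂ ≡ κ v + κ v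
  d₁Q₂ v = trans (sym (at arms₄ _)) (trans (d₁-++ v (map first K₄) _) (cong₂ _+_ (d₁-first v K₄) (d₁-second v K₄)))

  2h≡ : ∀ v → h v + h v ≡ ((κ v + κ v) + d₁ v N') + d₁ v IA
  2h≡ v = trans (sym (D≡ v)) (cong (λ x → (x + d₁ v N') + d₁ v IA) (d₁Q₂ v))

  κf≤h : ∀ v → κ v + f v ≤ h v
  κf≤h v = double-cancel-≤ (begin
    (κ v + f v) + (κ v + f v) ≡⟨ lem (κ v) (f v) ⟩
    (κ v + κ v) + (f v + f v) ≤⟨ +-monoʳ-≤ (κ v + κ v) (≤-trans (2f≤N v) (N≤N' v)) ⟩
    (κ v + κ v) + d₁ v N' ≤⟨ m≤m+n _ (d₁ v IA) ⟩
    ((κ v + κ v) + d₁ v N') + d₁ v IA ≡⟨ 2h≡ v ⟨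
    h v + h v ∎)
    where
    open ≤-Reasoning
    lem : ∀ a b → (a + b) + (a + b) ≡ (a + a) + (b + b)
    lem = solve-∀

  -- Of the `h - f` edges at `v` meant for `H`, the cherries of `K₄` contribute `κ` whichever arm
  -- comes first; `μ` are still to be taken from `N'`.
  μ : Fin n → ℕ
  μ v = h v ∸ (κ v + f v)
  h≡ : ∀ v → h v ≡ (κ v + f v) + μ v
  h≡ v = sym (m+[n∸m]≡n (κf≤h v))

  2μ≡ : ∀ v → (f v + f v) + (μ v + μ v) ≡ d₁ v N' + d₁ v IA
  2μ≡ v = +-cancelˡ-≡ (κ v + κ v) _ _ (trans (lem₁ (κ v) (f v) (μ v)) (trans (sym (cong₂ _+_ (h≡ v) (h≡ v))) (trans (2h≡ v) (+-assoc (κ v + κ v) _ _))))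
    where
    lem₁ : ∀ k x m → (k + k) + ((x + x) + (m + m)) ≡ ((k + x) + m) + ((k + x) + m)
    lem₁ = solve-∀

  μ≤ : ∀ v → μ v ≤ d₁ v N'
  μ≤ v = double-cancel-≤ (≤-trans (m≤n+m _ (f v + f v)) (≤-trans (≤-reflexive (2μ≡ v)) (+-monoʳ-≤ (d₁ v N') (≤-trans (IA-small v) (N≤N' v)))))

  selM = select proj₁ N' μ μ≤
  M₀ = proj₁ selM
  P₀ = proj₁ (proj₂ selM)
  eqM : N' ≈ M₀ ++ P₀
  eqM = proj₁ (proj₂ (proj₂ selM))
  degM : ∀ v → d₁ v M₀ ≡ μ v
  degM = proj₂ (proj₂ (proj₂ selM))
  sidedM : Sided A M₀
  sidedM = sided-++ˡ M₀ (sided-≈ eqM sidedN')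

  even-κμ : ∀ v → par (κ v + μ v) ≡ false
  even-κμ v = lem (κ v) (f v) (μ v) (trans (par-f v) (cong par (h≡ v)))
    where
    lem : ∀ k x m → par x ≡ par ((k + x) + m) → par (k + m) ≡ false
    lem k x m p rewrite par-+ (k + x) m | par-+ k x | par-+ k m = bool (par k) (par x) (par m) p
      where
      bool : ∀ k x m → x ≡ (k xor x) xor m → k xor m ≡ false
      bool true _ true _ = refl
      bool false _ false _ = refl
      bool true true false ()
      bool true false false ()
      bool false true true ()
      bool false false true ()

  -- `M₀` has as many edges as `μ` has in total, `K₄` as many cherries as `κ`, and `κ + μ` is even
  -- at every vertex.
  total₄ : ParF (λ v → par (d₂ v M₀)) ≡ par (length K₄)
  total₄ = trans (ParF-par _) (trans (cong par (trans (fiber-count proj₂ M₀) (trans (sym (fiber-count proj₁ M₀)) (Sum-cong degM allV))))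
    (bool (trans (sym (par-+ (ΣF κ) (ΣF μ))) (trans (cong par (sym (Sum-+ _ _ allV))) (trans (sym (ParF-par _)) (trans (Par-cong even-κμ allV) (Par-false (allV {n})))))))
    )
    where
    sumκ : ΣF κ ≡ length K₄
    sumκ = trans (fiber-count id (map proj₁ K₄)) (length-map proj₁ K₄)
    bool : par (ΣF κ) xor par (ΣF μ) ≡ false → par (ΣF μ) ≡ par (length K₄)
    bool p = trans (lem p) (cong par sumκ)
      where
      lem : ∀ {a b} → a xor b ≡ false → b ≡ a
      lem {true} {true} _ = refl
      lem {false} {false} _ = refl

  sidedK₄ : Sided A (map first K₄)
  sidedK₄ = sided-++ˡ (map first K₄) (sided-≈ (≈-sym arms₄) sidedQ₂)

  supp₄ : ∀ v → not (A v) ≡ false → par (d₂ v M₀) ≡ par (d₂ v (map first K₄))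
  supp₄ v p = cong par (trans (d₂-sided sidedM Av) (sym (d₂-sided sidedK₄ Av)))
    where
    Av : A v ≡ true
    Av = trans (sym (not-involutive (A v))) (cong not p)

  orient₄ = orient (not ∘ A) K₄ (λ v → par (d₂ v M₀)) connK₄ supp₄ total₄
  K₄' = proj₁ orient₄
  deg₄' : ∀ v → par (d₂ v (map first K₄')) ≡ par (d₂ v M₀)
  deg₄' = proj₁ (proj₂ orient₄)
  arms₄' : arms K₄' ≈ Q₂
  arms₄' = ≈-trans (proj₁ (proj₂ (proj₂ orient₄))) arms₄
  centres₄' : map proj₁ K₄' ≈ map proj₁ K₄
  centres₄' = proj₂ (proj₂ (proj₂ orient₄))

  -- Even on A because `h` and `f` have the same parity, even on B by the orientation of `K₄`. An
  -- Eulerian orientation therefore halves it at every vertex.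
  H : List (Edge n)
  H = map first K₄' ++ M₀

  sidedH : Sided A H
  sidedH = sided-++ (sided-++ˡ (map first K₄') (sided-≈ (≈-sym arms₄') sidedQ₂)) sidedM

  d₁H : ∀ v → d₁ v H ≡ κ v + μ v
  d₁H v = trans (d₁-++ v (map first K₄') M₀) (cong₂ _+_ (trans (d₁-first v K₄') (at centres₄' _)) (degM v))

  evenH : ∀ v → Par (ends v) H ≡ false
  evenH v = trans (Par-ends v H) (cong₂ _xor_ (trans (cong par (d₁H v)) (even-κμ v))
    (trans (cong par (d₂-++ v (map first K₄') M₀)) (trans (par-+ (d₂ v (map first K₄')) _) (trans (cong (_xor par (d₂ v M₀)) (deg₄' v)) (xor-same (par (d₂ v M₀)))))))

  orientH = euler H evenH
  E₀ = proj₁ orientH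
  J₀ = proj₁ (proj₂ orientH)
  eqH : H ≈ E₀ ++ J₀
  eqH = proj₁ (proj₂ (proj₂ orientH))
  bal : ∀ v → balance v E₀ J₀
  bal = proj₂ (proj₂ (proj₂ orientH))
  sidedE₀ : Sided A E₀
  sidedE₀ = sided-++ˡ E₀ (sided-≈ eqH sidedH)
  sidedJ₀ : Sided A J₀
  sidedJ₀ = sided-++ʳ E₀ (sided-≈ eqH sidedH)

  d₁J₀ : ∀ v → d₁ v J₀ + d₁ v J₀ ≡ κ v + μ v
  d₁J₀ v = go (A v) refl
    where
    go : ∀ b → A v ≡ b → d₁ v J₀ + d₁ v J₀ ≡ κ v + μ v
    go true Av = trans (cong (_+ d₁ v J₀) same) (trans (sym (d₁-++ v E₀ J₀)) (trans (sym (at eqH _)) (d₁H v)))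
      where
      same : d₁ v J₀ ≡ d₁ v E₀
      same = trans (sym (+-identityʳ _)) (trans (cong (d₁ v J₀ +_) (sym (d₂-sided sidedE₀ Av)))
        (trans (bal v) (cong (_+ d₁ v E₀) (d₂-sided sidedJ₀ Av))))
    go false Av = trans (cong₂ _+_ (d₁-sided sidedJ₀ Av) (d₁-sided sidedJ₀ Av)) (sym (trans (sym (d₁H v)) (d₁-sided sidedH Av)))

  d₂J₀ : ∀ v → d₂ v J₀ ≡ d₂ v E₀
  d₂J₀ v = go (A v) refl
    where
    go : ∀ b → A v ≡ b → d₂ v J₀ ≡ d₂ v E₀
    go true Av = trans (d₂-sided sidedJ₀ Av) (sym (d₂-sided sidedE₀ Av))
    go false Av = trans (sym (+-identityʳ _)) (trans (cong (d₂ v J₀ +_) (sym (d₁-sided sidedE₀ Av)))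
          (trans (sym (bal v)) (cong (_+ d₂ v E₀) (d₁-sided sidedJ₀ Av))))

  J E P : List (Edge n)
  J = F₃ ++ J₀
  E = F₁ ++ E₀
  P = map second K₄' ++ P₀

  total : Bp ≈ J ++ E ++ P
  total = mk λ g → trans (Bp-sum g) (trans (lem g) (sym (expand g)))
    where
    S₁ S₂ : (g : Edge n → ℕ) → List (Cherry n) → ℕ
    S₁ g K = Sum g (map swap (map first K))
    S₂ g K = Sum g (map swap (map second K))
    swap-++ : ∀ g (L L' : List (Edge n)) → Sum g (map swap (L ++ L')) ≡ Sum g (map swap L) + Sum g (map swap L')
    swap-++ g L L' = trans (Sum-map g swap (L ++ L')) (trans (Sum-++ (g ∘ swap) L L') (sym (cong₂ _+_ (Sum-map g swap L) (Sum-map g swap L'))))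
    arms-sum : ∀ g K L → arms K ≈ map swap L → Sum g L ≡ S₁ g K + S₂ g K
    arms-sum g K L eqv = trans (sym (Sum-map (g ∘ swap) swap L)) (trans (sym (at eqv (g ∘ swap)))
      (trans (sym (Sum-map g swap (arms K))) (swap-++ g (map first K) (map second K))))
    expand : ∀ g → Sum g (J ++ E ++ P) ≡ (((S₁ g K₁' + S₁ g K₂) + Sum g R) + Sum g J₀) + (((S₂ g K₁' + S₂ g K₂) + Sum g E₀) + (Sum g (map second K₄') + Sum g P₀))
    expand g = trans (Sum-++ g J (E ++ P)) (cong₂ _+_
      (trans (Sum-++ g F₃ J₀) (cong (_+ Sum g J₀) (trans (Sum-++ g (map swap (map first K₁' ++ map first K₂)) R) (cong (_+ Sum g R) (swap-++ g (map first K₁') (map first K₂))))))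
      (trans (Sum-++ g E P) (cong₂ _+_ (trans (Sum-++ g F₁ E₀) (cong (_+ Sum g E₀) (swap-++ g (map second K₁') (map second K₂)))) (Sum-++ g (map second K₄') P₀))))
    lem : ∀ g → (Sum g Q₁ + (Sum g J₂ + Sum g R)) + (Sum g Q₂ + Sum g N') ≡
      (((S₁ g K₁' + S₁ g K₂) + Sum g R) + Sum g J₀) + (((S₂ g K₁' + S₂ g K₂) + Sum g E₀) + (Sum g (map second K₄') + Sum g P₀))
    lem g = begin
      (Sum g Q₁ + (Sum g J₂ + Sum g R)) + (Sum g Q₂ + Sum g N')
        ≡⟨ cong₂ _+_ (cong₂ _+_ (arms-sum g K₁' Q₁ arms₁') (cong (_+ Sum g R) (arms-sum g K₂ J₂ arms₂)))
             (cong₂ _+_ (trans (sym (at arms₄' g)) (Sum-++ g (map first K₄') _)) (trans (at eqM g) (Sum-++ g M₀ P₀))) ⟩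
      ((S₁ g K₁' + S₂ g K₁') + ((S₁ g K₂ + S₂ g K₂) + Sum g R)) + ((Sum g (map first K₄') + Sum g (map second K₄')) + (Sum g M₀ + Sum g P₀))
        ≡⟨ shuffle₁ (S₁ g K₁') (S₂ g K₁') (S₁ g K₂) (S₂ g K₂) (Sum g R) (Sum g (map first K₄')) (Sum g (map second K₄')) (Sum g M₀) (Sum g P₀) ⟩
      ((S₁ g K₁' + S₂ g K₁') + ((S₁ g K₂ + S₂ g K₂) + Sum g R)) + ((Sum g (map first K₄') + Sum g M₀) + (Sum g (map second K₄') + Sum g P₀))
        ≡⟨ cong (λ x → ((S₁ g K₁' + S₂ g K₁') + ((S₁ g K₂ + S₂ g K₂) + Sum g R)) + (x + (Sum g (map second K₄') + Sum g P₀)))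
             (trans (sym (Sum-++ g (map first K₄') M₀)) (trans (at eqH g) (Sum-++ g E₀ J₀))) ⟩
      ((S₁ g K₁' + S₂ g K₁') + ((S₁ g K₂ + S₂ g K₂) + Sum g R)) + ((Sum g E₀ + Sum g J₀) + (Sum g (map second K₄') + Sum g P₀))
        ≡⟨ shuffle₂ (S₁ g K₁') (S₂ g K₁') (S₁ g K₂) (S₂ g K₂) (Sum g R) (Sum g E₀) (Sum g J₀) (Sum g (map second K₄') + Sum g P₀) ⟩
      _ ∎
      where
      open ≡-Reasoning
      shuffle₁ : ∀ a b c d r x y m p → ((a + b) + ((c + d) + r)) + ((x + y) + (m + p)) ≡ ((a + b) + ((c + d) + r)) + ((x + m) + (y + p))
      shuffle₁ = solve-∀
      shuffle₂ : ∀ a b c d r e j p → ((a + b) + ((c + d) + r)) + ((e + j) + p) ≡ (((a + c) + r) + j) + (((b + d) + e) + p)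
      shuffle₂ = solve-∀

  at-B : ∀ v → d₂ v J ≡ d₂ v E + d₁ v IB
  at-B v = begin
    d₂ v (F₃ ++ J₀) ≡⟨ d₂-++ v F₃ J₀ ⟩
    d₂ v F₃ + d₂ v J₀ ≡⟨ cong₂ _+_ (d₂-++ v (map swap (map first K₁' ++ map first K₂)) R) (d₂J₀ v) ⟩
    (d₂ v (map swap (map first K₁' ++ map first K₂)) + d₂ v R) + d₂ v E₀ ≡⟨ cong₂ (λ x y → (x + y) + d₂ v E₀) balanced (degR v) ⟩
    (d₂ v F₁ + d₁ v IB) + d₂ v E₀ ≡⟨ lem (d₂ v F₁) (d₁ v IB) (d₂ v E₀) ⟩
    (d₂ v F₁ + d₂ v E₀) + d₁ v IB ≡⟨ cong (_+ d₁ v IB) (d₂-++ v F₁ E₀) ⟨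
    d₂ v E + d₁ v IB ∎
    where
    open ≡-Reasoning
    balanced : d₂ v (map swap (map first K₁' ++ map first K₂)) ≡ d₂ v F₁
    balanced = trans (d₂-swap v (map first K₁' ++ map first K₂)) (trans (d₁-++ v (map first K₁') _) (trans (cong₂ _+_
      (trans (d₁-first v K₁') (sym (d₁-second v K₁'))) (trans (d₁-first v K₂) (sym (d₁-second v K₂))))
      (trans (sym (d₁-++ v (map second K₁') _)) (sym (d₂-swap v (map second K₁' ++ map second K₂))))))
    lem : ∀ a b c → (a + b) + c ≡ (a + c) + b
    lem = solve-∀

  d₁J : ∀ v → d₁ v J ≡ f v + d₁ v J₀
  d₁J v = d₁-++ v F₃ J₀

  at-A : ∀ v → d₁ v P + d₁ v IA ≡ d₁ v J + d₁ v J
  at-A v = +-cancelˡ-≡ (μ v) _ _ (begin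
    μ v + (d₁ v P + d₁ v IA) ≡⟨ cong (λ x → μ v + (x + d₁ v IA)) (trans (d₁-++ v (map second K₄') P₀) (cong (_+ d₁ v P₀) (trans (d₁-second v K₄') (at centres₄' _)))) ⟩
    μ v + ((κ v + d₁ v P₀) + d₁ v IA) ≡⟨ lem₁ (μ v) (κ v) (d₁ v P₀) (d₁ v IA) ⟩
    κ v + ((μ v + d₁ v P₀) + d₁ v IA) ≡⟨ cong (λ x → κ v + (x + d₁ v IA)) (trans (cong (_+ d₁ v P₀) (sym (degM v))) (trans (sym (d₁-++ v M₀ P₀)) (sym (at eqM _)))) ⟩
    κ v + (d₁ v N' + d₁ v IA) ≡⟨ cong (κ v +_) (2μ≡ v) ⟨
    κ v + ((f v + f v) + (μ v + μ v)) ≡⟨ lem₂ (κ v) (f v) (μ v) ⟩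
    μ v + ((f v + f v) + (κ v + μ v)) ≡⟨ cong (λ x → μ v + ((f v + f v) + x)) (d₁J₀ v) ⟨
    μ v + ((f v + f v) + (d₁ v J₀ + d₁ v J₀)) ≡⟨ cong (μ v +_) (trans (lem₃ (f v) (d₁ v J₀)) (sym (cong₂ _+_ (d₁J v) (d₁J v)))) ⟩
    μ v + (d₁ v J + d₁ v J) ∎)
    where
    open ≡-Reasoning
    lem₁ : ∀ m k p i → m + ((k + p) + i) ≡ k + ((m + p) + i)
    lem₁ = solve-∀
    lem₂ : ∀ k x m → k + ((x + x) + (m + m)) ≡ m + ((x + x) + (k + m))
    lem₂ = solve-∀
    lem₃ : ∀ x j → (x + x) + (j + j) ≡ (x + j) + (x + j)
    lem₃ = solve-∀

  -- At a vertex of A, 8 is at most `d₁ v N' + d₁ v IA`, which equals `2f + 2μ`; this is at most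
  -- `4f + 2(κ + μ)`, four times the number of `J`-edges.
  large : ∀ v → d₁ v J ≡ 0 ⊎ 2 ≤ d₁ v J
  large v = go (A v) refl
    where
    go : ∀ b → A v ≡ b → d₁ v J ≡ 0 ⊎ 2 ≤ d₁ v J
    go false Av = inj₁ (trans (d₁J v) (cong₂ _+_ (n≤0⇒n≡0 (≤-trans (m≤m+n (f v) (f v)) (≤-trans (2f≤N v) (≤-reflexive (d₁-sided sN Av)))))
              (d₁-sided sidedJ₀ Av)))
    go true Av = inj₂ (double-cancel-≤ (double-cancel-≤ (begin
        8 ≤⟨ N-large v Av ⟩
        d₁ v N ≤⟨ N≤N' v ⟩
        d₁ v N' ≤⟨ m≤m+n _ (d₁ v IA) ⟩
        d₁ v N' + d₁ v IA ≡⟨ 2μ≡ v ⟨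
        (f v + f v) + (μ v + μ v) ≤⟨ +-monoʳ-≤ (f v + f v) (+-mono-≤ (m≤n+m (μ v) (κ v)) (m≤n+m (μ v) (κ v))) ⟩
        (f v + f v) + ((κ v + μ v) + (κ v + μ v)) ≤⟨ +-monoˡ-≤ _ (m≤m+n (f v + f v) (f v + f v)) ⟩
        ((f v + f v) + (f v + f v)) + ((κ v + μ v) + (κ v + μ v)) ≡⟨ cong (λ x → ((f v + f v) + (f v + f v)) + (x + x)) (d₁J₀ v) ⟨
        ((f v + f v) + (f v + f v)) + ((d₁ v J₀ + d₁ v J₀) + (d₁ v J₀ + d₁ v J₀)) ≡⟨ lem (f v) (d₁ v J₀) ⟩
        ((f v + d₁ v J₀) + (f v + d₁ v J₀)) + ((f v + d₁ v J₀) + (f v + d₁ v J₀)) ≡⟨ cong (λ x → (x + x) + (x + x)) (d₁J v) ⟨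
        (d₁ v J + d₁ v J) + (d₁ v J + d₁ v J) ∎)))
      where
      open ≤-Reasoning
      lem : ∀ x j → ((x + x) + (x + x)) + ((j + j) + (j + j)) ≡ ((x + j) + (x + j)) + ((x + j) + (x + j))
      lem = solve-∀

  labelling : Labelling Bp IA IB
  labelling = record { J = J ; E = E ; P = P ; total = total ; at-B = at-B ; at-A = at-A ; large = large }

-- Copies of Y from a labelling.

-- (c , l₁ , l₂ , s , t) is the copy of Y with centre c, leaves l₁ and l₂ at c, and the path c s t.
YTree : ℕ → Set
YTree n = Fin n × Fin n × Fin n × Fin n × Fin n

edgesY : ∀ {n} → YTree n → List (Edge n)
edgesY (c , l₁ , l₂ , s , t) = (c , l₁) ∷ (c , l₂) ∷ (c , s) ∷ (s , t) ∷ []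

edgesYs : ∀ {n} → List (YTree n) → List (Edge n)
edgesYs = concatMap edgesY

-- In a simple graph this is the only degeneracy that disjointness of the four edges does not exclude.
Good : ∀ {n} → YTree n → Set
Good (c , l₁ , l₂ , s , t) = t ≢ l₁ × t ≢ l₂

Sym : ∀ {n} → (Edge n → ℕ) → Set
Sym f = ∀ u v → f (u , v) ≡ f (v , u)

All-concatMap : ∀ {A B : Set} {P : B → Set} (h : A → List B) (xs : List A) → (∀ x → All P (h x)) → All P (concatMap h xs)
All-concatMap h [] p = []
All-concatMap h (x ∷ xs) p = append (p x) (All-concatMap h xs p)
  where
  append : ∀ {B : Set} {P : B → Set} {xs ys : List B} → All P xs → All P ys → All P (xs ++ ys)
  append [] q = q
  append (p ∷ ps) q = p ∷ append ps q

three : ∀ {A : Set} (xs : List A) → length xs ≡ 3 → ∃ λ a → ∃ λ b → ∃ λ c → xs ≡ a ∷ b ∷ c ∷ []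
three (a ∷ b ∷ c ∷ []) p = a , b , c , refl

module _ {n : ℕ} where

  occ : Fin n → List (Fin n) → ℕ
  occ v = Sum (λ x → ⟦ x == v ⟧)

  absent : ∀ v xs → occ v xs ≡ 0 → All (v ≢_) xs
  absent v [] p = []
  absent v (x ∷ xs) p = v≢x ∷ absent v xs (m+n≡0⇒n≡0 ⟦ x == v ⟧ p)
    where
    v≢x : v ≢ x
    v≢x refl with () ← trans (sym p) (cong (λ b → ⟦ b ⟧ + occ v xs) (==-refl v))

  occ-absent : ∀ {v xs} → All (v ≢_) xs → occ v xs ≡ 0
  occ-absent [] = refl
  occ-absent (p ∷ ps) = cong₂ (λ b m → ⟦ b ⟧ + m) (==-≢ (p ∘ sym)) (occ-absent ps)

  absent-≈ : ∀ {v xs ys} → xs ≈ ys → All (v ≢_) xs → All (v ≢_) ys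
  absent-≈ {v} {xs} {ys} eqv p = absent v ys (trans (sym (at eqv _)) (occ-absent p))

  record Distinct (xs : List (Fin n)) : Set where
    constructor mk
    field once : ∀ v → occ v xs ≤ 1
  open Distinct

  distinct-head : ∀ {x xs} → Distinct (x ∷ xs) → All (x ≢_) xs
  distinct-head {x} {xs} d = absent x xs (n≤0⇒n≡0 (≤-pred (subst (λ b → ⟦ b ⟧ + occ x xs ≤ 1) (==-refl x) (once d x))))

  distinct-tail : ∀ {x xs} → Distinct (x ∷ xs) → Distinct xs
  distinct-tail {x} {xs} d = mk λ v → ≤-trans (m≤n+m (occ v xs) ⟦ x == v ⟧) (once d v)

  distinct-≈ : ∀ {xs ys} → xs ≈ ys → Distinct xs → Distinct ys
  distinct-≈ p d = mk λ v → ≤-trans (≤-reflexive (sym (at p _))) (once d v)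

  -- The entry `l` is `c` itself if `c` occurs and arbitrary otherwise; by distinctness the
  -- remainder avoids `c` in both cases.
  pull : ∀ c (ls : List (Fin n)) → 1 ≤ length ls → Distinct ls → ∃ λ l → ∃ λ ls' → ls ≈ l ∷ ls' × All (c ≢_) ls'
  pull c ls pos d with occ c ls in eq
  pull c (l ∷ ls) pos d | zero = l , ls , ≈-refl , tailAll (absent c (l ∷ ls) eq)
  pull c ls pos d | suc m with extract (_== c) ls (subst (1 ≤_) (sym eq) (s≤s z≤n))
  ... | l , ls' , l≡c , eqv with refl ← ==-≡ {i = l} {c} l≡c = l , ls' , eqv , distinct-head (distinct-≈ eqv d)

  -- Stars at a are given by z = (s , c): the edge as continued by the edge sc.
  Covers : Fin n → List (Edge n) → List (Fin n) → List (YTree n) → Set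
  Covers a zs ls ys = All Good ys × (∀ f → Sym f →
    Sum f (edgesYs ys) ≡ Sum (λ l → f (a , l)) ls + Sum (λ z → f (a , proj₁ z) + f z) zs)

  covers-pair : ∀ a s₁ c₁ s₂ c₂ {ls m₁ m₂ m₃ m₄} → ls ≈ m₁ ∷ m₂ ∷ m₃ ∷ m₄ ∷ [] → c₁ ≢ m₁ → c₁ ≢ m₂ → c₂ ≢ m₃ → c₂ ≢ m₄ →
    Covers a ((s₁ , c₁) ∷ (s₂ , c₂) ∷ []) ls ((a , m₁ , m₂ , s₁ , c₁) ∷ (a , m₃ , m₄ , s₂ , c₂) ∷ [])
  covers-pair a s₁ c₁ s₂ c₂ {m₁ = m₁} {m₂} {m₃} {m₄} eqv p₁ p₂ p₃ p₄ = ((p₁ , p₂) ∷ (p₃ , p₄) ∷ []) , λ f _ →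
    trans (lem (f (a , m₁)) (f (a , m₂)) (f (a , m₃)) (f (a , m₄)) (f (a , s₁)) (f (s₁ , c₁)) (f (a , s₂)) (f (s₂ , c₂)))
      (cong (_+ ((f (a , s₁) + f (s₁ , c₁)) + ((f (a , s₂) + f (s₂ , c₂)) + 0))) (sym (at eqv (λ l → f (a , l)))))
    where
    lem : ∀ m₁ m₂ m₃ m₄ x₁ y₁ x₂ y₂ → m₁ + (m₂ + (x₁ + (y₁ + (m₃ + (m₄ + (x₂ + (y₂ + 0))))))) ≡
      (m₁ + (m₂ + (m₃ + (m₄ + 0)))) + ((x₁ + y₁) + ((x₂ + y₂) + 0))
    lem = solve-∀

  -- The case c₁ = c₂ = l₁ is the one where no distribution of the four leaves works, and l₁ becomes
  -- the vertex of degree two of the first tree.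
  pair-stars : ∀ a s₁ c₁ s₂ c₂ ls → length ls ≡ 4 → Distinct (s₁ ∷ s₂ ∷ ls) →
    ∃ λ ys → Covers a ((s₁ , c₁) ∷ (s₂ , c₂) ∷ []) ls ys
  pair-stars a s₁ c₁ s₂ c₂ ls len dist with pull c₁ ls (subst (1 ≤_) (sym len) (s≤s z≤n)) (distinct-tail (distinct-tail dist))
  ... | l₁ , ls' , eqv , free with three ls' (suc-injective (trans (sym (≈-length eqv)) len))
  ... | l₂ , l₃ , l₄ , refl with c₁ ≟ᶠ l₁
  -- Here `c₁` is none of the leaves, so only `c₂` restricts their distribution.
  ... | no c₁≢l₁ with pull c₂ (l₁ ∷ l₂ ∷ l₃ ∷ l₄ ∷ []) (s≤s z≤n) (distinct-≈ eqv (distinct-tail (distinct-tail dist)))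
  ... | m₁ , ms , eqm , free₂ with three ms (suc-injective (sym (≈-length eqm)))
  ... | m₂ , m₃ , m₄ , refl with absent-≈ eqm (c₁≢l₁ ∷ free) | free₂
  ... | p₁ ∷ _ ∷ _ ∷ p₄ ∷ [] | q₂ ∷ q₃ ∷ _ = _ , covers-pair a s₁ c₁ s₂ c₂ (≈-trans eqv (≈-trans eqm rotate)) p₁ p₄ q₂ q₃
    where
    rotate : m₁ ∷ m₂ ∷ m₃ ∷ m₄ ∷ [] ≈ m₁ ∷ m₄ ∷ m₂ ∷ m₃ ∷ []
    rotate = mk λ f → lem (f m₁) (f m₂) (f m₃) (f m₄)
      where
      lem : ∀ a b c d → a + (b + (c + (d + 0))) ≡ a + (d + (b + (c + 0)))
      lem = solve-∀
  pair-stars a s₁ c₁ s₂ c₂ ls len dist | l₁ , ls' , eqv , f₂ ∷ f₃ ∷ f₄ ∷ [] | l₂ , l₃ , l₄ , refl | yes refl with c₂ ≟ᶠ l₁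
  ... | no c₂≢l₁ with c₂ ≟ᶠ l₂
  ... | no c₂≢l₂ = _ , covers-pair a s₁ c₁ s₂ c₂ (≈-trans eqv (mk λ f → lem (f l₁) (f l₂) (f l₃) (f l₄))) f₃ f₄ c₂≢l₁ c₂≢l₂
    where
    lem : ∀ a b c d → a + (b + (c + (d + 0))) ≡ c + (d + (a + (b + 0)))
    lem = solve-∀
  ... | yes refl with distinct-head (distinct-tail (distinct-≈ eqv (distinct-tail (distinct-tail dist))))
  ... | l₂≢l₃ ∷ _ = _ , covers-pair a s₁ c₁ s₂ c₂ (≈-trans eqv (mk λ f → lem (f l₁) (f l₂) (f l₃) (f l₄))) f₂ f₄ c₂≢l₁ l₂≢l₃
    where
    lem : ∀ a b c d → a + (b + (c + (d + 0))) ≡ b + (d + (a + (c + 0)))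
    lem = solve-∀
  pair-stars a s₁ c₁ s₂ c₂ ls len dist | l₁ , ls' , eqv , f₂ ∷ f₃ ∷ f₄ ∷ [] | l₂ , l₃ , l₄ , refl | yes refl | yes refl with distinct-head dist
  ... | _ ∷ s₁-free with absent-≈ eqv s₁-free
  ... | s≢l₁ ∷ s≢l₂ ∷ s≢l₃ ∷ s≢l₄ ∷ [] =
    (a , l₂ , l₃ , l₁ , s₁) ∷ (a , s₁ , l₄ , s₂ , l₁) ∷ [] , (s≢l₂ , s≢l₃) ∷ (s≢l₁ ∘ sym , f₄) ∷ [] ,
    λ f symf → trans (cong (λ x → f (a , l₂) + (f (a , l₃) + (f (a , l₁) + (x + (f (a , s₁) + (f (a , l₄) + (f (a , s₂) + (f (s₂ , l₁) + 0)))))))) (symf l₁ s₁))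
      (trans (lem (f (a , l₁)) (f (a , l₂)) (f (a , l₃)) (f (a , l₄)) (f (a , s₁)) (f (s₁ , l₁)) (f (a , s₂)) (f (s₂ , l₁)))
        (cong (_+ ((f (a , s₁) + f (s₁ , l₁)) + ((f (a , s₂) + f (s₂ , l₁)) + 0))) (sym (at eqv (λ l → f (a , l))))))
    where
    lem : ∀ m₁ m₂ m₃ m₄ x₁ y₁ x₂ y₂ → m₂ + (m₃ + (m₁ + (y₁ + (x₁ + (m₄ + (x₂ + (y₂ + 0))))))) ≡
      (m₁ + (m₂ + (m₃ + (m₄ + 0)))) + ((x₁ + y₁) + ((x₂ + y₂) + 0))
    lem = solve-∀

  -- The star gets two leaves other than `c`, and the pulled leaf, possibly `c`, goes back to the
  -- other stars. One further star suffices for this: three leaves then remain after pulling.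
  star-step : ∀ a s c (zs : List (Edge n)) → 1 ≤ length zs →
    (∀ ls → length ls ≡ length zs + length zs → Distinct (map proj₁ zs ++ ls) → ∃ λ ys → Covers a zs ls ys) →
    ∀ ls → length ls ≡ suc (length zs) + suc (length zs) → Distinct (s ∷ map proj₁ zs ++ ls) → ∃ λ ys → Covers a ((s , c) ∷ zs) ls ys
  star-step a s c zs pos rec ls len dist
    with pull c ls (subst (1 ≤_) (sym len) (s≤s z≤n)) (tail++ (map proj₁ ((s , c) ∷ zs)) dist)
    where
    tail++ : ∀ xs {ys} → Distinct (xs ++ ys) → Distinct ys
    tail++ [] d = d
    tail++ (x ∷ xs) d = tail++ xs (distinct-tail d)
  ... | l , [] , eqv , free with () ← trans (suc-injective (trans (sym (≈-length eqv)) len)) (+-suc (length zs) (length zs))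
  ... | l , m₁ ∷ [] , eqv , free = contradiction (≤-trans pos (≤-reflexive (m+n≡0⇒m≡0 (length zs) (sym
    (suc-injective (trans (suc-injective (trans (sym (≈-length eqv)) len)) (+-suc (length zs) (length zs)))))))) λ ()
  ... | l , m₁ ∷ m₂ ∷ ls'' , eqv , g₁ ∷ g₂ ∷ _ with rec (l ∷ ls'') len' dist'
    where
    len' : suc (length ls'') ≡ length zs + length zs
    len' = suc-injective (trans (suc-injective (trans (sym (≈-length eqv)) len)) (+-suc (length zs) (length zs)))
    zs' : List (Fin n)
    zs' = map proj₁ zs
    dist' : Distinct (zs' ++ l ∷ ls'')
    dist' = mk λ v → begin
      occ v (zs' ++ l ∷ ls'') ≡⟨ Sum-++ (λ x → ⟦ x == v ⟧) zs' (l ∷ ls'') ⟩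
      occ v zs' + (⟦ l == v ⟧ + occ v ls'') ≤⟨ +-monoʳ-≤ (occ v zs') (+-monoʳ-≤ ⟦ l == v ⟧ (≤-trans (m≤n+m (occ v ls'') ⟦ m₂ == v ⟧) (m≤n+m _ ⟦ m₁ == v ⟧))) ⟩
      occ v zs' + occ v (l ∷ m₁ ∷ m₂ ∷ ls'') ≡⟨ cong (occ v zs' +_) (at eqv (λ x → ⟦ x == v ⟧)) ⟨
      occ v zs' + occ v ls ≡⟨ Sum-++ (λ x → ⟦ x == v ⟧) zs' ls ⟨
      occ v (zs' ++ ls) ≤⟨ once (distinct-tail dist) v ⟩
      1 ∎
      where open ≤-Reasoning
  ... | ys , good , cov = (a , m₁ , m₂ , s , c) ∷ ys , (g₁ , g₂) ∷ good , λ f symf →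
    trans (cong (λ x → f (a , m₁) + (f (a , m₂) + (f (a , s) + (f (s , c) + x)))) (cov f symf))
      (trans (lem (f (a , m₁)) (f (a , m₂)) (f (a , s)) (f (s , c)) (f (a , l)) (Sum (λ l → f (a , l)) ls'') (Sum (λ z → f (a , proj₁ z) + f z) zs))
        (cong (_+ Sum (λ z → f (a , proj₁ z) + f z) ((s , c) ∷ zs)) (sym (at eqv (λ l → f (a , l))))))
    where
    lem : ∀ m₁ m₂ s c l ls zs → m₁ + (m₂ + (s + (c + ((l + ls) + zs)))) ≡ (l + (m₁ + (m₂ + ls))) + ((s + c) + zs)
    lem = solve-∀

  stars : ∀ a (zs : List (Edge n)) (ls : List (Fin n)) → length ls ≡ length zs + length zs → length zs ≡ 0 ⊎ 2 ≤ length zs →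
    Distinct (map proj₁ zs ++ ls) → ∃ λ ys → Covers a zs ls ys
  stars a [] [] len big dist = [] , [] , λ f _ → refl
  stars a (z ∷ []) ls len (inj₂ (s≤s ())) dist
  stars a ((s₁ , c₁) ∷ (s₂ , c₂) ∷ []) ls len big dist = pair-stars a s₁ c₁ s₂ c₂ ls len dist
  stars a ((s , c) ∷ z' ∷ z'' ∷ zs) ls len big dist = star-step a s c (z' ∷ z'' ∷ zs) (s≤s z≤n)
    (λ ls len dist → stars a (z' ∷ z'' ∷ zs) ls len (inj₂ (s≤s (s≤s z≤n))) dist) ls len dist

  restrict : ∀ {A B : Set} → (A → Fin n) → (A → B) → Fin n → List A → List B
  restrict key val a = concatMap (λ x → if key x == a then val x ∷ [] else [])

  Sum-restrict : ∀ {A B : Set} (key : A → Fin n) (val : A → B) a f (xs : List A) →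
    Sum f (restrict key val a xs) ≡ Sum (λ x → ⟦ key x == a ⟧ * f (val x)) xs
  Sum-restrict key val a f xs = trans (Sum-concatMap f _ xs) (Sum-cong eq xs)
    where
    eq : ∀ x → Sum f (if key x == a then val x ∷ [] else []) ≡ ⟦ key x == a ⟧ * f (val x)
    eq x with key x == a
    ... | true = refl
    ... | false = refl

  length-restrict : ∀ {A B : Set} (key : A → Fin n) (val : A → B) a (xs : List A) →
    length (restrict key val a xs) ≡ Sum (λ x → ⟦ key x == a ⟧) xs
  length-restrict key val a xs = trans (sym (Sum-1 (restrict key val a xs))) (trans (Sum-restrict key val a (λ _ → 1) xs) (Sum-cong (λ x → *-identityʳ _) xs))

  abstract
    -- By `at-B` each `J`-edge can be continued at its end in B by its own `E`-edge or owned inner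
    -- edge; by `at-A` there are two leaves per star. As the graph is simple, the neighbours used at
    -- a centre are distinct, and the regrouping is done at each centre separately.
    assemble : ∀ {Bp IA IB : List (Edge n)} (L : Labelling Bp IA IB) →
      (∀ a v → Sum (λ e → ⟦ proj₁ e == a ⟧ * ⟦ proj₂ e == v ⟧) (Bp ++ IA) ≤ 1) →
      ∃ λ ys → All Good ys × (∀ f → Sym f → Sum f (edgesYs ys) ≡ Sum f (Bp ++ IA ++ IB))
    assemble {Bp} {IA} {IB} L simple with match proj₂ proj₁ J (map swap E ++ IB) keys
      where
      open Labelling L
      keys : ∀ v → d₂ v J ≡ d₁ v (map swap E ++ IB)
      keys v = trans (at-B v) (sym (trans (d₁-++ v (map swap E) IB) (cong (_+ d₁ v IB) (d₁-swap v E))))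
    ... | Z , Z₁ , Z₂ , Zkeys = concatMap trees allV , All-concatMap trees allV (λ a → proj₁ (proj₂ (local a))) , sums
      where
      open Labelling L
      tipsAt : Fin n → List (Fin n)
      tipsAt a = restrict proj₁ proj₂ a (P ++ IA)
      starsAt : Fin n → List (Edge n)
      starsAt a = restrict (proj₁ ∘ proj₁) (λ z → proj₂ (proj₁ z) , proj₂ (proj₂ z)) a Z
      length-stars : ∀ a → length (starsAt a) ≡ d₁ a J
      length-stars a = trans (length-restrict (proj₁ ∘ proj₁) (λ z → proj₂ (proj₁ z) , proj₂ (proj₂ z)) a Z) (trans (sym (Sum-map _ proj₁ Z)) (at Z₁ _))
      local : ∀ a → ∃ λ ys → Covers a (starsAt a) (tipsAt a) ys
      local a = stars a (starsAt a) (tipsAt a)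
        (trans (length-restrict proj₁ proj₂ a (P ++ IA)) (trans (d₁-++ a P IA) (trans (at-A a) (sym (cong₂ _+_ (length-stars a) (length-stars a))))))
        (subst (λ m → m ≡ 0 ⊎ 2 ≤ m) (sym (length-stars a)) (large a)) dist
        where
        w : Fin n → Edge n → ℕ
        w v e = ⟦ proj₁ e == a ⟧ * ⟦ proj₂ e == v ⟧
        dist : Distinct (map proj₁ (starsAt a) ++ tipsAt a)
        dist = mk λ v → begin
          occ v (map proj₁ (starsAt a) ++ tipsAt a) ≡⟨ Sum-++ _ (map proj₁ (starsAt a)) (tipsAt a) ⟩
          occ v (map proj₁ (starsAt a)) + occ v (tipsAt a) ≡⟨ cong₂ _+_ (trans (Sum-map _ proj₁ (starsAt a)) (trans (Sum-restrict (proj₁ ∘ proj₁) (λ z → proj₂ (proj₁ z) , proj₂ (proj₂ z)) a _ Z) (trans (sym (Sum-map (w v) proj₁ Z)) (at Z₁ (w v)))))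
                                                                      (Sum-restrict proj₁ proj₂ a _ (P ++ IA)) ⟩
          Sum (w v) J + Sum (w v) (P ++ IA) ≤⟨ +-monoʳ-≤ (Sum (w v) J) (≤-reflexive (Sum-++ (w v) P IA)) ⟩
          Sum (w v) J + (Sum (w v) P + Sum (w v) IA) ≤⟨ +-monoʳ-≤ (Sum (w v) J) (m≤n+m _ (Sum (w v) E)) ⟩
          Sum (w v) J + (Sum (w v) E + (Sum (w v) P + Sum (w v) IA)) ≡⟨ lem (Sum (w v) J) (Sum (w v) E) (Sum (w v) P) (Sum (w v) IA) ⟩
          (Sum (w v) J + (Sum (w v) E + Sum (w v) P)) + Sum (w v) IA ≡⟨ cong (_+ Sum (w v) IA) (trans (at total (w v)) (trans (Sum-++ (w v) J (E ++ P)) (cong (Sum (w v) J +_) (Sum-++ (w v) E P)))) ⟨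
          Sum (w v) Bp + Sum (w v) IA ≡⟨ Sum-++ (w v) Bp IA ⟨
          Sum (w v) (Bp ++ IA) ≤⟨ simple a v ⟩
          1 ∎
          where
          open ≤-Reasoning
          lem : ∀ a b c d → a + (b + (c + d)) ≡ (a + (b + c)) + d
          lem = solve-∀
      trees : Fin n → List (YTree n)
      trees a = proj₁ (local a)
      edges-concat : ∀ f (xs : List (Fin n)) → Sum f (edgesYs (concatMap trees xs)) ≡ Sum (λ a → Sum f (edgesYs (trees a))) xs
      edges-concat f xs = trans (Sum-concatMap f edgesY (concatMap trees xs)) (trans (Sum-concatMap _ trees xs) (Sum-cong (λ a → sym (Sum-concatMap f edgesY (trees a))) xs))
      sums : ∀ f → Sym f → Sum f (edgesYs (concatMap trees allV)) ≡ Sum f (Bp ++ IA ++ IB)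
      sums f symf = begin
        Sum f (edgesYs (concatMap trees allV)) ≡⟨ edges-concat f allV ⟩
        ΣF (λ a → Sum f (edgesYs (trees a))) ≡⟨ Sum-cong (λ a → trans (proj₂ (proj₂ (local a)) f symf) (cong₂ _+_ (Sum-restrict proj₁ proj₂ a _ (P ++ IA)) (Sum-restrict (proj₁ ∘ proj₁) _ a _ Z))) allV ⟩
        ΣF (λ a → Sum (λ e → ⟦ proj₁ e == a ⟧ * f (a , proj₂ e)) (P ++ IA) + Sum (λ z → ⟦ proj₁ (proj₁ z) == a ⟧ * g a z) Z) ≡⟨ Sum-+ _ _ allV ⟩
        ΣF (λ a → Sum (λ e → ⟦ proj₁ e == a ⟧ * f (a , proj₂ e)) (P ++ IA)) + ΣF (λ a → Sum (λ z → ⟦ proj₁ (proj₁ z) == a ⟧ * g a z) Z)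
          ≡⟨ cong₂ _+_ (trans (Sum-cong (λ a → Sum-cong (λ e → at-key a (proj₁ e) (λ b → f (b , proj₂ e))) (P ++ IA)) allV) (fiber-sum f proj₁ (P ++ IA)))
               (trans (Sum-cong (λ a → Sum-cong (λ z → at-key a (proj₁ (proj₁ z)) (λ b → g b z)) Z) allV) (fiber-sum (λ z → g (proj₁ (proj₁ z)) z) (proj₁ ∘ proj₁) Z)) ⟩
        Sum f (P ++ IA) + Sum (λ z → g (proj₁ (proj₁ z)) z) Z ≡⟨ cong₂ _+_ (Sum-++ f P IA) (trans (Sum-+ _ _ Z) (cong₂ _+_ starEdges tailEdges)) ⟩
        (Sum f P + Sum f IA) + (Sum f J + (Sum f E + Sum f IB)) ≡⟨ lem (Sum f P) (Sum f IA) (Sum f J) (Sum f E) (Sum f IB) ⟩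
        (Sum f J + (Sum f E + Sum f P)) + (Sum f IA + Sum f IB) ≡⟨ cong₂ _+_ (trans (at total f) (trans (Sum-++ f J (E ++ P)) (cong (Sum f J +_) (Sum-++ f E P)))) (Sum-++ f IA IB) ⟨
        Sum f Bp + Sum f (IA ++ IB) ≡⟨ Sum-++ f Bp (IA ++ IB) ⟨
        Sum f (Bp ++ IA ++ IB) ∎
        where
        open ≡-Reasoning
        g : Fin n → Edge n × Edge n → ℕ
        g a z = f (a , proj₂ (proj₁ z)) + f (proj₂ (proj₁ z) , proj₂ (proj₂ z))
        at-key : ∀ a k (h : Fin n → ℕ) → ⟦ k == a ⟧ * h a ≡ ⟦ k == a ⟧ * h k
        at-key a k h with k ≟ᶠ a
        ... | yes refl = refl
        ... | no _ = refl
        starEdges : Sum (λ z → f (proj₁ z)) Z ≡ Sum f J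
        starEdges = trans (sym (Sum-map f proj₁ Z)) (at Z₁ f)
        tailEdges : Sum (λ z → f (proj₂ (proj₁ z) , proj₂ (proj₂ z))) Z ≡ Sum f E + Sum f IB
        tailEdges = trans (Sum-cong-∈ Z (λ {z} z∈ → cong (λ s → f (s , proj₂ (proj₂ z))) (lookupAll Zkeys z∈))) (trans (sym (Sum-map f proj₂ Z)) (trans (at Z₂ f)
          (trans (Sum-++ f (map swap E) IB) (cong (_+ Sum f IB) (trans (Sum-map f swap E) (Sum-cong (λ e → symf (proj₂ e) (proj₁ e)) E))))))
        lem : ∀ p i j e b → (p + i) + (j + (e + b)) ≡ (j + (e + p)) + (i + b)
        lem = solve-∀

-- From a cover counted with multiplicity to a decomposition.

hit : ∀ {n} → Fin n → Fin n → Edge n → ℕ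
hit u v (x , y) = ⟦ (x == u) ∧ (y == v) ⟧ + ⟦ (x == v) ∧ (y == u) ⟧

hit-sym : ∀ {n} (u v : Fin n) → Sym (hit u v)
hit-sym u v x y = trans (+-comm ⟦ (x == u) ∧ (y == v) ⟧ _) (cong₂ (λ a b → ⟦ a ⟧ + ⟦ b ⟧) (∧-comm (x == v) _) (∧-comm (x == u) _))

hit-self : ∀ {n} (u v : Fin n) → 1 ≤ hit u v (u , v)
hit-self u v rewrite ==-refl u | ==-refl v = s≤s z≤n

hit-swap : ∀ {n} (u v : Fin n) → 1 ≤ hit u v (v , u)
hit-swap u v = subst (1 ≤_) (hit-sym u v u v) (hit-self u v)

hit-≡ : ∀ {n} {u v x y : Fin n} → 1 ≤ hit u v (x , y) → (x ≡ u × y ≡ v) ⊎ (x ≡ v × y ≡ u)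
hit-≡ {u = u} {v} {x} {y} p with x ≟ᶠ u | y ≟ᶠ v | x ≟ᶠ v | y ≟ᶠ u
... | yes a | yes b | _ | _ = inj₁ (a , b)
... | yes a | no b | yes c | yes d = inj₂ (c , d)
... | no a | _ | yes c | yes d = inj₂ (c , d)
hit-≡ () | yes a | no b | yes c | no d
hit-≡ () | yes a | no b | no c | _
hit-≡ () | no a | _ | yes c | no d
hit-≡ () | no a | _ | no c | _

ΣF-two : ∀ {n} (f : Fin n → ℕ) {i j} → i ≢ j → f i + f j ≤ ΣF f
ΣF-two f {i} {j} i≢j = begin
  f i + f j ≡⟨ +-comm (f i) (f j) ⟩
  f j + f i ≡⟨ cong (_+ f i) (cong (λ b → if b then 0 else f j) (==-≢ i≢j)) ⟨
  g j + f i ≤⟨ +-monoˡ-≤ (f i) (ΣF-≤1 g j) ⟩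
  ΣF g + f i ≡⟨ ΣF-update f g i (λ y y≢i → sym (cong (λ b → if b then 0 else f y) (==-≢ (y≢i ∘ sym)))) ⟨
  ΣF f + g i ≡⟨ cong (λ b → ΣF f + (if b then 0 else f i)) (==-refl i) ⟩
  ΣF f + 0 ≡⟨ +-identityʳ _ ⟩
  ΣF f ∎
  where
  open ≤-Reasoning
  g : _ → ℕ
  g y = if i == y then 0 else f y

ΣF-pos : ∀ {n} (f : Fin n → ℕ) → 1 ≤ ΣF f → ∃ λ i → 1 ≤ f i
ΣF-pos {n} f p = go allV p
  where
  go : (xs : List (Fin n)) → 1 ≤ Sum f xs → ∃ λ i → 1 ≤ f i
  go (x ∷ xs) p with f x in eq
  ... | zero = go xs p
  ... | suc m = x , subst (1 ≤_) (sym eq) (s≤s z≤n)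

ΣF-empty : (f : Fin 0 → ℕ) → ΣF f ≡ 0
ΣF-empty f = n≤0⇒n≡0 (subst (ΣF f ≤_) (ΣF-1 {0}) (Sum-mono (λ ()) allV))

Sum-lookup : ∀ {A : Set} (f : A → ℕ) (xs : List A) → Sum f xs ≡ ΣF (λ i → f (lookupList xs i))
Sum-lookup f [] = sym (ΣF-empty _)
Sum-lookup f (x ∷ xs) = trans (cong (f x +_) (Sum-lookup f xs)) (sym (ΣF-suc (λ i → f (lookupList (x ∷ xs) i))))

vertexY : ∀ {n} → YTree n → Fin 5 → Fin n
vertexY (c , l₁ , l₂ , s , t) fzero = c
vertexY (c , l₁ , l₂ , s , t) (fsuc fzero) = l₁
vertexY (c , l₁ , l₂ , s , t) (fsuc (fsuc fzero)) = l₂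
vertexY (c , l₁ , l₂ , s , t) (fsuc (fsuc (fsuc fzero))) = s
vertexY (c , l₁ , l₂ , s , t) (fsuc (fsuc (fsuc (fsuc fzero)))) = t

edgeY : ∀ {n} → YTree n → Fin 4 → Edge n
edgeY y e = vertexY y (proj₁ (yEdge e)) , vertexY y (proj₂ (yEdge e))

edgesY-lookup : ∀ {n} (f : Edge n → ℕ) (y : YTree n) → Sum f (edgesY y) ≡ ΣF (λ e → f (edgeY y e))
edgesY-lookup f y = sym (trans (ΣF-suc (λ e → f (edgeY y e))) (cong (f (edgeY y fzero) +_)
  (trans (ΣF-suc (λ e → f (edgeY y (fsuc e)))) (cong (f (edgeY y (fsuc fzero)) +_)
  (trans (ΣF-suc (λ e → f (edgeY y (fsuc (fsuc e))))) (cong (f (edgeY y (fsuc (fsuc fzero))) +_)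
  (trans (ΣF-suc (λ e → f (edgeY y (fsuc (fsuc (fsuc e)))))) (cong (f (edgeY y (fsuc (fsuc (fsuc fzero)))) +_)
  (ΣF-empty _)))))))))

module _ {n : ℕ} (G : Graph n) (ys : List (YTree n)) (good : All Good ys)
  (cover : ∀ u v → Sum (hit u v) (edgesYs ys) ≡ ⟦ adj G u v ⟧) where

  private
    tree : Fin (length ys) → YTree n
    tree = lookupList ys

    cover′ : ∀ u v → ΣF (λ i → ΣF (λ e → hit u v (edgeY (tree i) e))) ≡ ⟦ adj G u v ⟧
    cover′ u v = trans (Sum-cong (λ i → sym (edgesY-lookup (hit u v) (tree i))) allV)
      (trans (sym (Sum-lookup (λ y → Sum (hit u v) (edgesY y)) ys)) (trans (sym (Sum-concatMap (hit u v) edgesY ys)) (cover u v)))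

    tree≤ : ∀ u v i → Sum (hit u v) (edgesY (tree i)) ≤ ⟦ adj G u v ⟧
    tree≤ u v i = ≤-trans (≤-reflexive (edgesY-lookup (hit u v) (tree i)))
      (≤-trans (ΣF-≤1 (λ i → ΣF (λ e → hit u v (edgeY (tree i) e))) i) (≤-reflexive (cover′ u v)))

    adj-true : ∀ {u v} → 1 ≤ ⟦ adj G u v ⟧ → adj G u v ≡ true
    adj-true {u} {v} p with adj G u v
    ... | true = refl

    edge-adj : ∀ i e → adj G (proj₁ (edgeY (tree i) e)) (proj₂ (edgeY (tree i) e)) ≡ true
    edge-adj i e = adj-true (≤-trans (hit-self u v) (≤-trans (ΣF-≤1 (λ e → hit u v (edgeY (tree i) e)) e)
      (≤-trans (≤-reflexive (sym (edgesY-lookup (hit u v) (tree i)))) (tree≤ u v i))))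
      where
      u v : Fin n
      u = proj₁ (edgeY (tree i) e)
      v = proj₂ (edgeY (tree i) e)

    adj-≢ : ∀ {u v} → adj G u v ≡ true → u ≢ v
    adj-≢ {u} p refl = true≢false p (irrefl G u)

    twice : ∀ i {e e'} u v → e ≢ e' → 1 ≤ hit u v (edgeY (tree i) e) → 1 ≤ hit u v (edgeY (tree i) e') → ⊥
    twice i {e} {e'} u v e≢ p q = contradiction (≤-trans (+-mono-≤ p q) (≤-trans (ΣF-two (λ e → hit u v (edgeY (tree i) e)) e≢)
      (≤-trans (≤-reflexive (sym (edgesY-lookup (hit u v) (tree i)))) (≤-trans (tree≤ u v i) (⟦⟧≤1 (adj G u v)))))) λ { (s≤s ()) }

    goodAt : ∀ i → Good (tree i)
    goodAt i = lookupAll good (∈-lookup i)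

    -- Two equal vertices would give a loop or make two of the four edges coincide, against
    -- multiplicity at most one. The exceptions, the far leaf equal to a leaf at the centre, are
    -- excluded by `Good`.
    vertex-≢ : ∀ i {a b} → toℕ a < toℕ b → vertexY (tree i) a ≢ vertexY (tree i) b
    vertex-≢ i {fzero} {fsuc fzero} _ = adj-≢ (edge-adj i fzero)
    vertex-≢ i {fzero} {fsuc (fsuc fzero)} _ = adj-≢ (edge-adj i (fsuc fzero))
    vertex-≢ i {fzero} {fsuc (fsuc (fsuc fzero))} _ = adj-≢ (edge-adj i (fsuc (fsuc fzero)))
    vertex-≢ i {fzero} {fsuc (fsuc (fsuc (fsuc fzero)))} _ eq = twice i {fsuc (fsuc fzero)} {fsuc (fsuc (fsuc fzero))} c s (λ ()) (hit-self c s)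
      (subst (λ t → 1 ≤ hit c s (s , t)) eq (hit-swap c s))
      where
      c s : Fin n
      c = vertexY (tree i) fzero
      s = vertexY (tree i) (fsuc (fsuc (fsuc fzero)))
    vertex-≢ i {fsuc fzero} {fsuc (fsuc fzero)} _ eq = twice i {fzero} {fsuc fzero} c l (λ ()) (hit-self c l) (subst (λ t → 1 ≤ hit c l (c , t)) eq (hit-self c l))
      where
      c l : Fin n
      c = vertexY (tree i) fzero
      l = vertexY (tree i) (fsuc fzero)
    vertex-≢ i {fsuc fzero} {fsuc (fsuc (fsuc fzero))} _ eq = twice i {fzero} {fsuc (fsuc fzero)} c l (λ ()) (hit-self c l) (subst (λ t → 1 ≤ hit c l (c , t)) eq (hit-self c l))
      where
      c l : Fin n
      c = vertexY (tree i) fzero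
      l = vertexY (tree i) (fsuc fzero)
    vertex-≢ i {fsuc fzero} {fsuc (fsuc (fsuc (fsuc fzero)))} _ eq = proj₁ (goodAt i) (sym eq)
    vertex-≢ i {fsuc (fsuc fzero)} {fsuc (fsuc (fsuc fzero))} _ eq = twice i {fsuc fzero} {fsuc (fsuc fzero)} c l (λ ()) (hit-self c l) (subst (λ t → 1 ≤ hit c l (c , t)) eq (hit-self c l))
      where
      c l : Fin n
      c = vertexY (tree i) fzero
      l = vertexY (tree i) (fsuc (fsuc fzero))
    vertex-≢ i {fsuc (fsuc fzero)} {fsuc (fsuc (fsuc (fsuc fzero)))} _ eq = proj₂ (goodAt i) (sym eq)
    vertex-≢ i {fsuc (fsuc (fsuc fzero))} {fsuc (fsuc (fsuc (fsuc fzero)))} _ = adj-≢ (edge-adj i (fsuc (fsuc (fsuc fzero))))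
    vertex-≢ i {fsuc a} {fsuc fzero} (s≤s ())
    vertex-≢ i {fsuc (fsuc a)} {fsuc (fsuc fzero)} (s≤s (s≤s ()))
    vertex-≢ i {fsuc (fsuc (fsuc a))} {fsuc (fsuc (fsuc fzero))} (s≤s (s≤s (s≤s ())))
    vertex-≢ i {fsuc (fsuc (fsuc (fsuc a)))} {fsuc (fsuc (fsuc (fsuc fzero)))} (s≤s (s≤s (s≤s (s≤s ()))))

    copyAt : Fin (length ys) → YCopy G
    copyAt i = record
      { emb = vertexY (tree i)
      ; inj = λ {a} {b} eq → case <-cmp (toℕ a) (toℕ b) of λ where
          (tri< lt _ _) → contradiction eq (vertex-≢ i lt)
          (tri≈ _ p _) → toℕ-injective p
          (tri> _ _ gt) → contradiction (sym eq) (vertex-≢ i gt)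
      ; isEdge = edge-adj i }

    hits⇒hit : ∀ i e u v → Hits (copyAt i) e u v → 1 ≤ hit u v (edgeY (tree i) e)
    hits⇒hit i e u v (inj₁ (p , q)) = subst (λ z → 1 ≤ hit u v z) (cong₂ _,_ (sym p) (sym q)) (hit-self u v)
    hits⇒hit i e u v (inj₂ (p , q)) = subst (λ z → 1 ≤ hit u v z) (cong₂ _,_ (sym p) (sym q)) (hit-swap u v)

  cover⇒decomposition : YDecomposition G
  cover⇒decomposition = length ys , copyAt , λ u v uv →
    let i , pᵢ = ΣF-pos (λ i → ΣF (λ e → hit u v (edgeY (tree i) e))) (≤-reflexive (sym (trans (cover′ u v) (cong ⟦_⟧ uv))))
        e , pₑ = ΣF-pos (λ e → hit u v (edgeY (tree i) e)) pᵢ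
    in (i , e) , hit-≡ pₑ , λ where
      (j , e') h → unique u v i e pᵢ pₑ j e' (hits⇒hit j e' u v h)
    where
    unique : ∀ u v i e → 1 ≤ ΣF (λ e → hit u v (edgeY (tree i) e)) → 1 ≤ hit u v (edgeY (tree i) e) →
      ∀ j e' → 1 ≤ hit u v (edgeY (tree j) e') → (j , e') ≡ (i , e)
    unique u v i e pᵢ pₑ j e' q with j ≟ᶠ i
    ... | no j≢i = contradiction (≤-trans (+-mono-≤ (≤-trans q (ΣF-≤1 (λ e → hit u v (edgeY (tree j) e)) e')) pᵢ)
        (≤-trans (ΣF-two (λ i → ΣF (λ e → hit u v (edgeY (tree i) e))) j≢i) (≤-trans (≤-reflexive (cover′ u v)) (⟦⟧≤1 (adj G u v))))) λ { (s≤s ()) }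
    ... | yes refl with e' ≟ᶠ e
    ... | yes refl = refl
    ... | no e'≢e = ⊥-elim (twice i u v e'≢e q pₑ)

-- Double sums and the maximum cut.

Σ₂ : ∀ {n} → (Fin n → Fin n → ℕ) → ℕ
Σ₂ F = ΣF λ i → ΣF λ j → F i j

argmax : {A : Set} (f : A → ℕ) (x : A) (xs : List A) → ∃ λ m → ∀ {y} → y ∈ x ∷ xs → f y ≤ f m
argmax f x [] = x , λ { (here refl) → ≤-refl }
argmax f x (y ∷ xs) with argmax f y xs
... | m , max with ≤-total (f x) (f m)
... | inj₁ le = m , λ { (here refl) → le ; (there p) → max p }
... | inj₂ ge = x , λ { (here refl) → ≤-refl ; (there p) → ≤-trans (max p) ge }

module _ {n : ℕ} where

  Σ₂-cong : {F H : Fin n → Fin n → ℕ} → (∀ i j → F i j ≡ H i j) → Σ₂ F ≡ Σ₂ H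
  Σ₂-cong eq = Sum-cong (λ i → Sum-cong (eq i) allV) allV

  Σ₂-+ : (F H : Fin n → Fin n → ℕ) → Σ₂ (λ i j → F i j + H i j) ≡ Σ₂ F + Σ₂ H
  Σ₂-+ F H = trans (Sum-cong (λ i → Sum-+ (F i) (H i) allV) allV) (Sum-+ _ _ allV)

  Σ₂-transpose : (F : Fin n → Fin n → ℕ) → Σ₂ (λ i j → F j i) ≡ Σ₂ F
  Σ₂-transpose F = Sum-swap (λ i j → F j i) allV allV

  Σ₂-double : {F H : Fin n → Fin n → ℕ} → (∀ i j → H i j ≡ F i j + F j i) → Σ₂ H ≡ Σ₂ F + Σ₂ F
  Σ₂-double {F} eq = trans (Σ₂-cong eq) (trans (Σ₂-+ F _) (cong (Σ₂ F +_) (Σ₂-transpose F)))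

  Σ₂-Σv : (F : Fin n → Fin n → ℕ) → (Σv λ i → Σv λ j → F i j) ≡ Σ₂ F
  Σ₂-Σv F = trans (ΣF-Σv _) (Sum-cong (λ i → ΣF-Σv (F i)) allV)

  -- Runs over ordered pairs, so each boundary edge counts twice.
  boundary : Graph n → (Fin n → Bool) → ℕ
  boundary G X = Σ₂ λ i j → ⟦ adj G i j ∧ (X i xor X j) ⟧

  boundary-cutSize : (G : Graph n) (X : Fin n → Bool) → boundary G X ≡ cutSize G X + cutSize G X
  boundary-cutSize G X = trans (Σ₂-double eq) (sym (cong₂ _+_ (Σ₂-Σv F) (Σ₂-Σv F)))
    where
    F : Fin n → Fin n → ℕ
    F i j = ⟦ adj G i j ∧ (X i ∧ not (X j)) ⟧
    eq : ∀ i j → ⟦ adj G i j ∧ (X i xor X j) ⟧ ≡ F i j + F j i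
    eq i j rewrite Graph.sym G j i with adj G i j | X i | X j
    ... | false | _ | _ = refl
    ... | true | true | true = refl
    ... | true | true | false = refl
    ... | true | false | true = refl
    ... | true | false | false = refl

  -- Switching the sides along X does not enlarge a maximum cut, so at least half of the edges
  -- leaving X belong to the cut.
  abstract
    max-cut : (G : Graph n) → ∃ λ (A : Fin n → Bool) → ∀ X →
      boundary G X ≤ Σ₂ (λ i j → ⟦ adj G i j ∧ ((A i xor A j) ∧ (X i xor X j)) ⟧) + Σ₂ (λ i j → ⟦ adj G i j ∧ ((A i xor A j) ∧ (X i xor X j)) ⟧)
    max-cut G with argmax (boundary G ∘ lookup) (tabulateᵛ (const false)) (allSubsets n)
    ... | s , max = A , bound
      where
      A : Fin n → Bool
      A = lookup s
      bound : ∀ X → boundary G X ≤ Σ₂ (λ i j → ⟦ adj G i j ∧ ((A i xor A j) ∧ (X i xor X j)) ⟧) + Σ₂ (λ i j → ⟦ adj G i j ∧ ((A i xor A j) ∧ (X i xor X j)) ⟧)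
      bound X = +-cancelˡ-≤ (boundary G A) _ _ (begin
        boundary G A + boundary G X ≡⟨ Σ₂-+ _ _ ⟨
        Σ₂ (λ i j → ⟦ adj G i j ∧ (A i xor A j) ⟧ + ⟦ adj G i j ∧ (X i xor X j) ⟧)
          ≡⟨ Σ₂-cong (λ i j → pointwise (adj G i j) (A i) (A j) (X i) (X j)) ⟩
        Σ₂ (λ i j → ⟦ adj G i j ∧ ((A i xor X i) xor (A j xor X j)) ⟧ + (B i j + B i j)) ≡⟨ trans (Σ₂-+ _ _) (cong (boundary G (λ v → A v xor X v) +_) (Σ₂-+ B B)) ⟩
        boundary G (λ v → A v xor X v) + (Σ₂ B + Σ₂ B) ≤⟨ +-monoˡ-≤ _ maximal ⟩
        boundary G A + (Σ₂ B + Σ₂ B) ∎)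
        where
        open ≤-Reasoning
        B : Fin n → Fin n → ℕ
        B i j = ⟦ adj G i j ∧ ((A i xor A j) ∧ (X i xor X j)) ⟧
        pointwise : ∀ g a b x y → ⟦ g ∧ (a xor b) ⟧ + ⟦ g ∧ (x xor y) ⟧ ≡
          ⟦ g ∧ ((a xor x) xor (b xor y)) ⟧ + (⟦ g ∧ ((a xor b) ∧ (x xor y)) ⟧ + ⟦ g ∧ ((a xor b) ∧ (x xor y)) ⟧)
        pointwise false a b x y = refl
        pointwise true a b x y = trans (lem (a xor b) (x xor y)) (cong (λ z → ⟦ z ⟧ + (⟦ (a xor b) ∧ (x xor y) ⟧ + ⟦ (a xor b) ∧ (x xor y) ⟧)) (xor-interchange a b x y))
          where
          lem : ∀ p q → ⟦ p ⟧ + ⟦ q ⟧ ≡ ⟦ p xor q ⟧ + (⟦ p ∧ q ⟧ + ⟦ p ∧ q ⟧)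
          lem true true = refl
          lem true false = refl
          lem false true = refl
          lem false false = refl
        maximal : boundary G (λ v → A v xor X v) ≤ boundary G A
        maximal = ≤-trans (≤-reflexive (Σ₂-cong (λ i j → cong (λ b → ⟦ adj G i j ∧ b ⟧)
          (sym (cong₂ _xor_ (lookup∘tabulate (λ v → A v xor X v) i) (lookup∘tabulate (λ v → A v xor X v) j)))))) (max (there (∈-allSubsets (tabulateᵛ (λ v → A v xor X v)))))

  -- Edge lists of relations, and deletion of edges.

  row : (Fin n → Fin n → Bool) → Fin n → List (Edge n)
  row F i = concatMap (λ j → if F i j then (i , j) ∷ [] else []) allV

  edgeList : (Fin n → Fin n → Bool) → List (Edge n)
  edgeList F = concatMap (row F) allV

  Sum-row : ∀ f F i → Sum f (row F i) ≡ ΣF (λ j → ⟦ F i j ⟧ * f (i , j))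
  Sum-row f F i = trans (Sum-concatMap f _ allV) (Sum-cong eq allV)
    where
    eq : ∀ j → Sum f (if F i j then (i , j) ∷ [] else []) ≡ ⟦ F i j ⟧ * f (i , j)
    eq j with F i j
    ... | true = refl
    ... | false = refl

  Sum-edgeList : ∀ f F → Sum f (edgeList F) ≡ Σ₂ (λ i j → ⟦ F i j ⟧ * f (i , j))
  Sum-edgeList f F = trans (Sum-concatMap f (row F) allV) (Sum-cong (Sum-row f F) allV)

  row-∈ : ∀ F i {e} → e ∈ row F i → proj₁ e ≡ i × F i (proj₂ e) ≡ true
  row-∈ F i e∈ with ∈-concatMap⁻ (λ j → if F i j then (i , j) ∷ [] else []) allV e∈
  ... | j , _ , p with F i j in Fij
  row-∈ F i e∈ | j , _ , here refl | true = refl , Fij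

  edgeList-∈ : ∀ F {u v} → (u , v) ∈ edgeList F → F u v ≡ true
  edgeList-∈ F e∈ with ∈-concatMap⁻ (row F) allV e∈
  ... | i , _ , p with row-∈ F i p
  ... | refl , q = q

  Σ₂-δ : ∀ (F : Fin n → Fin n → Bool) u v → Σ₂ (λ i j → ⟦ F i j ⟧ * (⟦ i == u ⟧ * ⟦ j == v ⟧)) ≡ ⟦ F u v ⟧
  Σ₂-δ F u v = begin
    Σ₂ (λ i j → ⟦ F i j ⟧ * (⟦ i == u ⟧ * ⟦ j == v ⟧)) ≡⟨ Σ₂-cong (λ i j → trans (lem ⟦ F i j ⟧ ⟦ i == u ⟧ ⟦ j == v ⟧) (cong₂ (λ a b → ⟦ a ⟧ * (⟦ b ⟧ * ⟦ F i j ⟧)) (==-sym i u) (==-sym j v))) ⟩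
    Σ₂ (λ i j → ⟦ u == i ⟧ * (⟦ v == j ⟧ * ⟦ F i j ⟧)) ≡⟨ Sum-cong (λ i → trans (Sum-*ˡ ⟦ u == i ⟧ _ allV) (cong (⟦ u == i ⟧ *_) (ΣF-δ v (λ j → ⟦ F i j ⟧)))) allV ⟩
    ΣF (λ i → ⟦ u == i ⟧ * ⟦ F i v ⟧) ≡⟨ ΣF-δ u (λ i → ⟦ F i v ⟧) ⟩
    ⟦ F u v ⟧ ∎
    where
    open ≡-Reasoning
    lem : ∀ a b c → a * (b * c) ≡ b * (c * a)
    lem = solve-∀

  hit-edgeList : ∀ F u v → Sum (hit u v) (edgeList F) ≡ ⟦ F u v ⟧ + ⟦ F v u ⟧
  hit-edgeList F u v = trans (Sum-edgeList (hit u v) F) (trans (Σ₂-cong expand) (trans (Σ₂-+ _ _) (cong₂ _+_ (Σ₂-δ F u v) (Σ₂-δ F v u))))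
    where
    and : ∀ a b → ⟦ a ∧ b ⟧ ≡ ⟦ a ⟧ * ⟦ b ⟧
    and true b = sym (+-identityʳ _)
    and false b = refl
    expand : ∀ i j → ⟦ F i j ⟧ * hit u v (i , j) ≡ ⟦ F i j ⟧ * (⟦ i == u ⟧ * ⟦ j == v ⟧) + ⟦ F i j ⟧ * (⟦ i == v ⟧ * ⟦ j == u ⟧)
    expand i j = trans (*-distribˡ-+ ⟦ F i j ⟧ _ _) (cong₂ (λ a b → ⟦ F i j ⟧ * a + ⟦ F i j ⟧ * b) (and (i == u) (j == v)) (and (i == v) (j == u)))

  Σ₂-hit : (L : List (Edge n)) → Σ₂ (λ u v → Sum (hit u v) L) ≡ length L + length L
  Σ₂-hit L = begin
    Σ₂ (λ u v → Sum (hit u v) L) ≡⟨ Sum-cong (λ u → Sum-swap (λ v e → hit u v e) allV L) allV ⟩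
    ΣF (λ u → Sum (λ e → ΣF (λ v → hit u v e)) L) ≡⟨ Sum-swap (λ u e → ΣF (λ v → hit u v e)) allV L ⟩
    Sum (λ e → Σ₂ (λ u v → hit u v e)) L ≡⟨ Sum-cong one L ⟩
    Sum (λ _ → 2) L ≡⟨ trans (Sum-+ (λ _ → 1) (λ _ → 1) L) (cong₂ _+_ (Sum-1 L) (Sum-1 L)) ⟩
    length L + length L ∎
    where
    open ≡-Reasoning
    both : ∀ x y → Σ₂ (λ u v → ⟦ (x == u) ∧ (y == v) ⟧) ≡ 1
    both x y = trans (Sum-cong (λ u → trans (Sum-cong (λ v → and (x == u) (y == v)) allV) (trans (Sum-*ˡ ⟦ x == u ⟧ _ allV)
      (trans (cong (⟦ x == u ⟧ *_) (ΣF-δ₁ y)) (*-identityʳ _)))) allV) (ΣF-δ₁ x)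
      where
      and : ∀ a b → ⟦ a ∧ b ⟧ ≡ ⟦ a ⟧ * ⟦ b ⟧
      and true b = sym (+-identityʳ _)
      and false b = refl
    one : ∀ e → Σ₂ (λ u v → hit u v e) ≡ 2
    one (x , y) = trans (Σ₂-+ _ _) (cong₂ _+_ (both x y) (trans (Σ₂-transpose (λ u v → ⟦ (x == u) ∧ (y == v) ⟧)) (both x y)))

  same? : (x y u v : Fin n) → Bool
  same? x y u v = ((x == u) ∧ (y == v)) ∨ ((x == v) ∧ (y == u))

  delete : Graph n → (x y : Fin n) → Graph n
  delete R x y = record
    { adj = λ u v → adj R u v ∧ not (same? x y u v)
    ; sym = λ u v → cong₂ (λ a b → a ∧ not b) (Graph.sym R u v) (∨-comm ((x == u) ∧ (y == v)) _)
    ; irrefl = λ u → cong (_∧ not (same? x y u u)) (irrefl R u) }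

  delete-count : ∀ R x y → adj R x y ≡ true → ∀ u v → ⟦ adj R u v ⟧ ≡ hit u v (x , y) + ⟦ adj (delete R x y) u v ⟧
  delete-count R x y xy u v = lem (x ≟ᶠ u) (y ≟ᶠ v) (x ≟ᶠ v) (y ≟ᶠ u)
    where
    lem : Dec (x ≡ u) → Dec (y ≡ v) → Dec (x ≡ v) → Dec (y ≡ u) → ⟦ adj R u v ⟧ ≡ hit u v (x , y) + ⟦ adj (delete R x y) u v ⟧
    lem (yes refl) (yes refl) (yes refl) _ = ⊥-elim (true≢false xy (irrefl R x))
    lem (yes refl) (yes refl) (no p) q rewrite ==-refl x | ==-refl y | ==-≢ p | xy = refl
    lem (yes refl) (no q) (no p) _ rewrite ==-refl x | ==-≢ p | ==-≢ q = cong ⟦_⟧ (sym (∧-identityʳ (adj R u v)))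
    lem (yes refl) (no q) (yes refl) _ rewrite ==-refl x | ==-≢ q = cong ⟦_⟧ (sym (∧-identityʳ (adj R u v)))
    lem (no p) q (yes refl) (yes refl) rewrite ==-refl x | ==-refl y | ==-≢ p | trans (Graph.sym R y x) xy = refl
    lem (no p) q (yes refl) (no r) rewrite ==-refl x | ==-≢ p | ==-≢ r = cong ⟦_⟧ (sym (∧-identityʳ (adj R u v)))
    lem (no p) q (no r) _ rewrite ==-≢ p | ==-≢ r = cong ⟦_⟧ (sym (∧-identityʳ (adj R u v)))

  delete-keeps : ∀ R x y {p q} → adj R p q ≡ true → ¬ (x ≡ p × y ≡ q) → ¬ (x ≡ q × y ≡ p) → adj (delete R x y) p q ≡ true
  delete-keeps R x y {p} {q} pq ne₁ ne₂ with same? x y p q in eq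
  ... | false = trans (∧-identityʳ _) pq
  ... | true = ⊥-elim (split (x ≟ᶠ p) (y ≟ᶠ q) (x ≟ᶠ q) (y ≟ᶠ p) eq)
    where
    split : Dec (x ≡ p) → Dec (y ≡ q) → Dec (x ≡ q) → Dec (y ≡ p) → same? x y p q ≡ true → ⊥
    split (yes a) (yes b) _ _ eq = ne₁ (a , b)
    split _ _ (yes a) (yes b) eq = ne₂ (a , b)
    split (no a) _ (no b) _ eq = true≢false eq (cong₂ (λ i j → (i ∧ (y == q)) ∨ (j ∧ (y == p))) (==-≢ a) (==-≢ b))
    split (no a) _ (yes b) (no c) eq = true≢false eq (trans (cong₂ (λ i j → (i ∧ (y == q)) ∨ ((x == q) ∧ j)) (==-≢ a) (==-≢ c)) (∧-zeroʳ (x == q)))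
    split (yes a) (no b) (no c) _ eq = true≢false eq (trans (cong₂ (λ i j → ((x == p) ∧ i) ∨ (j ∧ (y == p))) (==-≢ b) (==-≢ c)) (cong (_∨ false) (∧-zeroʳ (x == p))))
    split (yes a) (no b) (yes c) (no d) eq = true≢false eq (trans (cong₂ (λ i j → ((x == p) ∧ i) ∨ ((x == q) ∧ j)) (==-≢ b) (==-≢ d)) (cong₂ _∨_ (∧-zeroʳ (x == p)) (∧-zeroʳ (x == q))))

  -- Greedy removal of copies of Y and ownership of the remaining edges.

  IsY : Graph n → YTree n → Set
  IsY R (c , l₁ , l₂ , s , t) = (adj R c l₁ ≡ true × adj R c l₂ ≡ true × adj R c s ≡ true × adj R s t ≡ true) ×
    (l₁ ≢ l₂ × l₁ ≢ s × l₂ ≢ s) × (t ≢ c × t ≢ l₁ × t ≢ l₂)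

  YFree : Graph n → Set
  YFree R = ∀ y → ¬ IsY R y

  find-Y : (R : Graph n) → Dec (∃ λ c → ∃ λ l₁ → ∃ λ l₂ → ∃ λ s → ∃ λ t → IsY R (c , l₁ , l₂ , s , t))
  find-Y R = any? λ c → any? λ l₁ → any? λ l₂ → any? λ s → any? λ t →
    ((adj R c l₁ ≟ᵇ true) ×-dec (adj R c l₂ ≟ᵇ true) ×-dec (adj R c s ≟ᵇ true) ×-dec (adj R s t ≟ᵇ true)) ×-dec
    (¬? (l₁ ≟ᶠ l₂) ×-dec ¬? (l₁ ≟ᶠ s) ×-dec ¬? (l₂ ≟ᶠ s)) ×-dec (¬? (t ≟ᶠ c) ×-dec ¬? (t ≟ᶠ l₁) ×-dec ¬? (t ≟ᶠ l₂))

  adj-irrefl : ∀ (R : Graph n) {u v} → adj R u v ≡ true → u ≢ v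
  adj-irrefl R {u} p refl = true≢false p (irrefl R u)

  delete-Y : ∀ R y → IsY R y → ∃ λ R' → ∀ u v → ⟦ adj R u v ⟧ ≡ Sum (hit u v) (edgesY y) + ⟦ adj R' u v ⟧
  delete-Y R (c , l₁ , l₂ , s , t) ((e₁ , e₂ , e₃ , e₄) , (l₁≢l₂ , l₁≢s , l₂≢s) , (t≢c , t≢l₁ , t≢l₂)) = R₄ , λ u v → begin
    ⟦ adj R u v ⟧ ≡⟨ delete-count R c l₁ e₁ u v ⟩
    h u v (c , l₁) + ⟦ adj R₁ u v ⟧ ≡⟨ cong (h u v (c , l₁) +_) (delete-count R₁ c l₂ e₂' u v) ⟩
    h u v (c , l₁) + (h u v (c , l₂) + ⟦ adj R₂ u v ⟧) ≡⟨ cong (λ x → h u v (c , l₁) + (h u v (c , l₂) + x)) (trans (delete-count R₂ c s e₃'' u v) (cong (h u v (c , s) +_) (delete-count R₃ s t e₄''' u v))) ⟩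
    h u v (c , l₁) + (h u v (c , l₂) + (h u v (c , s) + (h u v (s , t) + ⟦ adj R₄ u v ⟧))) ≡⟨ lem (h u v (c , l₁)) (h u v (c , l₂)) (h u v (c , s)) (h u v (s , t)) ⟦ adj R₄ u v ⟧ ⟩
    h u v (c , l₁) + (h u v (c , l₂) + (h u v (c , s) + (h u v (s , t) + 0))) + ⟦ adj R₄ u v ⟧ ∎
    where
    open ≡-Reasoning
    h : Fin n → Fin n → Edge n → ℕ
    h = hit
    R₁ R₂ R₃ R₄ : Graph n
    R₁ = delete R c l₁
    R₂ = delete R₁ c l₂
    R₃ = delete R₂ c s
    R₄ = delete R₃ s t
    c≢l₂ : c ≢ l₂
    c≢l₂ = adj-irrefl R e₂
    c≢s : c ≢ s
    c≢s = adj-irrefl R e₃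
    e₂' : adj R₁ c l₂ ≡ true
    e₂' = delete-keeps R c l₁ e₂ (λ p → l₁≢l₂ (proj₂ p)) (λ p → c≢l₂ (proj₁ p))
    e₃'' : adj R₂ c s ≡ true
    e₃'' = delete-keeps R₁ c l₂ (delete-keeps R c l₁ e₃ (λ p → l₁≢s (proj₂ p)) (λ p → c≢s (proj₁ p))) (λ p → l₂≢s (proj₂ p)) (λ p → c≢s (proj₁ p))
    e₄''' : adj R₃ s t ≡ true
    e₄''' = delete-keeps R₂ c s (delete-keeps R₁ c l₂ (delete-keeps R c l₁ e₄ (λ p → c≢s (proj₁ p)) (λ p → l₁≢s (proj₂ p)))
      (λ p → c≢s (proj₁ p)) (λ p → l₂≢s (proj₂ p))) (λ p → c≢s (proj₁ p)) (λ p → t≢c (sym (proj₁ p)))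
    lem : ∀ a b c d r → a + (b + (c + (d + r))) ≡ a + (b + (c + (d + 0))) + r
    lem = solve-∀

  abstract
    peel : (R : Graph n) → ∃ λ ys → ∃ λ R' → All Good ys × YFree R' ×
      (∀ u v → ⟦ adj R u v ⟧ ≡ Sum (hit u v) (edgesYs ys) + ⟦ adj R' u v ⟧)
    peel R = go (Σ₂ (λ u v → ⟦ adj R u v ⟧)) R ≤-refl
      where
      go : ∀ fuel R → Σ₂ (λ u v → ⟦ adj R u v ⟧) ≤ fuel → ∃ λ ys → ∃ λ R' → All Good ys × YFree R' ×
        (∀ u v → ⟦ adj R u v ⟧ ≡ Sum (hit u v) (edgesYs ys) + ⟦ adj R' u v ⟧)
      go fuel R le with find-Y R
      ... | no ¬y = [] , R , [] , (λ y isY → ¬y (_ , _ , _ , _ , _ , isY)) , λ u v → refl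
      ... | yes (c , l₁ , l₂ , s , t , isY@(_ , _ , (_ , t≢l₁ , t≢l₂))) with delete-Y R (c , l₁ , l₂ , s , t) isY
      ... | R₁ , eq with fuel
      ... | zero = contradiction (≤-trans (≤-reflexive (sym count)) le) λ ()
        where
        -- Four edges, each counted in both directions.
        count : Σ₂ (λ u v → ⟦ adj R u v ⟧) ≡ 8 + Σ₂ (λ u v → ⟦ adj R₁ u v ⟧)
        count = trans (Σ₂-cong eq) (trans (Σ₂-+ _ _) (cong (_+ Σ₂ (λ u v → ⟦ adj R₁ u v ⟧)) (Σ₂-hit (edgesY (c , l₁ , l₂ , s , t)))))
      ... | suc fuel' with go fuel' R₁ (≤-pred (≤-trans (≤-trans (m≤n+m _ 7) (≤-reflexive (sym count))) le))
        where
        count : Σ₂ (λ u v → ⟦ adj R u v ⟧) ≡ 8 + Σ₂ (λ u v → ⟦ adj R₁ u v ⟧)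
        count = trans (Σ₂-cong eq) (trans (Σ₂-+ _ _) (cong (_+ Σ₂ (λ u v → ⟦ adj R₁ u v ⟧)) (Σ₂-hit (edgesY (c , l₁ , l₂ , s , t)))))
      ... | ys , R' , good , free , eq' = (c , l₁ , l₂ , s , t) ∷ ys , R' , (t≢l₁ , t≢l₂) ∷ good , free , λ u v →
        trans (eq u v) (trans (cong (Sum (hit u v) (edgesY (c , l₁ , l₂ , s , t)) +_) (eq' u v))
          (trans (sym (+-assoc (Sum (hit u v) (edgesY (c , l₁ , l₂ , s , t))) _ _))
            (cong (_+ ⟦ adj R' u v ⟧) (sym (Sum-++ (hit u v) (edgesY (c , l₁ , l₂ , s , t)) (edgesYs ys))))))

  pick-other : (p : Fin n → Bool) (ex : List (Fin n)) → length ex < ΣF (λ x → ⟦ p x ⟧) → ∃ λ x → p x ≡ true × All (x ≢_) ex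
  pick-other p ex lt with any? (λ x → (p x ≟ᵇ true) ×-dec allList? (λ e → ¬? (x ≟ᶠ e)) ex)
  ... | yes (x , px , x∉) = x , px , x∉
  ... | no none = contradiction lt (≤⇒≯ (≤-trans (Sum-mono le allV) (≤-reflexive (fiber-count id ex))))
    where
    le : ∀ x → ⟦ p x ⟧ ≤ Sum (λ e → ⟦ e == x ⟧) ex
    le x with p x in px
    ... | false = z≤n
    ... | true with occ x ex in eq
    ... | suc m = s≤s z≤n
    ... | zero = contradiction (x , px , absent x ex eq) none

  degree : Graph n → Fin n → ℕ
  degree R u = ΣF (λ v → ⟦ adj R u v ⟧)

  -- With `t` chosen at `v`, two leaves at `u` have to avoid `v`, `t` and each other; degree four at
  -- `u` leaves room for both, and the result is a copy of Y.
  YFree-degree : ∀ R → YFree R → ∀ {u v} → adj R u v ≡ true → 4 ≤ degree R u → 4 ≤ degree R v → ⊥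
  YFree-degree R free {u} {v} uv du dv with pick-other (adj R v) (u ∷ []) (≤-trans (s≤s (s≤s z≤n)) dv)
  ... | t , vt , t≢u ∷ [] with pick-other (adj R u) (v ∷ t ∷ []) (≤-trans (s≤s (s≤s (s≤s z≤n))) du)
  ... | l₁ , ul₁ , l₁≢v ∷ l₁≢t ∷ [] with pick-other (adj R u) (v ∷ t ∷ l₁ ∷ []) du
  ... | l₂ , ul₂ , l₂≢v ∷ l₂≢t ∷ l₂≢l₁ ∷ [] = free (u , l₁ , l₂ , v , t)
    ((ul₁ , ul₂ , uv , vt) , (l₂≢l₁ ∘ sym , l₁≢v , l₂≢v) , (t≢u , l₁≢t ∘ sym , l₂≢t ∘ sym))

  low : Graph n → Fin n → Bool
  low R u = does (degree R u ≤? 3)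

  -- In a graph without copies of Y each edge has an end of degree at most three. If both ends
  -- qualify, the smaller index decides.
  owned : Graph n → Fin n → Fin n → Bool
  owned R u v = adj R u v ∧ (low R u ∧ (not (low R v) ∨ (toℕ u <ᵇ toℕ v)))

  owned-degree : ∀ R u → ΣF (λ v → ⟦ owned R u v ⟧) ≤ 3
  owned-degree R u = go (degree R u ≤? 3)
    where
    sub : ∀ a b → ⟦ a ∧ b ⟧ ≤ ⟦ a ⟧
    sub true b = ⟦⟧≤1 b
    sub false b = z≤n
    other : Fin n → Bool
    other v = not (low R v) ∨ (toℕ u <ᵇ toℕ v)
    go : Dec (degree R u ≤ 3) → ΣF (λ v → ⟦ owned R u v ⟧) ≤ 3
    go (yes le) = ≤-trans (Sum-mono (λ v → sub (adj R u v) (low R u ∧ other v)) allV) le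
    go (no p) = ≤-trans (≤-reflexive (trans (Sum-cong (λ v → cong ⟦_⟧ (trans (cong (λ b → adj R u v ∧ (b ∧ other v)) (dec-false (degree R u ≤? 3) p))
      (∧-zeroʳ (adj R u v)))) allV) (Sum-0 (allV {n})))) z≤n

  owned-once : ∀ R → YFree R → ∀ u v → ⟦ owned R u v ⟧ + ⟦ owned R v u ⟧ ≡ ⟦ adj R u v ⟧
  owned-once R free u v rewrite Graph.sym R v u with adj R u v in uv
  ... | false = refl
  ... | true = ownership (degree R u ≤? 3) (degree R v ≤? 3)
    where
    u≢v : u ≢ v
    u≢v = adj-irrefl R uv
    compare : ⟦ toℕ u <ᵇ toℕ v ⟧ + ⟦ toℕ v <ᵇ toℕ u ⟧ ≡ 1
    compare with <-cmp (toℕ u) (toℕ v)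
    ... | tri≈ _ p _ = contradiction (toℕ-injective p) u≢v
    ... | tri< lt _ ¬gt = cong₂ (λ a b → ⟦ a ⟧ + ⟦ b ⟧) (dec-true (toℕ u <? toℕ v) lt) (dec-false (toℕ v <? toℕ u) ¬gt)
    ... | tri> ¬lt _ gt = cong₂ (λ a b → ⟦ a ⟧ + ⟦ b ⟧) (dec-false (toℕ u <? toℕ v) ¬lt) (dec-true (toℕ v <? toℕ u) gt)
    ownership : (p : Dec (degree R u ≤ 3)) (q : Dec (degree R v ≤ 3)) →
      ⟦ does p ∧ (not (does q) ∨ (toℕ u <ᵇ toℕ v)) ⟧ + ⟦ does q ∧ (not (does p) ∨ (toℕ v <ᵇ toℕ u)) ⟧ ≡ 1
    ownership (yes _) (yes _) = compare
    ownership (yes _) (no _) = refl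
    ownership (no _) (yes _) = refl
    ownership (no p) (no q) = ⊥-elim (YFree-degree R free uv (≰⇒> p) (≰⇒> q))

∧-true : ∀ {a b} → a ∧ b ≡ true → a ≡ true × b ≡ true
∧-true {true} p = refl , p

not-true : ∀ {a} → not a ≡ true → a ≡ false
not-true {false} p = refl

abstract
  chunk : ∀ {A : Set} (xs : List A) → length xs ≡ 0 ⊎ 3 ≤ length xs →
    ∃ λ gs → (∀ f → Sum f xs ≡ Sum (Sum f) gs) × All (λ g → 3 ≤ length g × length g ≤ 5 × (∀ e → e ∈ g → e ∈ xs)) gs
  chunk [] _ = [] , (λ f → refl) , []
  chunk (x ∷ []) (inj₂ (s≤s ()))
  chunk (x ∷ y ∷ []) (inj₂ (s≤s (s≤s ())))
  chunk (x ∷ y ∷ z ∷ []) _ = ((x ∷ y ∷ z ∷ []) ∷ []) , (λ f → sym (+-identityʳ _)) , (≤-refl , s≤s (s≤s (s≤s z≤n)) , λ _ → id) ∷ []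
  chunk (x ∷ y ∷ z ∷ a ∷ []) _ = ((x ∷ y ∷ z ∷ a ∷ []) ∷ []) , (λ f → sym (+-identityʳ _)) , (n≤1+n 3 , n≤1+n 4 , λ _ → id) ∷ []
  chunk (x ∷ y ∷ z ∷ a ∷ b ∷ []) _ = ((x ∷ y ∷ z ∷ a ∷ b ∷ []) ∷ []) , (λ f → sym (+-identityʳ _)) , (m≤n+m 3 2 , ≤-refl , λ _ → id) ∷ []
  chunk (x ∷ y ∷ z ∷ a ∷ b ∷ c ∷ xs) _ with chunk (a ∷ b ∷ c ∷ xs) (inj₂ (s≤s (s≤s (s≤s z≤n))))
  ... | gs , sums , props = (x ∷ y ∷ z ∷ []) ∷ gs ,
    (λ f → trans (lem (f x) (f y) (f z) (Sum f (a ∷ b ∷ c ∷ xs))) (cong (f x + (f y + (f z + 0)) +_) (sums f))) ,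
    (≤-refl , s≤s (s≤s (s≤s z≤n)) , λ { _ (here p) → here p ; _ (there (here p)) → there (here p) ; _ (there (there (here p))) → there (there (here p)) }) ∷
    mapAll (λ { (p , q , sub) → p , q , λ e e∈ → there (there (there (sub e e∈))) }) props
    where
    lem : ∀ a b c r → a + (b + (c + r)) ≡ a + (b + (c + 0)) + r
    lem = solve-∀

ΣF-8 : (f : Fin 8 → ℕ) → ΣF f ≡ f (# 0) + (f (# 1) + (f (# 2) + (f (# 3) + (f (# 4) + (f (# 5) + (f (# 6) + (f (# 7) + 0)))))))
ΣF-8 f = step f (step _ (step _ (step _ (step _ (step _ (step _ (step _ (ΣF-empty _))))))))
  where
  step : ∀ {n} (f : Fin (suc n) → ℕ) {r} → ΣF (f ∘ fsuc) ≡ r → ΣF f ≡ f fzero + r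
  step f p = trans (ΣF-suc f) (cong (f fzero +_) p)

d₁-edgeList : ∀ {n} (F : Fin n → Fin n → Bool) a → d₁ a (edgeList F) ≡ ΣF (λ j → ⟦ F a j ⟧)
d₁-edgeList F a = trans (Sum-edgeList _ F) (trans (Sum-cong (λ i → trans
    (Sum-cong (λ j → trans (*-comm ⟦ F i j ⟧ _) (cong (λ b → ⟦ b ⟧ * ⟦ F i j ⟧) (==-sym i a))) allV)
    (Sum-*ˡ ⟦ a == i ⟧ (λ j → ⟦ F i j ⟧) allV)) allV) (ΣF-δ a (λ i → ΣF (λ j → ⟦ F i j ⟧))))

edgeCount-double : ∀ {n} (G : Graph n) → Σ₂ (λ i j → ⟦ adj G i j ⟧) ≡ edgeCount G + edgeCount G
edgeCount-double {n} G = trans (Σ₂-double eq) (sym (cong₂ _+_ (Σ₂-Σv F) (Σ₂-Σv F)))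
  where
  F : Fin n → Fin n → ℕ
  F i j = ⟦ adj G i j ∧ (toℕ i <ᵇ toℕ j) ⟧
  eq : ∀ i j → ⟦ adj G i j ⟧ ≡ F i j + F j i
  eq i j rewrite Graph.sym G j i with adj G i j in ij
  ... | false = refl
  ... | true with <-cmp (toℕ i) (toℕ j)
  ... | tri≈ _ p _ = contradiction (toℕ-injective p) (adj-irrefl G ij)
  ... | tri< lt _ ¬gt = sym (cong₂ (λ a b → ⟦ a ⟧ + ⟦ b ⟧) (dec-true (toℕ i <? toℕ j) lt) (dec-false (toℕ j <? toℕ i) ¬gt))
  ... | tri> ¬lt _ gt = sym (cong₂ (λ a b → ⟦ a ⟧ + ⟦ b ⟧) (dec-false (toℕ i <? toℕ j) ¬lt) (dec-true (toℕ j <? toℕ i) gt))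

-- The decomposition of a graph with at least two vertices.

module Main {n : ℕ} (v₀ : Fin n) (other-vertex : (v : Fin n) → ∃ λ u → u ≢ v)
  (G : Graph n) (connected : EdgeConnected 191 G) (4∣e : 4 ∣ edgeCount G) where

  side : Fin n → Bool
  side = proj₁ (max-cut G)

  F : Fin n → Fin n → Bool
  F u v = adj G u v ∧ (side u ∧ not (side v))

  Bp : List (Edge n)
  Bp = edgeList F

  sidedF : ∀ {u v} → F u v ≡ true → side u ≡ true × side v ≡ false
  sidedF {u} {v} p with ∧-true {adj G u v} p
  ... | _ , q with ∧-true {side u} q
  ... | Au , Bv = Au , not-true Bv

  sided : Sided side Bp
  sided = mk λ e∈ → sidedF (edgeList-∈ F e∈)

  cuts : ∀ X u v → X u ≡ true → X v ≡ false → 80 ≤ cut X Bp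
  -- The packing of 8 subgraphs out of groups of at most 5 demands `80 = 2 * 8 * 5`; the boundary in
  -- G, at most twice the cut, has at least 191 edges, and `160 + 31 = 191`.
  cuts X u v Xu Xv = double-cancel-≤ (≤-trans (m≤n+m 160 31) (≤-trans (connected X (u , Xu) (v , Xv)) (double-cancel-≤ (begin
    cutSize G X + cutSize G X ≡⟨ boundary-cutSize G X ⟨
    boundary G X ≤⟨ proj₂ (max-cut G) X ⟩
    Σ₂ B + Σ₂ B ≡⟨ cong₂ _+_ both both ⟩
    (cut X Bp + cut X Bp) + (cut X Bp + cut X Bp) ∎))))
    where
    open ≤-Reasoning
    B : Fin n → Fin n → ℕ
    B i j = ⟦ adj G i j ∧ ((side i xor side j) ∧ (X i xor X j)) ⟧
    pointwise : ∀ g a b x y → ⟦ g ∧ ((a xor b) ∧ (x xor y)) ⟧ ≡ ⟦ g ∧ (a ∧ not b) ⟧ * ⟦ x xor y ⟧ + ⟦ g ∧ (b ∧ not a) ⟧ * ⟦ y xor x ⟧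
    pointwise false _ _ _ _ = refl
    pointwise true true true x y = refl
    pointwise true true false x y = sym (trans (+-identityʳ _) (*-identityˡ _))
    pointwise true false true x y = trans (cong ⟦_⟧ (xor-comm x y)) (sym (*-identityˡ _))
    pointwise true false false x y = refl
    both : Σ₂ B ≡ cut X Bp + cut X Bp
    both = trans (Σ₂-double {F = λ i j → ⟦ F i j ⟧ * ⟦ X i xor X j ⟧} (λ i j → trans (pointwise (adj G i j) (side i) (side j) (X i) (X j))
        (cong (λ g → ⟦ F i j ⟧ * ⟦ X i xor X j ⟧ + ⟦ g ∧ (side j ∧ not (side i)) ⟧ * ⟦ X j xor X i ⟧) (Graph.sym G i j))))
      (sym (cong₂ _+_ (Sum-edgeList _ F) (Sum-edgeList _ F)))

  degree-large : ∀ v → side v ≡ true → 80 ≤ d₁ v Bp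
  degree-large v Av with other-vertex v
  ... | u , u≢v = begin
    80 ≤⟨ cuts (v ==_) v u (==-refl v) (==-≢ (u≢v ∘ sym)) ⟩
    cut (v ==_) Bp ≤⟨ Sum-mono (λ e → ⟦xor⟧≤ (v == proj₁ e) (v == proj₂ e)) Bp ⟩
    Sum (λ e → ⟦ v == proj₁ e ⟧ + ⟦ v == proj₂ e ⟧) Bp ≡⟨ trans (Sum-+ _ _ Bp) (cong₂ _+_ (Sum-cong (λ e → cong ⟦_⟧ (==-sym v (proj₁ e))) Bp) (Sum-cong (λ e → cong ⟦_⟧ (==-sym v (proj₂ e))) Bp)) ⟩
    d₁ v Bp + d₂ v Bp ≡⟨ trans (cong (d₁ v Bp +_) (d₂-sided sided Av)) (+-identityʳ _) ⟩
    d₁ v Bp ∎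
    where open ≤-Reasoning

  length-row : ∀ a → length (row F a) ≡ d₁ a Bp
  length-row a = trans (sym (Sum-1 (row F a))) (trans (Sum-row (λ _ → 1) F a) (trans (Sum-cong (λ j → *-identityʳ _) allV) (sym (d₁-edgeList F a))))

  row-size : ∀ a → length (row F a) ≡ 0 ⊎ 3 ≤ length (row F a)
  row-size a = go (side a) refl
    where
    go : ∀ b → side a ≡ b → length (row F a) ≡ 0 ⊎ 3 ≤ length (row F a)
    go true Aa = inj₂ (≤-trans (m≤n+m 3 77) (≤-trans (degree-large a Aa) (≤-reflexive (sym (length-row a)))))
    go false Aa = inj₁ (trans (length-row a) (d₁-sided sided Aa))

  GroupOK : List (Edge n) → Set
  GroupOK g = 3 ≤ length g × length g ≤ 5 × ∃ λ a → ∀ e → e ∈ g → proj₁ e ≡ a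

  chunks : Fin n → List (List (Edge n))
  chunks a = proj₁ (chunk (row F a) (row-size a))

  allGroups : List (List (Edge n))
  allGroups = concatMap chunks allV

  allOK : All GroupOK allGroups
  allOK = All-concatMap {P = GroupOK} chunks allV λ a → mapAll (λ { (p , q , sub) → p , q , a , λ e e∈ → proj₁ (row-∈ F a (sub e e∈)) })
    (proj₂ (proj₂ (chunk (row F a) (row-size a))))

  groups : Fin (length allGroups) → List (Edge n)
  groups = lookupList allGroups

  groupOK : ∀ g → GroupOK (groups g)
  groupOK g = lookupAll allOK (∈-lookup {xs = allGroups} g)

  groups-sum : ∀ f → ΣF (λ g → Sum f (groups g)) ≡ Sum f Bp
  groups-sum f = trans (sym (Sum-lookup (Sum f) allGroups)) (trans (Sum-concatMap (Sum f) chunks allV)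
    (trans (Sum-cong (λ a → sym (proj₁ (proj₂ (chunk (row F a) (row-size a))) f)) allV) (sym (Sum-concatMap f (row F) allV))))

  open Packing {n} {length allGroups} 8 5 80 v₀ groups (λ g → proj₁ (proj₂ (groupOK g))) ≤-refl (s≤s z≤n)
    (λ X u v Xu Xv → ≤-trans (cuts X u v Xu Xv) (≤-reflexive (sym (trans (Sum-concatMap _ groups allV) (groups-sum _)))))
    using (pick; tree; packing)

  sel : Fin (length allGroups) → Maybe (Fin 8 × Edge n)
  sel = proj₁ packing

  t : Fin 8 → List (Edge n)
  t = tree sel

  conn : ∀ i → Conn (t i)
  conn = proj₂ (proj₂ packing)

  -- What the subgraphs leave of one group. At most one of its three or more edges is selected and
  -- all share their first vertex, so twice the selected degree is at most the remaining one.
  record Rest (g : Fin (length allGroups)) (s : Maybe (Fin 8 × Edge n)) : Set where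
    field
      rest : List (Edge n)
      rest-sum : ∀ f → Sum f (groups g) ≡ ΣF (λ i → Sum f (pick i s)) + Sum f rest
      rest-slack : ∀ v → ΣF (λ i → d₁ v (pick i s)) + ΣF (λ i → d₁ v (pick i s)) ≤ d₁ v rest
  open Rest

  pick-sum : ∀ f j e → ΣF (λ i → Sum f (pick i (just (j , e)))) ≡ f e
  pick-sum f j e = trans (Sum-cong eq allV) (ΣF-δ j (λ _ → f e))
    where
    eq : ∀ i → Sum f (pick i (just (j , e))) ≡ ⟦ j == i ⟧ * f e
    eq i with j == i
    ... | true = refl
    ... | false = refl

  mkRest : ∀ g s → (∀ i e → s ≡ just (i , e) → e ∈ groups g) → Rest g s
  mkRest g nothing _ = record
    { rest = groups g ; rest-sum = λ f → cong (_+ Sum f (groups g)) (sym (Sum-0 (allV {8})))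
    ; rest-slack = λ v → ≤-trans (≤-reflexive (cong₂ _+_ (Sum-0 (allV {8})) (Sum-0 (allV {8})))) z≤n }
  mkRest g (just (j , e)) valid with remove (valid j e refl) | groupOK g
  ... | r , eqv , _ , back | large , _ , a , firsts = record
    { rest = r
    ; rest-sum = λ f → trans (at eqv f) (cong (_+ Sum f r) (sym (pick-sum f j e)))
    ; rest-slack = λ v → ≤-trans (≤-reflexive (trans (cong₂ _+_ (pick-sum _ j e) (pick-sum _ j e)) (cong (λ x → ⟦ x == v ⟧ + ⟦ x == v ⟧) (firsts e (valid j e refl)))))
        (two v r (≤-pred (≤-trans large (≤-reflexive (≈-length eqv)))) (λ e e∈ → firsts e (back e∈))) }
    where
    two : ∀ v (r : List (Edge n)) → 2 ≤ length r → (∀ e → e ∈ r → proj₁ e ≡ a) → ⟦ a == v ⟧ + ⟦ a == v ⟧ ≤ d₁ v r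
    two v (x ∷ []) (s≤s ()) _
    two v (x ∷ y ∷ r) _ first rewrite first x (here refl) | first y (there (here refl)) =
      ≤-trans (m≤m+n _ (d₁ v r)) (≤-reflexive (+-assoc ⟦ a == v ⟧ _ _))

  rests : ∀ g → Rest g (sel g)
  rests g = mkRest g (sel g) (proj₁ (proj₂ packing) g)

  N : List (Edge n)
  N = concatMap (λ g → rest (rests g)) allV

  tree-sum : ∀ f i → Sum f (t i) ≡ ΣF (λ g → Sum f (pick i (sel g)))
  tree-sum f i = Sum-concatMap f (λ g → pick i (sel g)) allV

  Bp-sum : ∀ f → Sum f Bp ≡ ΣF (λ i → Sum f (t i)) + Sum f N
  Bp-sum f = trans (sym (groups-sum f)) (trans (Sum-cong (λ g → rest-sum (rests g) f) allV) (trans (Sum-+ _ _ allV)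
    (cong₂ _+_ (trans (Sum-swap (λ g i → Sum f (pick i (sel g))) allV allV) (Sum-cong (λ i → sym (tree-sum f i)) allV)) (sym (Sum-concatMap f _ allV)))))

  trees-slack : ∀ v → ΣF (λ i → d₁ v (t i)) + ΣF (λ i → d₁ v (t i)) ≤ d₁ v N
  trees-slack v = begin
    ΣF (λ i → d₁ v (t i)) + ΣF (λ i → d₁ v (t i)) ≡⟨ cong₂ _+_ regroup regroup ⟩
    ΣF (λ g → ΣF (λ i → d₁ v (pick i (sel g)))) + ΣF (λ g → ΣF (λ i → d₁ v (pick i (sel g)))) ≡⟨ Sum-+ _ _ allV ⟨
    ΣF (λ g → ΣF (λ i → d₁ v (pick i (sel g))) + ΣF (λ i → d₁ v (pick i (sel g)))) ≤⟨ Sum-mono (λ g → rest-slack (rests g) v) allV ⟩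
    ΣF (λ g → d₁ v (rest (rests g))) ≡⟨ Sum-concatMap _ (λ g → rest (rests g)) allV ⟨
    d₁ v N ∎
    where
    open ≤-Reasoning
    regroup : ΣF (λ i → d₁ v (t i)) ≡ ΣF (λ g → ΣF (λ i → d₁ v (pick i (sel g))))
    regroup = trans (Sum-cong (λ i → tree-sum _ i) allV) (Sum-swap (λ i g → d₁ v (pick i (sel g))) allV allV)

  -- Three subgraphs, because a vertex of B owns at most three inner edges and each connected
  -- subgraph has an edge there.
  T₅ : List (Edge n)
  T₅ = t (# 5) ++ t (# 6) ++ t (# 7)

  split : Bp ≈ t (# 0) ++ t (# 1) ++ t (# 2) ++ t (# 3) ++ t (# 4) ++ T₅ ++ N
  split = mk λ f → trans (Bp-sum f) (trans (cong (_+ Sum f N) (ΣF-8 (λ i → Sum f (t i))))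
    (trans (lem (s f (# 0)) (s f (# 1)) (s f (# 2)) (s f (# 3)) (s f (# 4)) (s f (# 5)) (s f (# 6)) (s f (# 7)) (Sum f N)) (sym (expand f))))
    where
    s : (Edge n → ℕ) → Fin 8 → ℕ
    s f i = Sum f (t i)
    lem : ∀ a b c d e f g h x → (a + (b + (c + (d + (e + (f + (g + (h + 0)))))))) + x ≡ a + (b + (c + (d + (e + ((f + (g + h)) + x)))))
    lem = solve-∀
    expand : ∀ f → Sum f (t (# 0) ++ t (# 1) ++ t (# 2) ++ t (# 3) ++ t (# 4) ++ T₅ ++ N) ≡
      s f (# 0) + (s f (# 1) + (s f (# 2) + (s f (# 3) + (s f (# 4) + ((s f (# 5) + (s f (# 6) + s f (# 7))) + Sum f N)))))
    expand f = trans (Sum-++ f (t (# 0)) _) (cong (s f (# 0) +_) (trans (Sum-++ f (t (# 1)) _) (cong (s f (# 1) +_)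
      (trans (Sum-++ f (t (# 2)) _) (cong (s f (# 2) +_) (trans (Sum-++ f (t (# 3)) _) (cong (s f (# 3) +_)
      (trans (Sum-++ f (t (# 4)) _) (cong (s f (# 4) +_) (trans (Sum-++ f T₅ N) (cong (_+ Sum f N)
      (trans (Sum-++ f (t (# 5)) _) (cong (s f (# 5) +_) (Sum-++ f (t (# 6)) (t (# 7))))))))))))))))

  inside : Graph n
  inside = record
    { adj = λ u v → adj G u v ∧ not (side u xor side v)
    ; sym = λ u v → cong₂ (λ a b → a ∧ not b) (Graph.sym G u v) (xor-comm (side u) (side v))
    ; irrefl = λ u → cong (_∧ not (side u xor side u)) (irrefl G u) }

  ys₀ : List (YTree n)
  ys₀ = proj₁ (peel inside)
  R : Graph n
  R = proj₁ (proj₂ (peel inside))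
  free : YFree R
  free = proj₁ (proj₂ (proj₂ (proj₂ (peel inside))))
  peeled : ∀ u v → ⟦ adj inside u v ⟧ ≡ Sum (hit u v) (edgesYs ys₀) + ⟦ adj R u v ⟧
  peeled = proj₂ (proj₂ (proj₂ (proj₂ (peel inside))))

  FA FB : Fin n → Fin n → Bool
  FA u v = owned R u v ∧ side u
  FB u v = owned R u v ∧ not (side u)

  IA IB : List (Edge n)
  IA = edgeList FA
  IB = edgeList FB

  ∧-≤ : ∀ a b → ⟦ a ∧ b ⟧ ≤ ⟦ a ⟧
  ∧-≤ true b = ⟦⟧≤1 b
  ∧-≤ false b = z≤n

  IA≤3 : ∀ v → d₁ v IA ≤ 3
  IA≤3 v = ≤-trans (≤-reflexive (d₁-edgeList FA v)) (≤-trans (Sum-mono (λ j → ∧-≤ (owned R v j) (side v)) allV) (owned-degree R v))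

  IB≤3 : ∀ v → d₁ v IB ≤ 3
  IB≤3 v = ≤-trans (≤-reflexive (d₁-edgeList FB v)) (≤-trans (Sum-mono (λ j → ∧-≤ (owned R v j) (not (side v))) allV) (owned-degree R v))

  IA-side : ∀ v → side v ≡ false → d₁ v IA ≡ 0
  IA-side v Av = trans (d₁-edgeList FA v) (trans (Sum-cong (λ j → cong ⟦_⟧ (trans (cong (owned R v j ∧_) Av) (∧-zeroʳ (owned R v j)))) allV) (Sum-0 (allV {n})))

  IB-side : ∀ v → side v ≡ true → d₁ v IB ≡ 0
  IB-side v Av = trans (d₁-edgeList FB v) (trans (Sum-cong (λ j → cong ⟦_⟧ (trans (cong (λ b → owned R v j ∧ not b) Av) (∧-zeroʳ (owned R v j)))) allV) (Sum-0 (allV {n})))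

  -- By `trees-slack`, twice the degree in the cut is at most three times the degree in `N`. The
  -- former is at least 160, while a degree of 7 or less in `N` would bound it by 21.
  N-large : ∀ v → side v ≡ true → 8 ≤ d₁ v N
  N-large v Av = go (8 ≤? d₁ v N)
    where
    open ≤-Reasoning
    s : ℕ
    s = ΣF (λ i → d₁ v (t i))
    lem : ∀ s x → (s + x) + (s + x) ≡ (s + s) + (x + x)
    lem = solve-∀
    few : d₁ v N ≤ 7 → 160 ≤ 21
    few N≤7 = begin
      80 + 80 ≤⟨ +-mono-≤ (degree-large v Av) (degree-large v Av) ⟩
      d₁ v Bp + d₁ v Bp ≡⟨ cong₂ _+_ (Bp-sum _) (Bp-sum _) ⟩
      (s + d₁ v N) + (s + d₁ v N) ≡⟨ lem s (d₁ v N) ⟩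
      (s + s) + (d₁ v N + d₁ v N) ≤⟨ +-monoˡ-≤ _ (trees-slack v) ⟩
      d₁ v N + (d₁ v N + d₁ v N) ≤⟨ +-mono-≤ N≤7 (+-mono-≤ N≤7 N≤7) ⟩
      21 ∎
    go : Dec (8 ≤ d₁ v N) → 8 ≤ d₁ v N
    go (yes p) = p
    go (no p) = contradiction (few (≤-pred (≰⇒> p))) (<⇒≱ (m≤n+m 22 138))

  IA-small : ∀ v → d₁ v IA ≤ d₁ v N
  IA-small v = go (side v) refl
    where
    go : ∀ b → side v ≡ b → d₁ v IA ≤ d₁ v N
    go true Av = ≤-trans (IA≤3 v) (≤-trans (m≤n+m 3 5) (N-large v Av))
    go false Av = ≤-trans (≤-reflexive (IA-side v Av)) z≤n

  sidedT₅ : Sided side T₅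
  sidedT₅ = sided-++ˡ T₅ (sided-++ʳ (t (# 4)) (sided-++ʳ (t (# 3)) (sided-++ʳ (t (# 2)) (sided-++ʳ (t (# 1))
    (sided-++ʳ (t (# 0)) (sided-≈ split sided))))))

  reserve : ∀ v → d₁ v IB ≤ d₂ v T₅
  reserve v = go (side v) refl
    where
    go : ∀ b → side v ≡ b → d₁ v IB ≤ d₂ v T₅
    go true Av = ≤-trans (≤-reflexive (IB-side v Av)) z≤n
    go false Av = ≤-trans (IB≤3 v) (≤-trans (+-mono-≤ (one (# 5) (sided-++ˡ (t (# 5)) sidedT₅)) (+-mono-≤
        (one (# 6) (sided-++ˡ (t (# 6)) s₆₇)) (one (# 7) (sided-++ʳ (t (# 6)) s₆₇))))
        (≤-reflexive (sym (trans (d₂-++ v (t (# 5)) _) (cong (d₂ v (t (# 5)) +_) (d₂-++ v (t (# 6)) (t (# 7))))))))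
      where
      s₆₇ : Sided side (t (# 6) ++ t (# 7))
      s₆₇ = sided-++ʳ (t (# 5)) sidedT₅
      one : ∀ i → Sided side (t i) → 1 ≤ d₂ v (t i)
      one i s = ≤-trans (conn-degree {L = t i} (conn i) (proj₂ (other-vertex v))) (≤-reflexive (cong (_+ d₂ v (t i)) (d₁-sided s Av)))

  slack : ∀ v → (d₁ v (t (# 0)) + d₁ v (t (# 1)) + d₁ v (t (# 2)) + d₁ v T₅) + (d₁ v (t (# 0)) + d₁ v (t (# 1)) + d₁ v (t (# 2)) + d₁ v T₅) ≤ d₁ v N
  slack v = ≤-trans (+-mono-≤ part part) (trees-slack v)
    where
    open ≤-Reasoning
    part : d₁ v (t (# 0)) + d₁ v (t (# 1)) + d₁ v (t (# 2)) + d₁ v T₅ ≤ ΣF (λ i → d₁ v (t i))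
    part = begin
      d₁ v (t (# 0)) + d₁ v (t (# 1)) + d₁ v (t (# 2)) + d₁ v T₅
        ≡⟨ cong (d₁ v (t (# 0)) + d₁ v (t (# 1)) + d₁ v (t (# 2)) +_) (trans (d₁-++ v (t (# 5)) _) (cong (d₁ v (t (# 5)) +_) (d₁-++ v (t (# 6)) (t (# 7))))) ⟩
      d₁ v (t (# 0)) + d₁ v (t (# 1)) + d₁ v (t (# 2)) + (d₁ v (t (# 5)) + (d₁ v (t (# 6)) + d₁ v (t (# 7))))
        ≤⟨ m≤m+n _ (d₁ v (t (# 3)) + d₁ v (t (# 4))) ⟩
      (d₁ v (t (# 0)) + d₁ v (t (# 1)) + d₁ v (t (# 2)) + (d₁ v (t (# 5)) + (d₁ v (t (# 6)) + d₁ v (t (# 7))))) + (d₁ v (t (# 3)) + d₁ v (t (# 4)))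
        ≡⟨ lem (d₁ v (t (# 0))) (d₁ v (t (# 1))) (d₁ v (t (# 2))) (d₁ v (t (# 3))) (d₁ v (t (# 4))) (d₁ v (t (# 5))) (d₁ v (t (# 6))) (d₁ v (t (# 7))) ⟩
      _ ≡⟨ ΣF-8 (λ i → d₁ v (t i)) ⟨
      ΣF (λ i → d₁ v (t i)) ∎
      where
      lem : ∀ a b c d e f g h → (a + b + c + (f + (g + h))) + (d + e) ≡ a + (b + (c + (d + (e + (f + (g + (h + 0)))))))
      lem = solve-∀

  covered : ∀ u v → ⟦ adj G u v ⟧ ≡ Sum (hit u v) (edgesYs ys₀) + (Sum (hit u v) Bp + (Sum (hit u v) IA + Sum (hit u v) IB))
  covered u v = begin
    ⟦ adj G u v ⟧ ≡⟨ by-ends (adj G u v) (side u) (side v) ⟩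
    (⟦ F u v ⟧ + ⟦ adj G u v ∧ (side v ∧ not (side u)) ⟧) + ⟦ adj inside u v ⟧
      ≡⟨ cong₂ _+_ (trans (cong (λ g → ⟦ F u v ⟧ + ⟦ g ∧ (side v ∧ not (side u)) ⟧) (Graph.sym G u v)) (sym (hit-edgeList F u v))) (peeled u v) ⟩
    Sum (hit u v) Bp + (Sum (hit u v) (edgesYs ys₀) + ⟦ adj R u v ⟧)
      ≡⟨ cong (λ x → Sum (hit u v) Bp + (Sum (hit u v) (edgesYs ys₀) + x)) leftover ⟩
    Sum (hit u v) Bp + (Sum (hit u v) (edgesYs ys₀) + (Sum (hit u v) IA + Sum (hit u v) IB))
      ≡⟨ lem (Sum (hit u v) Bp) (Sum (hit u v) (edgesYs ys₀)) _ ⟩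
    Sum (hit u v) (edgesYs ys₀) + (Sum (hit u v) Bp + (Sum (hit u v) IA + Sum (hit u v) IB)) ∎
    where
    open ≡-Reasoning
    lem : ∀ a b c → a + (b + c) ≡ b + (a + c)
    lem = solve-∀
    by-ends : ∀ g a b → ⟦ g ⟧ ≡ (⟦ g ∧ (a ∧ not b) ⟧ + ⟦ g ∧ (b ∧ not a) ⟧) + ⟦ g ∧ not (a xor b) ⟧
    by-ends false _ _ = refl
    by-ends true true true = refl
    by-ends true true false = refl
    by-ends true false true = refl
    by-ends true false false = refl
    by-side : ∀ o a → ⟦ o ⟧ ≡ ⟦ o ∧ a ⟧ + ⟦ o ∧ not a ⟧
    by-side false _ = refl
    by-side true true = refl
    by-side true false = refl
    leftover : ⟦ adj R u v ⟧ ≡ Sum (hit u v) IA + Sum (hit u v) IB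
    leftover = trans (sym (owned-once R free u v)) (trans (cong₂ _+_ (by-side (owned R u v) (side u)) (by-side (owned R v u) (side v)))
      (trans (lem₂ ⟦ FA u v ⟧ ⟦ FB u v ⟧ ⟦ FA v u ⟧ ⟦ FB v u ⟧) (sym (cong₂ _+_ (hit-edgeList FA u v) (hit-edgeList FB u v)))))
      where
      lem₂ : ∀ a b c d → (a + b) + (c + d) ≡ (a + c) + (b + d)
      lem₂ = solve-∀

  edges-total : edgeCount G ≡ length (edgesYs ys₀) + (length Bp + (length IA + length IB))
  edges-total = double-cancel (trans (sym (edgeCount-double G)) (trans (Σ₂-cong covered) (trans (Σ₂-+ _ _) (trans (cong₂ _+_ (Σ₂-hit (edgesYs ys₀))
    (trans (Σ₂-+ _ _) (cong₂ _+_ (Σ₂-hit Bp) (trans (Σ₂-+ _ _) (cong₂ _+_ (Σ₂-hit IA) (Σ₂-hit IB))))))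
    (lem (length (edgesYs ys₀)) (length Bp) (length IA) (length IB))))))
    where
    lem : ∀ y b i j → (y + y) + ((b + b) + ((i + i) + (j + j))) ≡ (y + (b + (i + j))) + (y + (b + (i + j)))
    lem = solve-∀

  size : ∃ λ M → length Bp + (length IA + length IB) ≡ (M + M) + (M + M)
  size = quarter (∣m+n∣m⇒∣n (subst (4 ∣_) edges-total 4∣e) (divides (length ys₀) (length-edgesYs ys₀)))
    where
    length-edgesYs : ∀ (ys : List (YTree n)) → length (edgesYs ys) ≡ length ys * 4
    length-edgesYs [] = refl
    length-edgesYs (y ∷ ys) = cong (4 +_) (length-edgesYs ys)
    lem : ∀ k → k * 4 ≡ (k + k) + (k + k)
    lem = solve-∀
    quarter : ∀ {x} → 4 ∣ x → ∃ λ M → x ≡ (M + M) + (M + M)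
    quarter (divides k eq) = k , trans eq (lem k)

  labelling : Labelling Bp IA IB
  labelling = Label.labelling side Bp IA IB (t (# 0)) (t (# 1)) (t (# 2)) (t (# 3)) (t (# 4)) T₅ N (proj₁ size) split sided
    (conn (# 0)) (conn (# 1)) (conn (# 2)) (conn (# 3)) (conn (# 4)) reserve IA-side IB-side slack IA-small N-large (proj₂ size)

  simple : ∀ a v → Sum (λ e → ⟦ proj₁ e == a ⟧ * ⟦ proj₂ e == v ⟧) (Bp ++ IA) ≤ 1
  simple a v = begin
    Sum w (Bp ++ IA) ≡⟨ trans (Sum-++ w Bp IA) (cong₂ _+_ (trans (Sum-edgeList w F) (Σ₂-δ F a v)) (trans (Sum-edgeList w FA) (Σ₂-δ FA a v))) ⟩
    ⟦ F a v ⟧ + ⟦ FA a v ⟧ ≤⟨ +-monoʳ-≤ ⟦ F a v ⟧ (≤-trans (∧-≤ (owned R a v) (side a)) (≤-trans (∧-≤ (adj R a v) _)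
                                               (≤-trans (m≤n+m _ (Sum (hit a v) (edgesYs ys₀))) (≤-reflexive (sym (peeled a v)))))) ⟩
    ⟦ F a v ⟧ + ⟦ adj inside a v ⟧ ≤⟨ exclusive (adj G a v) (side a) (side v) ⟩
    1 ∎
    where
    open ≤-Reasoning
    w : Edge n → ℕ
    w e = ⟦ proj₁ e == a ⟧ * ⟦ proj₂ e == v ⟧
    exclusive : ∀ g a b → ⟦ g ∧ (a ∧ not b) ⟧ + ⟦ g ∧ not (a xor b) ⟧ ≤ 1
    exclusive false _ _ = z≤n
    exclusive true true true = ≤-refl
    exclusive true true false = ≤-refl
    exclusive true false true = z≤n
    exclusive true false false = ≤-refl

  decomposition : YDecomposition G
  decomposition = finish (assemble labelling simple)
    where
    good₀ : All Good ys₀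
    good₀ = proj₁ (proj₂ (proj₂ (peel inside)))
    finish : (∃ λ ys₁ → All Good ys₁ × (∀ f → Sym f → Sum f (edgesYs ys₁) ≡ Sum f (Bp ++ IA ++ IB))) → YDecomposition G
    finish (ys₁ , good₁ , sum₁) = cover⇒decomposition G (ys₀ ++ ys₁) (++⁺ good₀ good₁) λ u v → begin
      Sum (hit u v) (edgesYs (ys₀ ++ ys₁)) ≡⟨ trans (Sum-concatMap (hit u v) edgesY (ys₀ ++ ys₁)) (trans (Sum-++ (λ y → Sum (hit u v) (edgesY y)) ys₀ ys₁)
                                                                           (sym (cong₂ _+_ (Sum-concatMap (hit u v) edgesY ys₀) (Sum-concatMap (hit u v) edgesY ys₁)))) ⟩
      Sum (hit u v) (edgesYs ys₀) + Sum (hit u v) (edgesYs ys₁) ≡⟨ cong (Sum (hit u v) (edgesYs ys₀) +_) (trans (sum₁ (hit u v) (hit-sym u v))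
                                                                           (trans (Sum-++ (hit u v) Bp (IA ++ IB)) (cong (Sum (hit u v) Bp +_) (Sum-++ (hit u v) IA IB)))) ⟩
      Sum (hit u v) (edgesYs ys₀) + (Sum (hit u v) Bp + (Sum (hit u v) IA + Sum (hit u v) IB)) ≡⟨ covered u v ⟨
      ⟦ adj G u v ⟧ ∎
      where open ≡-Reasoning

theorem5 : (n : ℕ) (G : Graph n) → EdgeConnected 191 G → 4 ∣ edgeCount G → YDecomposition G
theorem5 zero G _ _ = 0 , (λ ()) , λ ()
theorem5 (suc zero) G _ _ = 0 , (λ ()) , λ { fzero fzero p → ⊥-elim (true≢false p (irrefl G fzero)) }
theorem5 (suc (suc m)) G connected 4∣e = Main.decomposition fzero other-vertex G connected 4∣e
  where
  other-vertex : (v : Fin (suc (suc m))) → ∃ λ u → u ≢ v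
  other-vertex fzero = fsuc fzero , λ ()
  other-vertex (fsuc v) = fzero , λ ()
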